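{- For every $\varepsilon>0$ there exists an integer $d_0(\varepsilon)>0$ such that for every fixed integer $d\geq d_0$, if $G$ is the uniformly random $d$-regular graph on the vertex set $[n]$ (with $dn$ even), then with probability tending to $1$ as $n\to\infty$, $$r_\ell(G,\mathcal{HAM})\geq (1-\varepsilon)d/6.$$
   Context: For a monotone increasing graph property $\mathcal{P}$ and a graph $G$, the local resilience is $r_\ell(G,\mathcal{P})=\min\{r: \exists H\subseteq G \text{ with } \Delta(H)=r \text{ and } G- H\notin\mathcal{P}\}$, where $H\subseteq G$ is a subgraph on the same vertex set, $\Delta(H)$ its maximum degree, and $G-H$ the graph obtained by deleting the edges of $H$. $\mathcal{HAM}$ denotes the property of being Hamiltonian. -}

module Defs where

open import Data.Nat using (ℕ; zero; suc; _+_; _*_; _∸_; _≤_; _<_)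
open import Data.Bool using (Bool; true; false; _∧_; not)
import Data.Bool.Properties as BoolP
open import Data.Fin using (Fin; toℕ)
open import Data.Fin.Properties using (all?)
open import Data.Vec using (Vec; []; _∷_; lookup)
open import Data.List using (List; []; _∷_; length; filter; concatMap; map)
open import Data.Product using (Σ; _×_; _,_)
open import Relation.Binary.PropositionalEquality using (_≡_)
open import Relation.Nullary using (Dec)
open import Relation.Nullary.Decidable using (_×-dec_)
open import Relation.Unary using (Decidable)
open import Function.Definitions using (Injective)

-- A (simple, undirected, loopless) graph on vertex set Fin n, represented
-- canonically by its adjacency matrix (so ≡ is graph equality).
Mat : ℕ → Set
Mat n = Vec (Vec Bool n) n

adj : {n : ℕ} → Mat n → Fin n → Fin n → Bool
adj M i j = lookup (lookup M i) j

IsGraph : {n : ℕ} → Mat n → Set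
IsGraph M = (∀ i j → adj M i j ≡ adj M j i) × (∀ i → adj M i i ≡ false)

countTrue : {n : ℕ} → Vec Bool n → ℕ
countTrue [] = 0
countTrue (true ∷ v) = suc (countTrue v)
countTrue (false ∷ v) = countTrue v

deg : {n : ℕ} → Mat n → Fin n → ℕ
deg M i = countTrue (lookup M i)

Regular : (d : ℕ) {n : ℕ} → Mat n → Set
Regular d M = IsGraph M × (∀ i → deg M i ≡ d)

regular? : (d : ℕ) {n : ℕ} → Decidable (Regular d {n})
regular? d M =
  (all? (λ i → all? (λ j → adj M i j BoolP.≟ adj M j i))
   ×-dec all? (λ i → adj M i i BoolP.≟ false))
  ×-dec all? (λ i → Data.Nat._≟_ (deg M i) d)
  where import Data.Nat

allVecs : {A : Set} → List A → (n : ℕ) → List (Vec A n)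
allVecs xs zero = [] ∷ []
allVecs xs (suc n) = concatMap (λ x → map (x ∷_) (allVecs xs n)) xs

allMats : (n : ℕ) → List (Mat n)
allMats n = allVecs (allVecs (true ∷ false ∷ []) n) n

regCount : (d n : ℕ) → ℕ
regCount d n = length (filter (regular? d) (allMats n))

SubgraphOf : {n : ℕ} → Mat n → Mat n → Set
SubgraphOf H G = IsGraph H × (∀ i j → adj H i j ≡ true → adj G i j ≡ true)

rowMinus : {m : ℕ} → Vec Bool m → Vec Bool m → Vec Bool m
rowMinus [] [] = []
rowMinus (a ∷ u) (b ∷ v) = (a ∧ not b) ∷ rowMinus u v

minusRows : {m k : ℕ} → Vec (Vec Bool m) k → Vec (Vec Bool m) k → Vec (Vec Bool m) k
minusRows [] [] = []
minusRows (g ∷ G) (h ∷ H) = rowMinus g h ∷ minusRows G H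

minus : {n : ℕ} → Mat n → Mat n → Mat n
minus = minusRows

Hamiltonian : {n : ℕ} → Mat n → Set
Hamiltonian {n} M =
  (3 ≤ n) ×
  Σ (Fin n → Fin n) λ σ →
    Injective _≡_ _≡_ σ ×
    (∀ k l → suc (toℕ k) ≡ toℕ l → adj M (σ k) (σ l) ≡ true) ×
    (∀ k l → suc (toℕ k) ≡ n → toℕ l ≡ 0 → adj M (σ k) (σ l) ≡ true)

-- r_ℓ(G, HAM) ≥ (1 - p/q) d / 6 :
-- every subgraph H with Δ(H) < (1 - p/q) d / 6 (i.e. 6 q deg_H(v) < (q - p) d
-- for all v) leaves G - H Hamiltonian.
ResilienceAtLeast : (p q d : ℕ) {n : ℕ} → Mat n → Set
ResilienceAtLeast p q d {n} G =
  (H : Mat n) → SubgraphOf H G →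
  (∀ i → 6 * deg H i * q < (q ∸ p) * d) →
  Hamiltonian (minus G H)

{-# OPTIONS --safe #-}
module Submission where

-- Everything rests on one switching estimate.  Write f(F) for the number of d-regular graphs containing an edge set F.
-- Replacing edges xy, uz by xu, yz shows that f(F + xy) is at most (1 + o(1)) f(F) r(x) r(y) / Σ r, where
-- r = d − deg_F is the residual degree.  Exposing one edge at a time inside a prescribed set therefore bounds the
-- number of regular graphs in which every vertex v of some set R has many neighbours in a given set A_v: each step
-- costs a constant factor < 1 as soon as |A_v| ≤ 3n/4 while v is required to have 4d/5 neighbours in A_v.
--
-- Union bounds then exclude three events: small sets spanning many edges; large sets X with most neighbours in a set
-- of size 3n/4; and sparse subgraphs Γ of G almost all of whose boosters are missing from G.  Outside these events,
-- deleting H with Δ(H) < d/6 leaves a graph with a sparse expanding subgraph (a few edges at each vertex, and a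
-- greedily chosen set of O(n) edges meeting every large cut).  Pósa rotations give it more than n/4 vertices u, each
-- joined by longest paths to more than n/4 vertices w; since G is not one of the exceptional graphs, some such uw is
-- an edge that survived, and adding it lengthens a longest path or closes a Hamilton cycle.  Iterate at most n times.

open import Defs
open import Data.Nat
open import Data.Nat.Properties
open import Data.Nat.DivMod using (m≡m%n+[m/n]*n; m%n<n; m<n*o⇒m/o<n; m/n*n≤m; /-monoˡ-≤; m*n/n≡m)
open import Data.Nat.Divisibility using (_∣_)
open import Data.Nat.Tactic.RingSolver using (solve-∀)
open import Data.Bool using (Bool; true; false)
import Data.Bool.Properties as B
open import Data.Fin using (Fin; zero; suc; toℕ; fromℕ<; cast)
import Data.Fin.Properties as F
open import Data.Vec as Vec using (Vec; []; _∷_; lookup)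
import Data.Vec.Properties as VecP
open import Data.List using (List; []; _∷_; _++_; _ʳ++_; length; filter; concatMap; map; take; allFin; tabulate; cartesianProduct; cartesianProductWith)
import Data.List.Properties as L
open import Data.List.Membership.Propositional using (_∈_)
open import Data.List.Membership.Propositional.Properties using (∈-filter⁺; ∈-filter⁻; ∈-allFin; ∈-∃++; ∈-lookup; ∈-concat⁺′; ∈-concat⁻′; ∈-map⁺; ∈-map⁻; ∈-cartesianProduct⁺; ∈-cartesianProductWith⁺; ∈-++⁺ˡ; ∈-++⁺ʳ; ∈-++⁻)
open import Data.List.Relation.Unary.Any using (here; there)
open import Data.List.Relation.Unary.All as All using (All; []; _∷_)
open import Data.List.Relation.Unary.AllPairs using ([]; _∷_)
open import Data.List.Relation.Unary.Linked as Linked using (Linked; []; [-]; _∷_; linked?)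
open import Data.List.Relation.Unary.Unique.Propositional using (Unique)
import Data.List.Relation.Unary.Unique.Propositional.Properties as U
open import Data.List.Relation.Binary.Permutation.Propositional using (_↭_; ↭-sym; ↭⇒↭ₛ)
open import Data.List.Relation.Binary.Permutation.Propositional.Properties using (++↭ʳ++; ∈-resp-↭; ↭-length; ++-comm)
import Data.List.Relation.Binary.Permutation.Setoid.Properties as PermS
open import Data.Product using (Σ; ∃; _×_; _,_; proj₁; proj₂)
open import Data.Product.Properties using () renaming (≡-dec to ×-≡-dec)
open import Data.Sum using (_⊎_; inj₁; inj₂)
open import Data.Empty using (⊥; ⊥-elim)
open import Relation.Binary.PropositionalEquality hiding ([_])
open import Relation.Binary.Definitions using (DecidableEquality)
open import Relation.Nullary
open import Relation.Nullary.Decidable using (_×-dec_; _⊎-dec_; _→-dec_; ¬?; map′; decidable-stable)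
open import Relation.Unary using (Decidable)
open import Function using (_∘_; id)

-- Counting with sums over lists

-- `H` may depend on `G`, and the subgraphs of maximum degree near d/6 are far too numerous for a
-- union bound; every random event below is therefore free of `H`. The thresholds follow: Pósa's
-- argument leaves at most 3n/4 non-boosters at an endpoint, which typically contain 3d/4 of its
-- neighbours. Demanding 4d/5 makes the event exponentially rare, while missing it leaves more than
-- d/5 neighbours outside, of which `H` takes less than d/6; at least d/30 survive. Boosters in turn
-- depend on the graph grown so far, itself chosen after `G` and `H`. The union over these graphs Γ
-- is affordable because Γ has O(sn) edges, with s = ⌊d/Q⌋ for a large constant Q. Exposure starts
-- at F = Γ, and the sum of f(Γ) over all Γ counts sparse subgraphs inside regular graphs, so only
-- ratios of values of f are ever estimated. Regular graphs are counted directly, without the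
-- pairing model, and all inequalities are cleared of denominators.

ι : {P : Set} → Dec P → ℕ
ι (yes _) = 1
ι (no _) = 0

ι≤1 : {P : Set} (p : Dec P) → ι p ≤ 1
ι≤1 (yes _) = ≤-refl
ι≤1 (no _) = z≤n

ι-yes : {P : Set} (p : Dec P) → P → ι p ≡ 1
ι-yes (yes _) _ = refl
ι-yes (no ¬p) p = ⊥-elim (¬p p)

ι-no : {P : Set} (p : Dec P) → ¬ P → ι p ≡ 0
ι-no (yes p) ¬p = ⊥-elim (¬p p)
ι-no (no _) _ = refl

ι≡0⇒¬ : {P : Set} (p : Dec P) → ι p ≡ 0 → ¬ P
ι≡0⇒¬ (no ¬p) _ = ¬p

ι-mono : {P Q : Set} (p : Dec P) (q : Dec Q) → (P → Q) → ι p ≤ ι q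
ι-mono (yes p) q f = ≤-reflexive (sym (ι-yes q (f p)))
ι-mono (no _) q f = z≤n

ι-cong : {P Q : Set} (p : Dec P) (q : Dec Q) → (P → Q) → (Q → P) → ι p ≡ ι q
ι-cong p q f g = ≤-antisym (ι-mono p q f) (ι-mono q p g)

ι-× : {P Q : Set} (p : Dec P) (q : Dec Q) → ι (p ×-dec q) ≡ ι p * ι q
ι-× (yes _) (yes _) = refl
ι-× (yes _) (no _) = refl
ι-× (no _) _ = refl

ι-⊎ : {P Q : Set} (p : Dec P) (q : Dec Q) → ι (p ⊎-dec q) ≤ ι p + ι q
ι-⊎ (yes _) _ = s≤s z≤n
ι-⊎ (no _) (yes _) = ≤-refl
ι-⊎ (no _) (no _) = z≤n

ι-¬ : {P : Set} (p : Dec P) → ι p + ι (¬? p) ≡ 1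
ι-¬ (yes _) = refl
ι-¬ (no _) = refl

ι-guard : {P : Set} (p : Dec P) {m k : ℕ} → (P → m ≤ k) → ι p * m ≤ ι p * k
ι-guard (yes p) h = *-monoʳ-≤ 1 (h p)
ι-guard (no _) h = z≤n

∑ : {A : Set} → List A → (A → ℕ) → ℕ
∑ [] f = 0
∑ (x ∷ xs) f = f x + ∑ xs f

syntax ∑ xs (λ x → e) = ∑[ x ∈ xs ] e

∑-mono∈ : {A : Set} (xs : List A) {f g : A → ℕ} → (∀ x → x ∈ xs → f x ≤ g x) → ∑ xs f ≤ ∑ xs g
∑-mono∈ [] h = z≤n
∑-mono∈ (x ∷ xs) h = +-mono-≤ (h x (here refl)) (∑-mono∈ xs λ y y∈ → h y (there y∈))

∑-mono : {A : Set} (xs : List A) {f g : A → ℕ} → (∀ x → f x ≤ g x) → ∑ xs f ≤ ∑ xs g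
∑-mono xs h = ∑-mono∈ xs λ x _ → h x

∑-cong∈ : {A : Set} (xs : List A) {f g : A → ℕ} → (∀ x → x ∈ xs → f x ≡ g x) → ∑ xs f ≡ ∑ xs g
∑-cong∈ xs h = ≤-antisym (∑-mono∈ xs λ x p → ≤-reflexive (h x p)) (∑-mono∈ xs λ x p → ≤-reflexive (sym (h x p)))

∑-cong : {A : Set} (xs : List A) {f g : A → ℕ} → (∀ x → f x ≡ g x) → ∑ xs f ≡ ∑ xs g
∑-cong xs h = ∑-cong∈ xs λ x _ → h x

∑-+ : {A : Set} (xs : List A) (f g : A → ℕ) → ∑ xs (λ x → f x + g x) ≡ ∑ xs f + ∑ xs g
∑-+ [] f g = refl
∑-+ (x ∷ xs) f g rewrite ∑-+ xs f g = lem (f x) (g x) (∑ xs f) (∑ xs g)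
  where
  lem : ∀ a b c d → a + b + (c + d) ≡ a + c + (b + d)
  lem = solve-∀

∑-*ˡ : {A : Set} (xs : List A) (c : ℕ) (f : A → ℕ) → ∑ xs (λ x → c * f x) ≡ c * ∑ xs f
∑-*ˡ [] c f = sym (*-zeroʳ c)
∑-*ˡ (x ∷ xs) c f rewrite ∑-*ˡ xs c f = sym (*-distribˡ-+ c (f x) (∑ xs f))

∑-*ʳ : {A : Set} (xs : List A) (c : ℕ) (f : A → ℕ) → ∑ xs (λ x → f x * c) ≡ ∑ xs f * c
∑-*ʳ xs c f = trans (∑-cong xs λ x → *-comm (f x) c) (trans (∑-*ˡ xs c f) (*-comm c _))

∑-const : {A : Set} (xs : List A) (c : ℕ) → ∑ xs (λ _ → c) ≡ length xs * c
∑-const [] c = refl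
∑-const (x ∷ xs) c = cong (c +_) (∑-const xs c)

∑-0 : {A : Set} (xs : List A) → ∑ xs (λ _ → 0) ≡ 0
∑-0 xs = trans (∑-const xs 0) (*-zeroʳ (length xs))

∑-≤const : {A : Set} (xs : List A) {f : A → ℕ} (c : ℕ) → (∀ x → x ∈ xs → f x ≤ c) → ∑ xs f ≤ length xs * c
∑-≤const xs c h = ≤-trans (∑-mono∈ xs h) (≤-reflexive (∑-const xs c))

∑-swap : {A B : Set} (xs : List A) (ys : List B) (f : A → B → ℕ) →
  ∑ xs (λ x → ∑ ys (f x)) ≡ ∑ ys (λ y → ∑ xs (λ x → f x y))
∑-swap [] ys f = sym (∑-0 ys)
∑-swap (x ∷ xs) ys f rewrite ∑-swap xs ys f = sym (∑-+ ys (f x) _)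

∑-++ : {A : Set} (xs ys : List A) (f : A → ℕ) → ∑ (xs ++ ys) f ≡ ∑ xs f + ∑ ys f
∑-++ [] ys f = refl
∑-++ (x ∷ xs) ys f = trans (cong (f x +_) (∑-++ xs ys f)) (sym (+-assoc (f x) _ _))

∑-map : {A B : Set} (g : A → B) (xs : List A) (f : B → ℕ) → ∑ (map g xs) f ≡ ∑ xs (f ∘ g)
∑-map g [] f = refl
∑-map g (x ∷ xs) f = cong (f (g x) +_) (∑-map g xs f)

∑-∈ : {A : Set} {xs : List A} {x : A} (f : A → ℕ) → x ∈ xs → f x ≤ ∑ xs f
∑-∈ {xs = x ∷ xs} f (here refl) = m≤m+n (f x) _
∑-∈ {xs = x ∷ xs} f (there p) = ≤-trans (∑-∈ f p) (m≤n+m _ (f x))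

∑≡0 : {A : Set} {xs : List A} {x : A} (f : A → ℕ) → ∑ xs f ≡ 0 → x ∈ xs → f x ≡ 0
∑≡0 f e p = n≤0⇒n≡0 (subst (f _ ≤_) e (∑-∈ f p))

# : {A : Set} {P : A → Set} → List A → Decidable P → ℕ
# xs P? = ∑ xs (λ x → ι (P? x))

#≡length : {A : Set} {P : A → Set} (xs : List A) (P? : Decidable P) → # xs P? ≡ length (filter P? xs)
#≡length [] P? = refl
#≡length (x ∷ xs) P? with P? x
... | yes _ = cong suc (#≡length xs P?)
... | no _ = #≡length xs P?

∑-filter : {A : Set} {P : A → Set} (xs : List A) (P? : Decidable P) (f : A → ℕ) →
  ∑ (filter P? xs) f ≡ ∑ xs (λ x → ι (P? x) * f x)
∑-filter [] P? f = refl
∑-filter (x ∷ xs) P? f with P? x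
... | yes _ = cong₂ _+_ (sym (+-identityʳ (f x))) (∑-filter xs P? f)
... | no _ = ∑-filter xs P? f

#≤length : {A : Set} {P : A → Set} (xs : List A) (P? : Decidable P) → # xs P? ≤ length xs
#≤length xs P? = ≤-trans (∑-≤const xs 1 λ x _ → ι≤1 (P? x)) (≤-reflexive (*-identityʳ _))

#-mono : {A : Set} {P Q : A → Set} (xs : List A) (P? : Decidable P) (Q? : Decidable Q) →
  (∀ x → P x → Q x) → # xs P? ≤ # xs Q?
#-mono xs P? Q? h = ∑-mono xs λ x → ι-mono (P? x) (Q? x) (h x)

#-cong : {A : Set} {P Q : A → Set} (xs : List A) (P? : Decidable P) (Q? : Decidable Q) →
  (∀ x → P x → Q x) → (∀ x → Q x → P x) → # xs P? ≡ # xs Q?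
#-cong xs P? Q? f g = ∑-cong xs λ x → ι-cong (P? x) (Q? x) (f x) (g x)

#-¬ : {A : Set} {P : A → Set} (xs : List A) (P? : Decidable P) → # xs P? + # xs (λ x → ¬? (P? x)) ≡ length xs
#-¬ xs P? = trans (sym (∑-+ xs _ _)) (trans (∑-cong xs λ x → ι-¬ (P? x)) (trans (∑-const xs 1) (*-identityʳ _)))

#-all : {A : Set} {P : A → Set} (xs : List A) (P? : Decidable P) → (∀ x → x ∈ xs → P x) → # xs P? ≡ length xs
#-all xs P? h = trans (∑-cong∈ xs λ x p → ι-yes (P? x) (h x p)) (trans (∑-const xs 1) (*-identityʳ _))

#-none : {A : Set} {P : A → Set} (xs : List A) (P? : Decidable P) → (∀ x → x ∈ xs → ¬ P x) → # xs P? ≡ 0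
#-none xs P? h = trans (∑-cong∈ xs λ x p → ι-no (P? x) (h x p)) (∑-0 xs)

#-⊎ : {A : Set} {P Q R : A → Set} (xs : List A) (P? : Decidable P) (Q? : Decidable Q) (R? : Decidable R) →
  (∀ x → R x → P x ⊎ Q x) → # xs R? ≤ # xs P? + # xs Q?
#-⊎ xs P? Q? R? h = ≤-trans (∑-mono xs λ x → ≤-trans (ι-mono (R? x) (P? x ⊎-dec Q? x) (h x)) (ι-⊎ (P? x) (Q? x)))
  (≤-reflexive (∑-+ xs _ _))

#≤1 : {A : Set} {P : A → Set} {xs : List A} (P? : Decidable P) → Unique xs →
  (∀ x y → P x → P y → x ≡ y) → # xs P? ≤ 1
#≤1 P? [] h = z≤n
#≤1 {xs = x ∷ xs} P? (x∉ ∷ u) h with P? x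
... | yes px = s≤s (≤-reflexive (#-none xs P? λ y y∈ py → All.lookup x∉ y∈ (h x y px py)))
... | no _ = #≤1 P? u h

#-inject : {A B : Set} {P : A → Set} {Q : B → Set} (_≟ᴮ_ : DecidableEquality B) {xs : List A} {ys : List B}
  (P? : Decidable P) (Q? : Decidable Q) (φ : A → B) → Unique xs →
  (∀ x → x ∈ xs → P x → φ x ∈ ys × Q (φ x)) →
  (∀ x y → P x → P y → φ x ≡ φ y → x ≡ y) → # xs P? ≤ # ys Q?
#-inject {B = B} _≟ᴮ_ {xs} {ys} P? Q? φ u into inj = begin
  ∑ xs (λ x → ι (P? x))
    ≤⟨ ∑-mono∈ xs step ⟩
  ∑ xs (λ x → ∑ ys (λ y → ι (Q? y) * ι (P? x ×-dec (φ x ≟ᴮ y))))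
    ≡⟨ ∑-swap xs ys _ ⟩
  ∑ ys (λ y → ∑ xs (λ x → ι (Q? y) * ι (P? x ×-dec (φ x ≟ᴮ y))))
    ≡⟨ ∑-cong ys (λ y → ∑-*ˡ xs (ι (Q? y)) _) ⟩
  ∑ ys (λ y → ι (Q? y) * # xs (λ x → P? x ×-dec (φ x ≟ᴮ y)))
    ≤⟨ ∑-mono ys (λ y → *-monoʳ-≤ (ι (Q? y)) (#≤1 (λ x → P? x ×-dec (φ x ≟ᴮ y)) u
         λ x x′ p p′ → inj x x′ (proj₁ p) (proj₁ p′) (trans (proj₂ p) (sym (proj₂ p′))))) ⟩
  ∑ ys (λ y → ι (Q? y) * 1)
    ≡⟨ ∑-cong ys (λ y → *-identityʳ _) ⟩
  ∑ ys (λ y → ι (Q? y)) ∎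
  where
  open ≤-Reasoning
  step : ∀ x → x ∈ xs → ι (P? x) ≤ ∑ ys (λ y → ι (Q? y) * ι (P? x ×-dec (φ x ≟ᴮ y)))
  step x x∈ with P? x
  ... | no _ = z≤n
  ... | yes p with into x x∈ p
  ... | y∈ , q = ≤-trans (≤-reflexive (sym (cong₂ _*_ (ι-yes (Q? (φ x)) q)
                   (ι-yes (yes p ×-dec (φ x ≟ᴮ φ x)) (p , refl)))))
                   (∑-∈ (λ y → ι (Q? y) * ι (yes p ×-dec (φ x ≟ᴮ y))) y∈)

length≤# : {A : Set} {P : A → Set} (_≟ᴬ_ : DecidableEquality A) {xs ys : List A} (P? : Decidable P) → Unique xs →
  (∀ x → x ∈ xs → x ∈ ys × P x) → length xs ≤ # ys P?
length≤# _≟ᴬ_ {xs} {ys} P? u h =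
  subst (_≤ # ys P?) (#-all xs (λ x → x ∈? xs) λ x p → p)
    (#-inject _≟ᴬ_ (λ x → x ∈? xs) P? id u (λ x x∈ _ → h x x∈) λ x y _ _ e → e)
  where open import Data.List.Membership.DecPropositional _≟ᴬ_

#≤cover : {A : Set} {P : A → Set} (_≟ᴬ_ : DecidableEquality A) {xs : List A} (P? : Decidable P) (ys : List A) → Unique xs →
  (∀ x → P x → x ∈ ys) → # xs P? ≤ length ys
#≤cover _≟ᴬ_ {xs} P? ys u h =
  subst (# xs P? ≤_) (#-all ys (λ x → x ∈? ys) λ x p → p)
    (#-inject _≟ᴬ_ P? (λ x → x ∈? ys) id u (λ x _ p → h x p , h x p) λ x y _ _ e → e)
  where open import Data.List.Membership.DecPropositional _≟ᴬ_

average : {A : Set} (x₀ : A) (xs : List A) (f : A → ℕ) → ∃ λ x → x ∈ (x₀ ∷ xs) × ∑ (x₀ ∷ xs) f ≤ length (x₀ ∷ xs) * f x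
average x₀ [] f = x₀ , here refl , ≤-refl
average x₀ (x₁ ∷ xs) f with average x₁ xs f
... | x , x∈ , le with ≤-total (f x₀) (f x)
... | inj₁ p = x , there x∈ , +-mono-≤ p le
... | inj₂ p = x₀ , here refl , +-monoʳ-≤ (f x₀) (≤-trans le (*-monoʳ-≤ (length (x₁ ∷ xs)) p))

-- Vertices, vertex sets and matrices as finite lists

V : (n : ℕ) → List (Fin n)
V = allFin

V-unique : ∀ n → Unique (V n)
V-unique n = U.tabulate⁺ id

V-length : ∀ n → length (V n) ≡ n
V-length n = L.length-tabulate id

∑-tabulate : ∀ {A : Set} {n} (g : Fin n → A) (f : A → ℕ) → ∑ (tabulate g) f ≡ ∑ (V n) (f ∘ g)
∑-tabulate {n = zero} g f = refl
∑-tabulate {n = suc n} g f = cong (f (g zero) +_)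
  (trans (∑-tabulate (g ∘ suc) f) (sym (∑-tabulate {n = n} suc (f ∘ g))))

∑V-suc : ∀ {n} (f : Fin (suc n) → ℕ) → ∑ (V (suc n)) f ≡ f zero + ∑ (V n) (f ∘ suc)
∑V-suc f = cong (f zero +_) (∑-tabulate suc f)

#-≟ : ∀ {n} (v : Fin n) → # (V n) (λ x → x F.≟ v) ≡ 1
#-≟ v = ≤-antisym (#≤1 (λ x → x F.≟ v) (V-unique _) λ x y p q → trans p (sym q))
  (≤-trans (≤-reflexive (sym (ι-yes (v F.≟ v) refl))) (∑-∈ (λ x → ι (x F.≟ v)) (∈-allFin v)))

∑-δ : ∀ {n} (v : Fin n) (f : Fin n → ℕ) → ∑ (V n) (λ x → ι (x F.≟ v) * f x) ≡ f v
∑-δ {n} v f = trans (∑-cong (V n) eq) (trans (∑-*ʳ (V n) (f v) _) (trans (cong (_* f v) (#-≟ v)) (*-identityˡ _)))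
  where
  eq : ∀ x → ι (x F.≟ v) * f x ≡ ι (x F.≟ v) * f v
  eq x with x F.≟ v
  ... | yes refl = refl
  ... | no _ = refl

choose : ∀ {n} {P : Fin n → Set} (P? : Decidable P) (k : ℕ) → k ≤ # (V n) P? →
  ∃ λ xs → length xs ≡ k × Unique xs × (∀ x → x ∈ xs → P x)
choose {n} P? k le = take k (filter P? (V n))
  , trans (L.length-take k _) (m≤n⇒m⊓n≡m (subst (k ≤_) (#≡length (V n) P?) le))
  , U.take⁺ k (U.filter⁺ P? (V-unique n))
  , λ x x∈ → proj₂ (∈-filter⁻ P? {xs = V n} (∈-take k x∈))
  where
  ∈-take : ∀ {A : Set} {x : A} k {xs : List A} → x ∈ take k xs → x ∈ xs
  ∈-take (suc k) {y ∷ xs} (here e) = here e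
  ∈-take (suc k) {y ∷ xs} (there p) = there (∈-take k p)

^-distribʳ-* : ∀ n a b → (a * b) ^ n ≡ a ^ n * b ^ n
^-distribʳ-* zero a b = refl
^-distribʳ-* (suc n) a b = trans (cong (a * b *_) (^-distribʳ-* n a b)) (r a b (a ^ n) (b ^ n))
  where
  r : ∀ a b c e → a * b * (c * e) ≡ a * c * (b * e)
  r = solve-∀

-- Opens `allVecs` to the facts about products of lists, for uniqueness and membership.
concatMap≡product : ∀ {A B C : Set} (f : A → B → C) xs ys →
  concatMap (λ x → map (f x) ys) xs ≡ cartesianProductWith f xs ys
concatMap≡product f [] ys = refl
concatMap≡product f (x ∷ xs) ys = cong (map (f x) ys Data.List.++_) (concatMap≡product f xs ys)

allVecs-unique : ∀ {A : Set} {xs : List A} → Unique xs → ∀ k → Unique (allVecs xs k)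
allVecs-unique u zero = [] ∷ []
allVecs-unique {xs = xs} u (suc k) = subst Unique (sym (concatMap≡product _∷_ xs (allVecs xs k)))
  (U.cartesianProductWith⁺ _∷_ VecP.∷-injective u (allVecs-unique u k))

∈-allVecs : ∀ {A : Set} {xs : List A} {k} (v : Vec A k) → (∀ i → lookup v i ∈ xs) → v ∈ allVecs xs k
∈-allVecs [] h = here refl
∈-allVecs {xs = xs} {suc k} (x ∷ v) h = subst (x ∷ v ∈_) (sym (concatMap≡product _∷_ xs (allVecs xs k)))
  (∈-cartesianProductWith⁺ _∷_ (h zero) (∈-allVecs v (h ∘ suc)))

bools : List Bool
bools = true ∷ false ∷ []

∈-bools : ∀ b → b ∈ bools
∈-bools true = here refl
∈-bools false = there (here refl)

bools-unique : Unique bools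
bools-unique = ((λ ()) ∷ []) ∷ ([] ∷ [])

∈-allMats : ∀ {n} (M : Mat n) → M ∈ allMats n
∈-allMats M = ∈-allVecs M λ i → ∈-allVecs (lookup M i) λ j → ∈-bools _

allMats-unique : ∀ n → Unique (allMats n)
allMats-unique n = allVecs-unique (allVecs-unique bools-unique n) n

_≟ᴹ_ : ∀ {n} → DecidableEquality (Mat n)
_≟ᴹ_ = VecP.≡-dec (VecP.≡-dec B._≟_)

-- Edge sets

Rel : ℕ → Set
Rel n = Fin n → Fin n → Bool

-- Computes as soon as the decision is known, so that a `with` on `pair?` or `inE?` settles the
-- value of `ins` or `gr`.
_orDec_ : ∀ {P : Set} → Bool → Dec P → Bool
b orDec yes _ = true
b orDec no _ = b

module _ {n : ℕ} where

  at : Rel n → Fin n → Fin n → Set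
  at F i j = F i j ≡ true

  at? : (F : Rel n) (i j : Fin n) → Dec (at F i j)
  at? F i j = F i j B.≟ true

  Sym : Rel n → Set
  Sym F = ∀ i j → at F i j → at F j i

  dg : Rel n → Fin n → ℕ
  dg F v = # (V n) (at? F v)

  -- Counts ordered pairs, hence twice the edges of a symmetric loopless `F`; all budgets below are
  -- in this unit.
  tot : Rel n → ℕ
  tot F = ∑ (V n) (dg F)

  Pair : Fin n → Fin n → Fin n → Fin n → Set
  Pair a b i j = (i ≡ a × j ≡ b) ⊎ (i ≡ b × j ≡ a)

  pair? : ∀ a b i j → Dec (Pair a b i j)
  pair? a b i j = ((i F.≟ a) ×-dec (j F.≟ b)) ⊎-dec ((i F.≟ b) ×-dec (j F.≟ a))

  ins : Rel n → Fin n → Fin n → Rel n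
  ins F a b i j = F i j orDec pair? a b i j

  ins⁻ : ∀ F a b i j → at (ins F a b) i j → at F i j ⊎ Pair a b i j
  ins⁻ F a b i j e with pair? a b i j
  ... | yes p = inj₂ p
  ... | no _ = inj₁ e

  ins-old : ∀ F a b i j → at F i j → at (ins F a b) i j
  ins-old F a b i j e with pair? a b i j
  ... | yes _ = refl
  ... | no _ = e

  ins-new : ∀ F a b i j → Pair a b i j → at (ins F a b) i j
  ins-new F a b i j p with pair? a b i j
  ... | yes _ = refl
  ... | no ¬p = ⊥-elim (¬p p)

  pair-sym : ∀ {a b i j} → Pair a b i j → Pair a b j i
  pair-sym (inj₁ (p , q)) = inj₂ (q , p)
  pair-sym (inj₂ (p , q)) = inj₁ (q , p)

  ins-sym : ∀ {F a b} → Sym F → Sym (ins F a b)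
  ins-sym {F} {a} {b} s i j e with ins⁻ F a b i j e
  ... | inj₁ p = ins-old F a b j i (s i j p)
  ... | inj₂ p = ins-new F a b j i (pair-sym p)

  ι-pair≤ : ∀ a b i j → ι (pair? a b i j) ≤ ι (i F.≟ a) * ι (j F.≟ b) + ι (i F.≟ b) * ι (j F.≟ a)
  ι-pair≤ a b i j = ≤-trans (ι-⊎ ((i F.≟ a) ×-dec (j F.≟ b)) ((i F.≟ b) ×-dec (j F.≟ a)))
    (≤-reflexive (cong₂ _+_ (ι-× (i F.≟ a) (j F.≟ b)) (ι-× (i F.≟ b) (j F.≟ a))))

  ∑-δδ : ∀ (a b i : Fin n) → ∑ (V n) (λ j → ι (i F.≟ a) * ι (j F.≟ b) + ι (i F.≟ b) * ι (j F.≟ a)) ≡ ι (i F.≟ a) + ι (i F.≟ b)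
  ∑-δδ a b i = trans (∑-+ (V n) _ _) (cong₂ _+_ (one a b) (one b a))
    where
    one : ∀ a b → ∑ (V n) (λ j → ι (i F.≟ a) * ι (j F.≟ b)) ≡ ι (i F.≟ a)
    one a b = trans (∑-*ˡ (V n) (ι (i F.≟ a)) (λ j → ι (j F.≟ b))) (trans (cong (ι (i F.≟ a) *_) (#-≟ b)) (*-identityʳ _))

  deg-pair≤ : ∀ a b i → ∑ (V n) (λ j → ι (pair? a b i j)) ≤ ι (i F.≟ a) + ι (i F.≟ b)
  deg-pair≤ a b i = ≤-trans (∑-mono (V n) (ι-pair≤ a b i)) (≤-reflexive (∑-δδ a b i))

  deg-pair : ∀ {a b} → a ≢ b → ∀ i → ∑ (V n) (λ j → ι (pair? a b i j)) ≡ ι (i F.≟ a) + ι (i F.≟ b)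
  deg-pair {a} {b} a≢b i = trans (∑-cong (V n) eq) (∑-δδ a b i)
    where
    eq : ∀ j → ι (pair? a b i j) ≡ ι (i F.≟ a) * ι (j F.≟ b) + ι (i F.≟ b) * ι (j F.≟ a)
    eq j with i F.≟ a | j F.≟ b | i F.≟ b | j F.≟ a
    ... | yes p | yes q | yes r | _ = ⊥-elim (a≢b (trans (sym p) r))
    ... | yes p | no q | yes r | _ = ⊥-elim (a≢b (trans (sym p) r))
    ... | yes p | yes q | no r | _ = refl
    ... | yes p | no q | no r | _ = refl
    ... | no p | q | yes r | yes s = refl
    ... | no p | q | yes r | no s = refl
    ... | no p | q | no r | s = refl

  tot-pair≤ : ∀ a b → ∑ (V n) (λ i → ∑ (V n) (λ j → ι (pair? a b i j))) ≤ 2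
  tot-pair≤ a b = ≤-trans (∑-mono (V n) (deg-pair≤ a b))
    (≤-reflexive (trans (∑-+ (V n) _ _) (cong₂ _+_ (#-≟ a) (#-≟ b))))

  tot-ins : ∀ F a b → tot (ins F a b) ≤ tot F + 2
  tot-ins F a b = begin
    tot (ins F a b)
      ≤⟨ ∑-mono (V n) (λ i → #-⊎ (V n) (at? F i) (pair? a b i) (at? (ins F a b) i) (ins⁻ F a b i)) ⟩
    ∑ (V n) (λ i → dg F i + ∑ (V n) (λ j → ι (pair? a b i j)))
      ≡⟨ ∑-+ (V n) _ _ ⟩
    tot F + ∑ (V n) (λ i → ∑ (V n) (λ j → ι (pair? a b i j)))
      ≤⟨ +-monoʳ-≤ (tot F) (tot-pair≤ a b) ⟩
    tot F + 2 ∎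
    where open ≤-Reasoning

  toMat : Rel n → Mat n
  toMat f = Vec.tabulate λ i → Vec.tabulate (f i)

  adj-toMat : ∀ f i j → adj (toMat f) i j ≡ f i j
  adj-toMat f i j = trans (cong (λ v → lookup v j) (VecP.lookup∘tabulate _ i)) (VecP.lookup∘tabulate _ j)

  vec-ext : ∀ {A : Set} {k} {u v : Vec A k} → (∀ i → lookup u i ≡ lookup v i) → u ≡ v
  vec-ext {u = u} {v} h = trans (sym (VecP.tabulate∘lookup u)) (trans (VecP.tabulate-cong h) (VecP.tabulate∘lookup v))

  mat-ext : {M N : Mat n} → (∀ i j → adj M i j ≡ adj N i j) → M ≡ N
  mat-ext h = vec-ext λ i → vec-ext (h i)

  infix 4 _⊑_
  _⊑_ : Rel n → Rel n → Set
  F ⊑ G = ∀ i j → at F i j → at G i j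

  _⊑?_ : ∀ F G → Dec (F ⊑ G)
  F ⊑? G = F.all? λ i → F.all? λ j → at? F i j →-dec at? G i j

  ⊑-ins : ∀ F G a b → Sym G → F ⊑ G → at G a b → ins F a b ⊑ G
  ⊑-ins F G a b s sub e i j h with ins⁻ F a b i j h
  ... | inj₁ p = sub i j p
  ... | inj₂ (inj₁ (refl , refl)) = e
  ... | inj₂ (inj₂ (refl , refl)) = s a b e

  ins⊑⇒⊑ : ∀ F G a b → ins F a b ⊑ G → F ⊑ G
  ins⊑⇒⊑ F G a b h i j e = h i j (ins-old F a b i j e)

countTrue≡# : ∀ {m} (v : Vec Bool m) → countTrue v ≡ # (V m) (λ j → lookup v j B.≟ true)
countTrue≡# [] = refl
countTrue≡# (true ∷ v) = trans (cong suc (countTrue≡# v)) (sym (∑V-suc (λ j → ι (lookup (true ∷ v) j B.≟ true))))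
countTrue≡# (false ∷ v) = trans (countTrue≡# v) (sym (∑V-suc (λ j → ι (lookup (false ∷ v) j B.≟ true))))

deg≡dg : ∀ {n} (M : Mat n) i → deg M i ≡ dg (adj M) i
deg≡dg M i = countTrue≡# (lookup M i)

≢true : ∀ {b} → ¬ b ≡ true → b ≡ false
≢true {true} h = ⊥-elim (h refl)
≢true {false} h = refl

bool-ext : ∀ {b c} → (b ≡ true → c ≡ true) → (c ≡ true → b ≡ true) → b ≡ c
bool-ext {true} f g = sym (f refl)
bool-ext {false} {true} f g = g refl
bool-ext {false} {false} f g = refl

module _ (d n : ℕ) where

  Reg : List (Mat n)
  Reg = filter (regular? d) (allMats n)

  Reg-unique : Unique Reg
  Reg-unique = U.filter⁺ (regular? d) (allMats-unique n)

  cnt : Rel n → ℕ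
  cnt F = # Reg (λ G → F ⊑? adj G)

  res : Rel n → Fin n → ℕ
  res F v = d ∸ dg F v

  totres : Rel n → ℕ
  totres F = ∑ (V n) (res F)

  -- The ordered edges `uz` that may be ineligible for switching with `xy`: `d` with `u = x`, `d`
  -- with `z = y`, and `d * d` each with `u` adjacent to `x` or with `z` adjacent to `y`.
  slack : ℕ
  slack = 2 * d * (d + 1)

module _ {d n : ℕ} where

  ∈Reg : ∀ {G} → Regular d G → G ∈ Reg d n
  ∈Reg {G} r = ∈-filter⁺ (regular? d) (∈-allMats G) r

  Reg⇒ : ∀ {G} → G ∈ Reg d n → Regular d G
  Reg⇒ p = proj₂ (∈-filter⁻ (regular? d) {xs = allMats n} p)

  reg-sym : ∀ (G : Mat n) → Regular d G → Sym (adj G)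
  reg-sym G ((s , _) , _) i j e = trans (sym (s i j)) e

  reg-irr : ∀ (G : Mat n) → Regular d G → ∀ {i j} → at (adj G) i j → i ≢ j
  reg-irr G ((_ , l) , _) {i} e refl with trans (sym e) (l i)
  ... | ()

  reg-dg : ∀ (G : Mat n) → Regular d G → ∀ i → dg (adj G) i ≡ d
  reg-dg G (_ , r) i = trans (sym (deg≡dg G i)) (r i)

  residual : ∀ (G : Mat n) F → Regular d G → F ⊑ adj G → ∀ v →
    # (V n) (λ y → at? (adj G) v y ×-dec ¬? (at? F v y)) ≡ res d n F v
  residual G F r sub v = sym (trans (cong (_∸ dg F v) (sym total)) (m+n∸n≡m _ (dg F v)))
    where
    total : # (V n) (λ y → at? (adj G) v y ×-dec ¬? (at? F v y)) + dg F v ≡ d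
    total = trans (sym (∑-+ (V n) _ _)) (trans (∑-cong (V n) eq) (reg-dg G r v))
      where
      eq : ∀ y → ι (at? (adj G) v y ×-dec ¬? (at? F v y)) + ι (at? F v y) ≡ ι (at? (adj G) v y)
      eq y with at? (adj G) v y | at? F v y
      ... | yes p | yes q = refl
      ... | yes p | no q = refl
      ... | no p | yes q = ⊥-elim (p (sub v y q))
      ... | no p | no q = refl

-- Switchings

swb : ∀ {P₁ P₂ P₃ P₄ : Set} → Dec P₁ → Dec P₂ → Dec P₃ → Dec P₄ → Bool → Bool
swb (yes _) _ _ _ b = false
swb (no _) (yes _) _ _ b = false
swb (no _) (no _) (yes _) _ b = true
swb (no _) (no _) (no _) (yes _) b = true
swb (no _) (no _) (no _) (no _) b = b

module Switch {d n : ℕ} (F : Rel n) (F-sym : Sym F) (x y : Fin n) (x∉ : ¬ at F x y) where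

  swf : Fin n → Fin n → Mat n → Rel n
  swf u z G i j = swb (pair? x y i j) (pair? u z i j) (pair? x u i j) (pair? y z i j) (adj G i j)

  sw : Fin n → Fin n → Mat n → Mat n
  sw u z G = toMat (swf u z G)

  -- Once `xy` is an edge, `u ≢ y` and `z ≢ x` follow from the absence of `xu` and `yz`. The edge
  -- `uz` has to lie outside `F` so that the switched graph still contains `F`.
  New : Fin n → Fin n → Mat n → Set
  New u z G = (at (adj G) u z × ¬ at F u z) × (u ≢ x × z ≢ y × ¬ at (adj G) x u × ¬ at (adj G) y z)

  Valid : Fin n → Fin n → Mat n → Set
  Valid u z G = ins F x y ⊑ adj G × New u z G

  new? : ∀ u z G → Dec (New u z G)
  new? u z G = (at? (adj G) u z ×-dec ¬? (at? F u z)) ×-dec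
    (¬? (u F.≟ x) ×-dec ¬? (z F.≟ y) ×-dec ¬? (at? (adj G) x u) ×-dec ¬? (at? (adj G) y z))

  valid? : ∀ u z G → Dec (Valid u z G)
  valid? u z G = (ins F x y ⊑? adj G) ×-dec new? u z G

  -- What the switched graph still shows: `u` and `z` are neighbours of `x` and `y` outside `F`.
  -- This alone limits the preimages to `res x * res y` pairs.
  Valid′ : Fin n → Fin n → Mat n → Set
  Valid′ u z G = F ⊑ adj G × (at (adj G) x u × ¬ at F x u) × (at (adj G) y z × ¬ at F y z)

  valid′? : ∀ u z G → Dec (Valid′ u z G)
  valid′? u z G = (F ⊑? adj G) ×-dec (at? (adj G) x u ×-dec ¬? (at? F x u)) ×-dec (at? (adj G) y z ×-dec ¬? (at? F y z))

  same : ∀ {a b c e i j : Fin n} → Pair a b i j → Pair c e i j → (a ≡ c × b ≡ e) ⊎ (a ≡ e × b ≡ c)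
  same (inj₁ (refl , refl)) (inj₁ (refl , refl)) = inj₁ (refl , refl)
  same (inj₁ (refl , refl)) (inj₂ (refl , refl)) = inj₂ (refl , refl)
  same (inj₂ (refl , refl)) (inj₁ (refl , refl)) = inj₂ (refl , refl)
  same (inj₂ (refl , refl)) (inj₂ (refl , refl)) = inj₁ (refl , refl)

  module _ (u z : Fin n) (G : Mat n) (r : Regular d G) (v : Valid u z G) where
    private
      g = adj G
      gs = reg-sym {d} G r
      sub = proj₁ v
      gxy : at g x y
      gxy = sub x y (ins-new F x y x y (inj₁ (refl , refl)))
      guz = proj₁ (proj₁ (proj₂ v))
      u≢x = proj₁ (proj₂ (proj₂ v))
      z≢y = proj₁ (proj₂ (proj₂ (proj₂ v)))
      ¬xu = proj₁ (proj₂ (proj₂ (proj₂ (proj₂ v))))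
      ¬yz = proj₂ (proj₂ (proj₂ (proj₂ (proj₂ v))))
      x≢y = reg-irr G r gxy
      u≢z = reg-irr G r guz
      x≢z : x ≢ z
      x≢z refl = ¬yz (gs x y gxy)

      g-pair : ∀ {a b i j} → at g a b → Pair a b i j → at g i j
      g-pair e (inj₁ (refl , refl)) = e
      g-pair e (inj₂ (refl , refl)) = gs _ _ e

      ¬g-pair : ∀ {a b i j} → ¬ at g a b → Pair a b i j → ¬ at g i j
      ¬g-pair e (inj₁ (refl , refl)) = e
      ¬g-pair e (inj₂ (refl , refl)) = e ∘ gs _ _

      no-edge : ∀ {i j} → Pair x u i j ⊎ Pair y z i j → ¬ at g i j
      no-edge (inj₁ q) = ¬g-pair ¬xu q
      no-edge (inj₂ q) = ¬g-pair ¬yz q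

      xy/uz : ∀ {i j} → Pair x y i j → ¬ Pair u z i j
      xy/uz p q with same p q
      ... | inj₁ (e , _) = u≢x (sym e)
      ... | inj₂ (e , _) = x≢z e

      xu/yz : ∀ {i j} → Pair x u i j → ¬ Pair y z i j
      xu/yz p q with same p q
      ... | inj₁ (e , _) = x≢y e
      ... | inj₂ (e , _) = x≢z e

    sw-cases : ∀ i j → at (swf u z G) i j → at g i j ⊎ (Pair x u i j ⊎ Pair y z i j)
    sw-cases i j e with pair? x y i j | pair? u z i j | pair? x u i j | pair? y z i j
    ... | no _ | no _ | yes p | _ = inj₂ (inj₁ p)
    ... | no _ | no _ | no _ | yes p = inj₂ (inj₂ p)
    ... | no _ | no _ | no _ | no _ = inj₁ e

    sw-kept : ∀ i j → ¬ Pair x y i j → ¬ Pair u z i j → at g i j → at (swf u z G) i j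
    sw-kept i j ¬p ¬q e with pair? x y i j | pair? u z i j | pair? x u i j | pair? y z i j
    ... | yes p | _ | _ | _ = ⊥-elim (¬p p)
    ... | no _ | yes q | _ | _ = ⊥-elim (¬q q)
    ... | no _ | no _ | yes p | _ = refl
    ... | no _ | no _ | no _ | yes p = refl
    ... | no _ | no _ | no _ | no _ = e

    sw-added : ∀ i j → Pair x u i j ⊎ Pair y z i j → at (swf u z G) i j
    sw-added i j pq with pair? x y i j | pair? u z i j | pair? x u i j | pair? y z i j
    ... | yes p | _ | _ | _ = ⊥-elim (no-edge pq (g-pair gxy p))
    ... | no _ | yes p | _ | _ = ⊥-elim (no-edge pq (g-pair guz p))
    ... | no _ | no _ | yes p | _ = refl
    ... | no _ | no _ | no _ | yes p = refl
    sw-added i j (inj₁ p) | no _ | no _ | no ¬p | no ¬q = ⊥-elim (¬p p)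
    sw-added i j (inj₂ q) | no _ | no _ | no ¬p | no ¬q = ⊥-elim (¬q q)

    sw-removed : ∀ i j → Pair x y i j ⊎ Pair u z i j → ¬ at (swf u z G) i j
    sw-removed i j pq e with pair? x y i j | pair? u z i j
    sw-removed i j (inj₁ p) e | no ¬p | no ¬q = ¬p p
    sw-removed i j (inj₂ q) e | no ¬p | no ¬q = ¬q q

    -- The removed edges are distinct and lie in `G`, the added ones are distinct and do not, so the
    -- entries balance one by one. Summed along a row, each of `x`, `y`, `u`, `z` loses one edge and
    -- gains one.
    balance : ∀ i j → ι (at? (swf u z G) i j) + (ι (pair? x y i j) + ι (pair? u z i j)) ≡
      ι (at? g i j) + (ι (pair? x u i j) + ι (pair? y z i j))
    balance i j with pair? x y i j | pair? u z i j | pair? x u i j | pair? y z i j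
    ... | yes p | yes q | _ | _ = ⊥-elim (xy/uz p q)
    ... | yes p | no _ | yes q | _ = ⊥-elim (¬g-pair ¬xu q (g-pair gxy p))
    ... | yes p | no _ | no _ | yes q = ⊥-elim (¬g-pair ¬yz q (g-pair gxy p))
    ... | yes p | no _ | no _ | no _ rewrite g-pair gxy p = refl
    ... | no _ | yes p | yes q | _ = ⊥-elim (¬g-pair ¬xu q (g-pair guz p))
    ... | no _ | yes p | no _ | yes q = ⊥-elim (¬g-pair ¬yz q (g-pair guz p))
    ... | no _ | yes p | no _ | no _ rewrite g-pair guz p = refl
    ... | no _ | no _ | yes p | yes q = ⊥-elim (xu/yz p q)
    ... | no _ | no _ | yes p | no _ rewrite ≢true (¬g-pair ¬xu p) = refl
    ... | no _ | no _ | no _ | yes p rewrite ≢true (¬g-pair ¬yz p) = refl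
    ... | no _ | no _ | no _ | no _ = refl

    sw-dg : ∀ i → dg (swf u z G) i ≡ d
    sw-dg i = trans (+-cancelʳ-≡ _ _ _ (begin
      dg (swf u z G) i + ∑ (V n) (λ j → ι (pair? x y i j) + ι (pair? u z i j))
        ≡⟨ ∑-+ (V n) _ _ ⟨
      ∑ (V n) (λ j → ι (at? (swf u z G) i j) + (ι (pair? x y i j) + ι (pair? u z i j)))
        ≡⟨ ∑-cong (V n) (balance i) ⟩
      ∑ (V n) (λ j → ι (at? g i j) + (ι (pair? x u i j) + ι (pair? y z i j)))
        ≡⟨ ∑-+ (V n) _ _ ⟩
      dg g i + ∑ (V n) (λ j → ι (pair? x u i j) + ι (pair? y z i j))
        ≡⟨ cong (dg g i +_) (trans (∑-+ (V n) _ _) (trans (cong₂ _+_ (deg-pair (u≢x ∘ sym) i) (deg-pair (z≢y ∘ sym) i))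
             (trans (shuffle (ι (i F.≟ x)) (ι (i F.≟ u)) (ι (i F.≟ y)) (ι (i F.≟ z)))
             (sym (trans (∑-+ (V n) _ _) (cong₂ _+_ (deg-pair x≢y i) (deg-pair u≢z i))))))) ⟩
      dg g i + ∑ (V n) (λ j → ι (pair? x y i j) + ι (pair? u z i j)) ∎)) (reg-dg G r i)
      where
      open ≡-Reasoning
      shuffle : ∀ a b c e → a + b + (c + e) ≡ a + c + (b + e)
      shuffle = solve-∀

    swf-sym : ∀ i j → swf u z G i j ≡ swf u z G j i
    swf-sym i j = bool-ext (half i j) (half j i)
      where
      half : ∀ i j → at (swf u z G) i j → at (swf u z G) j i
      half i j e with sw-cases i j e
      ... | inj₁ p = sw-kept j i (λ q → sw-removed i j (inj₁ (pair-sym q)) e) (λ q → sw-removed i j (inj₂ (pair-sym q)) e) (gs i j p)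
      ... | inj₂ (inj₁ p) = sw-added j i (inj₁ (pair-sym p))
      ... | inj₂ (inj₂ p) = sw-added j i (inj₂ (pair-sym p))

    swf-irr : ∀ i → swf u z G i i ≡ false
    swf-irr i = ≢true λ e → case (sw-cases i i e)
      where
      case : ¬ (at g i i ⊎ (Pair x u i i ⊎ Pair y z i i))
      case (inj₁ p) = reg-irr G r p refl
      case (inj₂ (inj₁ (inj₁ (p , q)))) = u≢x (trans (sym q) p)
      case (inj₂ (inj₁ (inj₂ (p , q)))) = u≢x (trans (sym p) q)
      case (inj₂ (inj₂ (inj₁ (p , q)))) = z≢y (trans (sym q) p)
      case (inj₂ (inj₂ (inj₂ (p , q)))) = z≢y (trans (sym p) q)

    sw-regular : Regular d (sw u z G)
    sw-regular = ((λ i j → trans (adj-toMat _ i j) (trans (swf-sym i j) (sym (adj-toMat _ j i))))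
      , λ i → trans (adj-toMat _ i i) (swf-irr i))
      , λ i → trans (deg≡dg (sw u z G) i)
          (trans (∑-cong (V n) λ j → cong (λ b → ι (b B.≟ true)) (adj-toMat (swf u z G) i j)) (sw-dg i))

    sw-valid′ : Valid′ u z (sw u z G)
    sw-valid′ = (λ i j e → into i j (sw-kept i j (λ p → ¬F-pair x∉ p e) (λ p → ¬F-pair (proj₂ (proj₁ (proj₂ v))) p e)
                   (sub i j (ins-old F x y i j e))))
      , (into x u (sw-added x u (inj₁ (inj₁ (refl , refl)))) , λ e → ¬xu (sub x u (ins-old F x y x u e)))
      , (into y z (sw-added y z (inj₂ (inj₁ (refl , refl)))) , λ e → ¬yz (sub y z (ins-old F x y y z e)))
      where
      into : ∀ i j → at (swf u z G) i j → at (adj (sw u z G)) i j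
      into i j e = trans (adj-toMat _ i j) e
      ¬F-pair : ∀ {a b i j} → ¬ at F a b → Pair a b i j → ¬ at F i j
      ¬F-pair h (inj₁ (refl , refl)) e = h e
      ¬F-pair h (inj₂ (refl , refl)) e = h (F-sym _ _ e)

    -- For injectivity: an edge of `G` is either one of the two removed, known from `x`, `y`, `u`,
    -- `z` alone, or is visible in the switched graph apart from the added edges.
    sw-back : ∀ i j → at g i j → (Pair x y i j ⊎ Pair u z i j) ⊎ (at (swf u z G) i j × ¬ Pair x u i j × ¬ Pair y z i j)
    sw-back i j e with pair? x y i j | pair? u z i j in eq
    ... | yes p | _ = inj₁ (inj₁ p)
    ... | no _ | yes q = inj₁ (inj₂ q)
    ... | no ¬p | no ¬q = inj₂ (lemma , (λ p → ¬g-pair ¬xu p e) , λ p → ¬g-pair ¬yz p e)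
      where
      lemma : swb {P₁ = Pair x y i j} {P₂ = Pair u z i j} (no ¬p) (no ¬q) (pair? x u i j) (pair? y z i j) (adj G i j) ≡ true
      lemma with pair? x u i j | pair? y z i j
      ... | yes _ | _ = refl
      ... | no _ | yes _ = refl
      ... | no _ | no _ = e

    forced : ∀ i j → Pair x y i j ⊎ Pair u z i j → at g i j
    forced i j (inj₁ p) = g-pair gxy p
    forced i j (inj₂ p) = g-pair guz p

  sw-injective : ∀ u z G H → Regular d G → Valid u z G → Regular d H → Valid u z H → sw u z G ≡ sw u z H → G ≡ H
  sw-injective u z G H rG vG rH vH e = mat-ext λ i j → bool-ext (half G H rG vG rH vH e i j) (half H G rH vH rG vG (sym e) i j)
    where
    half : ∀ G H → Regular d G → Valid u z G → Regular d H → Valid u z H → sw u z G ≡ sw u z H →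
      ∀ i j → at (adj G) i j → at (adj H) i j
    half G H rG vG rH vH e i j p with sw-back u z G rG vG i j p
    ... | inj₁ q = forced u z H rH vH i j q
    ... | inj₂ (s , ¬xu , ¬yz) with sw-cases u z H rH vH i j
            (trans (sym (adj-toMat (swf u z H) i j)) (trans (cong (λ M → adj M i j) (sym e)) (trans (adj-toMat (swf u z G) i j) s)))
    ... | inj₁ t = t
    ... | inj₂ (inj₁ t) = ⊥-elim (¬xu t)
    ... | inj₂ (inj₂ t) = ⊥-elim (¬yz t)

  #valid≤ : ∀ u z → # (Reg d n) (valid? u z) ≤ # (Reg d n) (valid′? u z)
  #valid≤ u z = ≤-trans (∑-mono∈ (Reg d n) λ G G∈ → ι-mono (valid? u z G) (regular? d G ×-dec valid? u z G) λ v → Reg⇒ G∈ , v)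
    (#-inject _≟ᴹ_ (λ G → regular? d G ×-dec valid? u z G) (valid′? u z) (sw u z) (Reg-unique d n)
      (λ G _ (r , v) → ∈Reg (sw-regular u z G r v) , sw-valid′ u z G r v)
      (λ G H (rG , vG) (rH , vH) → sw-injective u z G H rG vG rH vH))

  reverse-count : ∑ (V n) (λ u → ∑ (V n) (λ z → # (Reg d n) (valid′? u z))) ≡ cnt d n F * (res d n F x * res d n F y)
  reverse-count = begin
    ∑ (V n) (λ u → ∑ (V n) (λ z → # (Reg d n) (valid′? u z)))
      ≡⟨ ∑-cong (V n) (λ u → ∑-swap (V n) (Reg d n) _) ⟩
    ∑ (V n) (λ u → ∑ (Reg d n) (λ G → ∑ (V n) (λ z → ι (valid′? u z G))))
      ≡⟨ ∑-swap (V n) (Reg d n) _ ⟩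
    ∑ (Reg d n) (λ G → ∑ (V n) (λ u → ∑ (V n) (λ z → ι (valid′? u z G))))
      ≡⟨ ∑-cong∈ (Reg d n) (λ G G∈ → perG G (Reg⇒ G∈)) ⟩
    ∑ (Reg d n) (λ G → ι (F ⊑? adj G) * (res d n F x * res d n F y))
      ≡⟨ ∑-*ʳ (Reg d n) _ _ ⟩
    cnt d n F * (res d n F x * res d n F y) ∎
    where
    open ≡-Reasoning
    perG : ∀ G → Regular d G → ∑ (V n) (λ u → ∑ (V n) (λ z → ι (valid′? u z G))) ≡ ι (F ⊑? adj G) * (res d n F x * res d n F y)
    perG G r = trans (∑-cong (V n) λ u → trans (∑-cong (V n) λ z → trans (ι-× (F ⊑? adj G) _) (cong (ι (F ⊑? adj G) *_) (ι-× (α u) (β z))))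
        (trans (∑-*ˡ (V n) (ι (F ⊑? adj G)) _) (cong (ι (F ⊑? adj G) *_) (∑-*ˡ (V n) (ι (α u)) (λ z → ι (β z))))))
      (trans (∑-*ˡ (V n) (ι (F ⊑? adj G)) _) (trans (cong (ι (F ⊑? adj G) *_) (∑-*ʳ (V n) (# (V n) β) (λ u → ι (α u)))) fin))
      where
      α : ∀ u → Dec (at (adj G) x u × ¬ at F x u)
      α u = at? (adj G) x u ×-dec ¬? (at? F x u)
      β : ∀ z → Dec (at (adj G) y z × ¬ at F y z)
      β z = at? (adj G) y z ×-dec ¬? (at? F y z)
      fin : ι (F ⊑? adj G) * (# (V n) α * # (V n) β) ≡ ι (F ⊑? adj G) * (res d n F x * res d n F y)
      fin with F ⊑? adj G
      ... | yes s = cong (1 *_) (cong₂ _*_ (residual G F r s x) (residual G F r s y))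
      ... | no _ = refl

  -- Of the `totres` ordered edges of `G` outside `F`, each one that violates a condition of `New`
  -- is charged to one of `e₁` to `e₄`.
  forward-count : ∀ G → Regular d G → ins F x y ⊑ adj G →
    totres d n F ≤ ∑ (V n) (λ u → ∑ (V n) (λ z → ι (new? u z G))) + slack d n
  forward-count G r sub = begin
    totres d n F
      ≡⟨ ∑-cong (V n) (λ u → residual G F r (ins⊑⇒⊑ F g x y sub) u) ⟨
    ∑ (V n) (λ u → ∑ (V n) (λ z → ι (at? g u z ×-dec ¬? (at? F u z))))
      ≤⟨ ∑-mono (V n) (λ u → ∑-mono (V n) (λ z → pointwise u z)) ⟩
    ∑ (V n) (λ u → ∑ (V n) (λ z → ι (new? u z G) + (((e₁ u z + e₂ u z) + e₃ u z) + e₄ u z)))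
      ≡⟨ trans (∑∑-+ _ _) (cong (∑ (V n) (λ u → ∑ (V n) (λ z → ι (new? u z G))) +_)
           (trans (∑∑-+ _ _) (cong₂ _+_ (trans (∑∑-+ _ _) (cong₂ _+_ (trans (∑∑-+ _ _) (cong₂ _+_ s₁ s₂)) s₃)) s₄))) ⟩
    ∑ (V n) (λ u → ∑ (V n) (λ z → ι (new? u z G))) + (((d + d) + d * d) + d * d)
      ≡⟨ cong (∑ (V n) (λ u → ∑ (V n) (λ z → ι (new? u z G))) +_) (poly d) ⟩
    ∑ (V n) (λ u → ∑ (V n) (λ z → ι (new? u z G))) + slack d n ∎
    where
    open ≤-Reasoning
    g = adj G
    e₁ e₂ e₃ e₄ : Fin n → Fin n → ℕ
    e₁ u z = ι (u F.≟ x) * ι (at? g u z)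
    e₂ u z = ι (z F.≟ y) * ι (at? g u z)
    e₃ u z = ι (at? g x u) * ι (at? g u z)
    e₄ u z = ι (at? g y z) * ι (at? g u z)
    poly : ∀ d → ((d + d) + d * d) + d * d ≡ 2 * d * (d + 1)
    poly = solve-∀
    ∑∑-+ : ∀ (f h : Fin n → Fin n → ℕ) → ∑ (V n) (λ u → ∑ (V n) (λ z → f u z + h u z)) ≡
      ∑ (V n) (λ u → ∑ (V n) (f u)) + ∑ (V n) (λ u → ∑ (V n) (h u))
    ∑∑-+ f h = trans (∑-cong (V n) λ u → ∑-+ (V n) (f u) (h u)) (∑-+ (V n) _ _)
    gg : ∀ u z → ι (at? g u z) ≡ ι (at? g z u)
    gg u z = ι-cong _ _ (reg-sym {d} G r u z) (reg-sym {d} G r z u)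
    s₁ : ∑ (V n) (λ u → ∑ (V n) (e₁ u)) ≡ d
    s₁ = trans (∑-cong (V n) λ u → trans (∑-*ˡ (V n) (ι (u F.≟ x)) _) (cong (ι (u F.≟ x) *_) (reg-dg G r u)))
      (trans (∑-*ʳ (V n) d _) (trans (cong (_* d) (#-≟ x)) (*-identityˡ d)))
    s₂ : ∑ (V n) (λ u → ∑ (V n) (e₂ u)) ≡ d
    s₂ = trans (∑-cong (V n) λ u → trans (∑-δ y (λ z → ι (at? g u z))) (gg u y)) (reg-dg G r y)
    s₃ : ∑ (V n) (λ u → ∑ (V n) (e₃ u)) ≡ d * d
    s₃ = trans (∑-cong (V n) λ u → trans (∑-*ˡ (V n) (ι (at? g x u)) (λ z → ι (at? g u z))) (cong (ι (at? g x u) *_) (reg-dg G r u)))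
      (trans (∑-*ʳ (V n) d _) (cong (_* d) (reg-dg G r x)))
    s₄ : ∑ (V n) (λ u → ∑ (V n) (e₄ u)) ≡ d * d
    s₄ = trans (∑-swap (V n) (V n) e₄) (trans (∑-cong (V n) λ z → trans (∑-*ˡ (V n) (ι (at? g y z)) _)
        (cong (ι (at? g y z) *_) (trans (∑-cong (V n) λ u → gg u z) (reg-dg G r z))))
      (trans (∑-*ʳ (V n) d _) (cong (_* d) (reg-dg G r y))))
    pointwise : ∀ u z → ι (at? g u z ×-dec ¬? (at? F u z)) ≤ ι (new? u z G) + (((e₁ u z + e₂ u z) + e₃ u z) + e₄ u z)
    pointwise u z with at? g u z ×-dec ¬? (at? F u z)
    ... | no _ = z≤n
    ... | yes (p , q) with at? g u z
    ...   | no ¬p = ⊥-elim (¬p p)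
    ...   | yes _ with u F.≟ x | z F.≟ y | at? g x u | at? g y z
    ...     | yes _ | _ | _ | _ = s≤s z≤n
    ...     | no _ | yes _ | _ | _ = s≤s z≤n
    ...     | no _ | no _ | yes _ | _ = s≤s z≤n
    ...     | no _ | no _ | no _ | yes _ = s≤s z≤n
    ...     | no _ | no _ | no _ | no _ = s≤s z≤n

  -- An edge xy of G is destroyed by switching it with an edge uz into xu, yz.  All but `slack` of the oriented
  -- edges uz outside F are eligible, and the reverse switching is determined by u ∈ N(x), z ∈ N(y).
  switching : cnt d n (ins F x y) * totres d n F ≤ cnt d n F * (res d n F x * res d n F y) + cnt d n (ins F x y) * slack d n
  switching = begin
    cnt d n (ins F x y) * totres d n F
      ≡⟨ ∑-*ʳ (Reg d n) _ _ ⟨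
    ∑ (Reg d n) (λ G → ι (ins F x y ⊑? adj G) * totres d n F)
      ≤⟨ ∑-mono∈ (Reg d n) (λ G G∈ → ι-guard (ins F x y ⊑? adj G) (forward-count G (Reg⇒ G∈))) ⟩
    ∑ (Reg d n) (λ G → ι (ins F x y ⊑? adj G) * (∑ (V n) (λ u → ∑ (V n) (λ z → ι (new? u z G))) + slack d n))
      ≡⟨ ∑-cong (Reg d n) (λ G → *-distribˡ-+ (ι (ins F x y ⊑? adj G)) _ _) ⟩
    ∑ (Reg d n) (λ G → ι (ins F x y ⊑? adj G) * ∑ (V n) (λ u → ∑ (V n) (λ z → ι (new? u z G))) + ι (ins F x y ⊑? adj G) * slack d n)
      ≡⟨ trans (∑-+ (Reg d n) _ _) (cong₂ _+_ (∑-cong (Reg d n) push) (∑-*ʳ (Reg d n) _ _)) ⟩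
    ∑ (Reg d n) (λ G → ∑ (V n) (λ u → ∑ (V n) (λ z → ι (valid? u z G)))) + cnt d n (ins F x y) * slack d n
      ≡⟨ cong (_+ cnt d n (ins F x y) * slack d n) (trans (sym (∑-swap (V n) (Reg d n) _)) (∑-cong (V n) λ u → sym (∑-swap (V n) (Reg d n) _))) ⟩
    ∑ (V n) (λ u → ∑ (V n) (λ z → # (Reg d n) (valid? u z))) + cnt d n (ins F x y) * slack d n
      ≤⟨ +-monoˡ-≤ _ (∑-mono (V n) λ u → ∑-mono (V n) (#valid≤ u)) ⟩
    ∑ (V n) (λ u → ∑ (V n) (λ z → # (Reg d n) (valid′? u z))) + cnt d n (ins F x y) * slack d n
      ≡⟨ cong (_+ cnt d n (ins F x y) * slack d n) reverse-count ⟩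
    cnt d n F * (res d n F x * res d n F y) + cnt d n (ins F x y) * slack d n ∎
    where
    open ≤-Reasoning
    push : ∀ G → ι (ins F x y ⊑? adj G) * ∑ (V n) (λ u → ∑ (V n) (λ z → ι (new? u z G))) ≡
      ∑ (V n) (λ u → ∑ (V n) (λ z → ι (valid? u z G)))
    push G = trans (sym (∑-*ˡ (V n) (ι (ins F x y ⊑? adj G)) (λ u → ∑ (V n) (λ z → ι (new? u z G))))) (∑-cong (V n) λ u → trans (sym (∑-*ˡ (V n) (ι (ins F x y ⊑? adj G)) (λ z → ι (new? u z G)))) (∑-cong (V n) λ z →
      sym (ι-× (ins F x y ⊑? adj G) (new? u z G))))

-- Exposing edges one at a time

module Exposure {d n : ℕ} {Bad : Mat n → Set} (bad? : Decidable Bad)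
  {R : Fin n → Set} {A : Fin n → Fin n → Set} (A? : ∀ v → Decidable (A v)) (K α β S : ℕ)
  (rich : ∀ G → Regular d G → Bad G → ∀ v → R v → K ≤ # (V n) (λ y → at? (adj G) v y ×-dec A? v y))
  (step : ∀ F → Sym F → tot F ≤ S → ∃ λ v → R v × ∃ λ k → ∃ λ e → 0 < k × 0 < e × k + dg F v ≤ K ×
    e + slack d n ≤ totres d n F × α * (res d n F v * ∑ (V n) (λ y → ι (A? v y) * res d n F y)) ≤ β * (k * e))
    where

  cntBad : Rel n → ℕ
  cntBad F = # (Reg d n) (λ G → bad? G ×-dec (F ⊑? adj G))

  private
    w : Rel n → Fin n → Fin n → ℕ
    w F v y = ι (A? v y ×-dec ¬? (at? F v y))

    many : ∀ F v k → R v → k + dg F v ≤ K → ∀ G → Regular d G → Bad G →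
      k ≤ # (V n) (λ y → at? (adj G) v y ×-dec (A? v y ×-dec ¬? (at? F v y)))
    many F v k Rv kK G r b = +-cancelʳ-≤ (dg F v) _ _ (≤-trans kK (≤-trans (rich G r b v Rv)
      (#-⊎ (V n) (λ y → at? (adj G) v y ×-dec (A? v y ×-dec ¬? (at? F v y))) (at? F v) (λ y → at? (adj G) v y ×-dec A? v y) split)))
      where
      split : ∀ y → at (adj G) v y × A v y → (at (adj G) v y × (A v y × ¬ at F v y)) ⊎ at F v y
      split y (g , a) with at? F v y
      ... | yes f = inj₂ f
      ... | no f = inj₁ (g , a , f)

    perG : ∀ F v k → R v → k + dg F v ≤ K → ∀ G → G ∈ Reg d n →
      ι (bad? G ×-dec (F ⊑? adj G)) * k ≤ ∑ (V n) (λ y → w F v y * ι (bad? G ×-dec (ins F v y ⊑? adj G)))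
    perG F v k Rv kK G G∈ with bad? G ×-dec (F ⊑? adj G)
    ... | no _ = z≤n
    ... | yes (b , sub) = ≤-trans (≤-reflexive (*-identityˡ k)) (≤-trans (many F v k Rv kK G (Reg⇒ G∈) b)
        (∑-mono (V n) λ y → ≤-trans (ι-mono (at? (adj G) v y ×-dec (A? v y ×-dec ¬? (at? F v y)))
           ((A? v y ×-dec ¬? (at? F v y)) ×-dec (bad? G ×-dec (ins F v y ⊑? adj G)))
           λ (g , a) → a , b , ⊑-ins F (adj G) v y (reg-sym G (Reg⇒ G∈)) sub g)
         (≤-reflexive (ι-× (A? v y ×-dec ¬? (at? F v y)) (bad? G ×-dec (ins F v y ⊑? adj G))))))

    -- A bad `G` containing `F` has at least `K` edges from `v` into `A v`. At most `dg F v` of them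
    -- are in `F`, so at least `k` vertices `y` extend `F` inside `G`.
    expose : ∀ F v k → R v → k + dg F v ≤ K → cntBad F * k ≤ ∑ (V n) (λ y → w F v y * cntBad (ins F v y))
    expose F v k Rv kK = begin
      cntBad F * k ≡⟨ ∑-*ʳ (Reg d n) k _ ⟨
      ∑ (Reg d n) (λ G → ι (bad? G ×-dec (F ⊑? adj G)) * k) ≤⟨ ∑-mono∈ (Reg d n) (perG F v k Rv kK) ⟩
      ∑ (Reg d n) (λ G → ∑ (V n) (λ y → w F v y * ι (bad? G ×-dec (ins F v y ⊑? adj G)))) ≡⟨ ∑-swap (Reg d n) (V n) _ ⟩
      ∑ (V n) (λ y → ∑ (Reg d n) (λ G → w F v y * ι (bad? G ×-dec (ins F v y ⊑? adj G))))
        ≡⟨ ∑-cong (V n) (λ y → ∑-*ˡ (Reg d n) (w F v y) (λ G → ι (bad? G ×-dec (ins F v y ⊑? adj G)))) ⟩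
      ∑ (V n) (λ y → w F v y * cntBad (ins F v y)) ∎
      where open ≤-Reasoning

    -- The switching estimate with its error term absorbed on the left: `e` is a part of `totres`
    -- that remains after `slack` is set aside.
    one-edge : ∀ F → Sym F → ∀ v y e → e + slack d n ≤ totres d n F →
      w F v y * (cnt d n (ins F v y) * e) ≤ ι (A? v y) * (cnt d n F * (res d n F v * res d n F y))
    one-edge F s v y e le with A? v y | at? F v y
    ... | no _ | _ = z≤n
    ... | yes _ | yes _ = z≤n
    ... | yes _ | no ¬f = *-monoʳ-≤ 1 (+-cancelʳ-≤ (cnt d n (ins F v y) * slack d n) _ _
      (≤-trans (≤-reflexive (sym (*-distribˡ-+ (cnt d n (ins F v y)) e (slack d n))))
      (≤-trans (*-monoʳ-≤ (cnt d n (ins F v y)) le) (Switch.switching F s v y ¬f))))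

  -- Induction on the number of exposed edges. Choosing the new edge `vy` among at least `k` divides
  -- by `k`, switching it away bounds the count for `F + vy` by that for `F` times
  -- `res v * res y / e`, and after summing over `y` the last clause of `step` says precisely that
  -- the total cost is at most `β / α`. Each edge uses up two units of the budget `S`.
  exposure : ∀ t F → Sym F → tot F + 2 * t ≤ S → α ^ t * cntBad F ≤ β ^ t * cnt d n F
  exposure zero F s le = *-monoʳ-≤ 1 (#-mono (Reg d n) (λ G → bad? G ×-dec (F ⊑? adj G)) (λ G → F ⊑? adj G) λ G → proj₂)
  exposure (suc t) F s le with step F s (≤-trans (m≤m+n _ _) le)
  ... | v , Rv , k@(suc _) , e@(suc _) , _ , _ , kK , eE , key = *-cancelʳ-≤ _ _ (k * e) (begin
    α ^ suc t * cntBad F * (k * e)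
      ≡⟨ r₁ α (α ^ t) (cntBad F) k e ⟩
    α * e * α ^ t * (cntBad F * k)
      ≤⟨ *-monoʳ-≤ (α * e * α ^ t) (expose F v k Rv kK) ⟩
    α * e * α ^ t * ∑ (V n) (λ y → w F v y * cntBad (ins F v y))
      ≡⟨ ∑-*ˡ (V n) (α * e * α ^ t) _ ⟨
    ∑ (V n) (λ y → α * e * α ^ t * (w F v y * cntBad (ins F v y)))
      ≤⟨ ∑-mono (V n) each ⟩
    ∑ (V n) (λ y → α * β ^ t * cnt d n F * res d n F v * (ι (A? v y) * res d n F y))
      ≡⟨ ∑-*ˡ (V n) (α * β ^ t * cnt d n F * res d n F v) _ ⟩
    α * β ^ t * cnt d n F * res d n F v * T
      ≡⟨ r₂ α (β ^ t) (cnt d n F) (res d n F v) T ⟩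
    β ^ t * cnt d n F * (α * (res d n F v * T))
      ≤⟨ *-monoʳ-≤ (β ^ t * cnt d n F) key ⟩
    β ^ t * cnt d n F * (β * (k * e))
      ≡⟨ r₃ (β ^ t) (cnt d n F) β (k * e) ⟩
    β ^ suc t * cnt d n F * (k * e) ∎)
    where
    open ≤-Reasoning
    T = ∑ (V n) (λ y → ι (A? v y) * res d n F y)
    r₁ : ∀ a p c k e → a * p * c * (k * e) ≡ a * e * p * (c * k)
    r₁ = solve-∀
    r₂ : ∀ a b c r t → a * b * c * r * t ≡ b * c * (a * (r * t))
    r₂ = solve-∀
    r₃ : ∀ b c β x → b * c * (β * x) ≡ β * b * c * x
    r₃ = solve-∀
    r₄ : ∀ a e p w c → a * e * p * (w * c) ≡ a * e * w * (p * c)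
    r₄ = solve-∀
    r₅ : ∀ a e w b c → a * e * w * (b * c) ≡ a * b * (w * (c * e))
    r₅ = solve-∀
    r₆ : ∀ a b i c r s → a * b * (i * (c * (r * s))) ≡ a * b * c * r * (i * s)
    r₆ = solve-∀
    bound : ∀ y → tot (ins F v y) + 2 * t ≤ S
    bound y = ≤-trans (+-monoˡ-≤ (2 * t) (tot-ins F v y)) (≤-trans (≤-reflexive (r₇ (tot F) t)) le)
      where
      r₇ : ∀ f t → f + 2 + 2 * t ≡ f + 2 * suc t
      r₇ = solve-∀
    each : ∀ y → α * e * α ^ t * (w F v y * cntBad (ins F v y)) ≤ α * β ^ t * cnt d n F * res d n F v * (ι (A? v y) * res d n F y)
    each y = begin
      α * e * α ^ t * (w F v y * cntBad (ins F v y))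
        ≡⟨ r₄ α e (α ^ t) (w F v y) (cntBad (ins F v y)) ⟩
      α * e * w F v y * (α ^ t * cntBad (ins F v y))
        ≤⟨ *-monoʳ-≤ (α * e * w F v y) (exposure t (ins F v y) (ins-sym s) (bound y)) ⟩
      α * e * w F v y * (β ^ t * cnt d n (ins F v y))
        ≡⟨ r₅ α e (w F v y) (β ^ t) (cnt d n (ins F v y)) ⟩
      α * β ^ t * (w F v y * (cnt d n (ins F v y) * e))
        ≤⟨ *-monoʳ-≤ (α * β ^ t) (one-edge F s v y e eE) ⟩
      α * β ^ t * (ι (A? v y) * (cnt d n F * (res d n F v * res d n F y)))
        ≡⟨ r₆ α (β ^ t) (ι (A? v y)) (cnt d n F) (res d n F v) (res d n F y) ⟩
      α * β ^ t * cnt d n F * res d n F v * (ι (A? v y) * res d n F y) ∎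

-- A constant gain per exposure

totres-bound : ∀ d n (F : Rel n) → d * n ≤ totres d n F + tot F
totres-bound d n F = begin
  d * n ≡⟨ *-comm d n ⟩
  n * d ≡⟨ cong (_* d) (V-length n) ⟨
  length (V n) * d ≡⟨ ∑-const (V n) d ⟨
  ∑ (V n) (λ _ → d) ≤⟨ ∑-mono (V n) (λ v → ≤-trans (m≤n+m∸n d (dg F v)) (≤-reflexive (+-comm (dg F v) _))) ⟩
  ∑ (V n) (λ v → res d n F v + dg F v) ≡⟨ ∑-+ (V n) _ _ ⟩
  totres d n F + tot F ∎
  where open ≤-Reasoning

∑res≤ : ∀ d n (F : Rel n) {A : Fin n → Set} (A? : Decidable A) → ∑ (V n) (λ y → ι (A? y) * res d n F y) ≤ # (V n) A? * d
∑res≤ d n F A? = ≤-trans (∑-mono (V n) λ y → *-monoʳ-≤ (ι (A? y)) (m∸n≤m d (dg F y))) (≤-reflexive (∑-*ʳ (V n) d _))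

-- While few edges are exposed, averaging over `R` finds a vertex whose degree is almost entirely
-- unexposed; the next edge is exposed there, so that the gain does not deteriorate.
low-degree : ∀ {n} (F : Rel n) {R : Fin n → Set} (R? : Decidable R) (c D : ℕ) → c * tot F < # (V n) R? * suc D →
  ∃ λ v → R v × c * dg F v ≤ D
low-degree {n} F R? c D lt with F.any? (λ v → R? v ×-dec (c * dg F v ≤? D))
... | yes p = p
... | no ¬p = ⊥-elim (<-irrefl refl (<-≤-trans lt (begin
  # (V n) R? * suc D ≡⟨ ∑-*ʳ (V n) (suc D) _ ⟨
  ∑ (V n) (λ v → ι (R? v) * suc D) ≤⟨ ∑-mono (V n) per ⟩
  ∑ (V n) (λ v → c * dg F v) ≡⟨ ∑-*ˡ (V n) c _ ⟩
  c * tot F ∎)))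
  where
  open ≤-Reasoning
  per : ∀ v → ι (R? v) * suc D ≤ c * dg F v
  per v with R? v
  ... | no _ = z≤n
  ... | yes r = ≤-trans (≤-reflexive (*-identityˡ (suc D))) (≰⇒> λ le → ¬p (v , r , le))

pos-cancel : ∀ a b {c} → 0 < c → c ≤ a * b → 0 < b
pos-cancel a zero 0<c le = ⊥-elim (<⇒≱ 0<c (≤-trans le (≤-reflexive (*-zeroʳ a))))
pos-cancel a (suc b) _ _ = s≤s z≤n

-- One exposure costs `r * T / (k * e)`. With `k / d ≥ a / p`, `e / x ≥ b / q` and `T / x ≤ 3 / 4`
-- this is at most `(3 / 4) (p / a) (q / b)`, and the first hypothesis compares that number with
-- `β / α`.
product-gap : ∀ α β a p b q d x k e T r → α * 3 * (p * q) ≤ β * 4 * (a * b) → 0 < p * q →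
  a * d ≤ p * k → b * x ≤ q * e → 4 * T ≤ 3 * x → r ≤ d → α * (r * T) ≤ β * (k * e)
product-gap α β a p b q d x k e T r c 0<pq kd ex Tx rd = *-cancelˡ-≤ (p * q) {{>-nonZero 0<pq}} (*-cancelˡ-≤ 4 (begin
  4 * (p * q * (α * (r * T))) ≡⟨ r₁ p q α r T ⟩
  p * q * α * (r * (4 * T)) ≤⟨ *-monoʳ-≤ (p * q * α) (*-mono-≤ rd Tx) ⟩
  p * q * α * (d * (3 * x)) ≡⟨ r₂ p q α d x ⟩
  α * 3 * (p * q) * (d * x) ≤⟨ *-monoˡ-≤ (d * x) c ⟩
  β * 4 * (a * b) * (d * x) ≡⟨ r₃ β a b d x ⟩
  4 * β * (a * d * (b * x)) ≤⟨ *-monoʳ-≤ (4 * β) (*-mono-≤ kd ex) ⟩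
  4 * β * (p * k * (q * e)) ≡⟨ r₄ β p k q e ⟩
  4 * (p * q * (β * (k * e))) ∎))
  where
  open ≤-Reasoning
  r₁ : ∀ p q α r t → 4 * (p * q * (α * (r * t))) ≡ p * q * α * (r * (4 * t))
  r₁ = solve-∀
  r₂ : ∀ p q α d x → p * q * α * (d * (3 * x)) ≡ α * 3 * (p * q) * (d * x)
  r₂ = solve-∀
  r₃ : ∀ β a b d x → β * 4 * (a * b) * (d * x) ≡ 4 * β * (a * d * (b * x))
  r₃ = solve-∀
  r₄ : ∀ β p k q e → 4 * β * (p * k * (q * e)) ≡ 4 * (p * q * (β * (k * e)))
  r₄ = solve-∀

-- The set `A v` has at most 3n/4 vertices but must catch 4d/5 of the degree. The ratio of 3/4 to
-- 4/5 is 15/16, which leaves room for losses of one or two percent, to edges already exposed and to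
-- `slack`, before it reaches 32/33.
module Concentration {d n : ℕ} {Bad : Mat n → Set} (bad? : Decidable Bad)
  {R : Fin n → Set} (R? : Decidable R) {A : Fin n → Fin n → Set} (A? : ∀ v → Decidable (A v)) (K ℓ S : ℕ)
  (rich : ∀ G → Regular d G → Bad G → ∀ v → R v → K ≤ # (V n) (λ y → at? (adj G) v y ×-dec A? v y))
  (1≤d : 1 ≤ d) (n-large : 200 * suc d ≤ n) (R-large : n ≤ ℓ * # (V n) R?)
  (A-small : ∀ v → R v → 4 * # (V n) (A? v) ≤ 3 * n) (K-large : 4 * d ≤ 5 * K) (S-small : 100 * (ℓ * S) ≤ d * n)
    where

  private
    0<n : 0 < n
    0<n = ≤-trans (s≤s z≤n) n-large

    0<dn : 0 < d * n
    0<dn = *-mono-≤ 1≤d 0<n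

    few : ∀ (F : Rel n) → tot F ≤ S → 100 * tot F < # (V n) R? * suc d
    few F le with 100 * tot F <? # (V n) R? * suc d
    ... | yes p = p
    ... | no ¬p = ⊥-elim (<⇒≱ (m<m+n (n * d) 0<n) (begin
      n * d + n ≡⟨ r₁ n d ⟩
      n * suc d ≤⟨ *-monoˡ-≤ (suc d) R-large ⟩
      ℓ * # (V n) R? * suc d ≡⟨ *-assoc ℓ _ _ ⟩
      ℓ * (# (V n) R? * suc d) ≤⟨ *-monoʳ-≤ ℓ (≤-trans (≮⇒≥ ¬p) (*-monoʳ-≤ 100 le)) ⟩
      ℓ * (100 * S) ≡⟨ r₂ ℓ S ⟩
      100 * (ℓ * S) ≤⟨ S-small ⟩
      d * n ≡⟨ *-comm d n ⟩
      n * d ∎))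
      where
      open ≤-Reasoning
      r₁ : ∀ n d → n * d + n ≡ n * suc d
      r₁ = solve-∀
      r₂ : ∀ l s → l * (100 * s) ≡ 100 * (l * s)
      r₂ = solve-∀

    0<ℓ : 0 < ℓ
    0<ℓ = pos-cancel (# (V n) R?) ℓ 0<n (≤-trans R-large (≤-reflexive (*-comm ℓ _)))

    100S≤ : 100 * S ≤ d * n
    100S≤ = ≤-trans (*-monoʳ-≤ 100 (≤-trans (≤-reflexive (sym (*-identityˡ S))) (*-monoˡ-≤ S 0<ℓ))) S-small

    slack≤ : 100 * slack d n ≤ d * n
    slack≤ = begin
      100 * (2 * d * (d + 1)) ≡⟨ r d ⟩
      d * (200 * suc d) ≤⟨ *-monoʳ-≤ d n-large ⟩
      d * n ∎
      where
      open ≤-Reasoning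
      r : ∀ d → 100 * (2 * d * (d + 1)) ≡ d * (200 * suc d)
      r = solve-∀

    step : ∀ F → Sym F → tot F ≤ S → ∃ λ v → R v × ∃ λ k → ∃ λ e → 0 < k × 0 < e × k + dg F v ≤ K ×
      e + slack d n ≤ totres d n F × 33 * (res d n F v * ∑ (V n) (λ y → ι (A? v y) * res d n F y)) ≤ 32 * (k * e)
    step F s le with low-degree F R? 100 d (few F le)
    ... | v , Rv , low = v , Rv , k , e , 0<k , 0<e , k+ , e+ , key
      where
      open ≤-Reasoning
      f = dg F v
      k = K ∸ f
      E = totres d n F
      e = E ∸ slack d n
      -- 80 hundredths of `d` from `K-large`, less the hundredth that may be exposed at `v`.
      100k : 79 * d ≤ 100 * k
      100k = begin
        79 * d ≤⟨ m+n≤o⇒m≤o∸n (79 * d) (begin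
          79 * d + 100 * f ≤⟨ +-monoʳ-≤ (79 * d) low ⟩
          79 * d + d ≡⟨ r d ⟩
          20 * (4 * d) ≤⟨ *-monoʳ-≤ 20 K-large ⟩
          20 * (5 * K) ≡⟨ *-assoc 20 5 K ⟨
          100 * K ∎) ⟩
        100 * K ∸ 100 * f ≡⟨ *-distribˡ-∸ 100 K f ⟨
        100 * k ∎
        where
        r : ∀ d → 79 * d + d ≡ 20 * (4 * d)
        r = solve-∀
      -- Of 100 parts of `d * n`, one is lost to the arcs of `F` and one to `slack`.
      50e : 49 * (d * n) ≤ 50 * e
      50e = begin
        49 * (d * n) ≤⟨ *-cancelˡ-≤ 2 (begin
          2 * (49 * (d * n)) ≤⟨ m+n≤o⇒m≤o∸n (2 * (49 * (d * n))) (+-cancelʳ-≤ (100 * tot F) _ _ (begin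
            2 * (49 * (d * n)) + 100 * slack d n + 100 * tot F
              ≤⟨ +-mono-≤ (+-monoʳ-≤ (2 * (49 * (d * n))) slack≤) (≤-trans (*-monoʳ-≤ 100 le) 100S≤) ⟩
            2 * (49 * (d * n)) + d * n + d * n ≡⟨ r (d * n) ⟩
            100 * (d * n) ≤⟨ *-monoʳ-≤ 100 (totres-bound d n F) ⟩
            100 * (E + tot F) ≡⟨ *-distribˡ-+ 100 E (tot F) ⟩
            100 * E + 100 * tot F ∎)) ⟩
          100 * E ∸ 100 * slack d n ≡⟨ *-distribˡ-∸ 100 E (slack d n) ⟨
          100 * e ≡⟨ *-assoc 2 50 e ⟩
          2 * (50 * e) ∎) ⟩
        50 * e ∎
        where
        r : ∀ x → 2 * (49 * x) + x + x ≡ 100 * x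
        r = solve-∀
      0<k = pos-cancel 100 k (*-mono-≤ {1} {79} (s≤s z≤n) 1≤d) 100k
      0<e = pos-cancel 50 e (*-mono-≤ {1} {49} (s≤s z≤n) 0<dn) 50e
      k+ : k + f ≤ K
      k+ = ≤-reflexive (m∸n+n≡m {K} {f} (<⇒≤ (m∸n≢0⇒n<m {K} {f} (>⇒≢ 0<k))))
      e+ : e + slack d n ≤ E
      e+ = ≤-reflexive (m∸n+n≡m {E} {slack d n} (<⇒≤ (m∸n≢0⇒n<m {E} {slack d n} (>⇒≢ 0<e))))
      T = ∑ (V n) (λ y → ι (A? v y) * res d n F y)
      4T : 4 * T ≤ 3 * n * d
      4T = begin
        4 * T ≤⟨ *-monoʳ-≤ 4 (∑res≤ d n F (A? v)) ⟩
        4 * (# (V n) (A? v) * d) ≡⟨ *-assoc 4 (# (V n) (A? v)) d ⟨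
        4 * # (V n) (A? v) * d ≤⟨ *-monoˡ-≤ d (A-small v Rv) ⟩
        3 * n * d ∎
      key : 33 * (res d n F v * T) ≤ 32 * (k * e)
      -- The rate 33/32 just fits: 33 * 3 * 5000 = 495000, while 32 * 4 * 79 * 49 = 495488.
      key = product-gap 33 32 79 100 49 50 d (d * n) k e T (res d n F v) (≤ᵇ⇒≤ _ _ _) (s≤s z≤n) 100k 50e
        (≤-trans 4T (≤-reflexive (trans (*-assoc 3 n d) (cong (3 *_) (*-comm n d))))) (m∸n≤m d f)

  open Exposure bad? A? K 33 32 S rich step public

-- Paths, rotations and boosters

Unique-resp-↭ : ∀ {A : Set} {xs ys : List A} → xs ↭ ys → Unique xs → Unique ys
Unique-resp-↭ p = PermS.Unique-resp-↭ (setoid _) (↭⇒↭ₛ p)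

module _ {A : Set} where

  data Next : List A → A → A → Set where
    here : ∀ {a b xs} → Next (a ∷ b ∷ xs) a b
    there : ∀ {x a b xs} → Next xs a b → Next (x ∷ xs) a b

  Adj : List A → A → A → Set
  Adj xs a b = Next xs a b ⊎ Next xs b a

  adj-there : ∀ {x xs a b} → Adj xs a b → Adj (x ∷ xs) a b
  adj-there (inj₁ p) = inj₁ (there p)
  adj-there (inj₂ p) = inj₂ (there p)

  next-++ˡ : ∀ {xs ys a b} → Next xs a b → Next (xs ++ ys) a b
  next-++ˡ here = here
  next-++ˡ (there p) = there (next-++ˡ p)

  next-++ʳ : ∀ xs {ys a b} → Next ys a b → Next (xs ++ ys) a b
  next-++ʳ [] p = p
  next-++ʳ (x ∷ xs) p = there (next-++ʳ xs p)

  -- The only adjacency created when `xs` is reversed onto `ys`: their two heads meet.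
  data Heads : List A → List A → A → A → Set where
    heads : ∀ {x y xs ys} → Heads (x ∷ xs) (y ∷ ys) x y

  adj-ʳ++ : ∀ xs ys {a b} → Adj (xs ʳ++ ys) a b →
    Adj xs a b ⊎ Adj ys a b ⊎ (Heads xs ys a b ⊎ Heads xs ys b a)
  adj-ʳ++ [] ys p = inj₂ (inj₁ p)
  adj-ʳ++ (x ∷ xs) ys p with adj-ʳ++ xs (x ∷ ys) p
  ... | inj₁ q = inj₁ (adj-there q)
  ... | inj₂ (inj₁ (inj₁ here)) = inj₂ (inj₂ (inj₁ heads))
  ... | inj₂ (inj₁ (inj₁ (there q))) = inj₂ (inj₁ (inj₁ q))
  ... | inj₂ (inj₁ (inj₂ here)) = inj₂ (inj₂ (inj₂ heads))
  ... | inj₂ (inj₁ (inj₂ (there q))) = inj₂ (inj₁ (inj₂ q))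
  ... | inj₂ (inj₂ (inj₁ heads)) = inj₁ (inj₂ here)
  ... | inj₂ (inj₂ (inj₂ heads)) = inj₁ (inj₁ here)

  data Ends (b : A) : List A → Set where
    here : Ends b (b ∷ [])
    there : ∀ {x xs} → Ends b xs → Ends b (x ∷ xs)

  ends-++⁻ : ∀ {b} xs {y ys} → Ends b (xs ++ y ∷ ys) → Ends b (y ∷ ys)
  ends-++⁻ [] e = e
  ends-++⁻ (x ∷ []) (there e) = e
  ends-++⁻ (x ∷ x′ ∷ xs) (there e) = ends-++⁻ (x′ ∷ xs) e

  ends-++ : ∀ {b} xs {ys} → Ends b ys → Ends b (xs ++ ys)
  ends-++ [] e = e
  ends-++ (x ∷ xs) e = there (ends-++ xs e)

  ends-ʳ++ : ∀ {b} xs {ys} → Ends b ys → Ends b (xs ʳ++ ys)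
  ends-ʳ++ [] e = e
  ends-ʳ++ (x ∷ xs) e = ends-ʳ++ xs (there e)

  ends-head : ∀ {b xs} → Ends b xs → ∀ ys → ∃ λ zs → xs ʳ++ ys ≡ b ∷ zs
  ends-head here ys = ys , refl
  ends-head (there e) ys = ends-head e (_ ∷ ys)

  ends-exists : ∀ x xs → ∃ λ b → Ends b (x ∷ xs)
  ends-exists x [] = x , here
  ends-exists x (y ∷ xs) with ends-exists y xs
  ... | b , e = b , there e

  -- The pivot's predecessor is the new head after a rotation.
  pivot : ∀ u as w bs → ∃ λ c → (∀ ys → ∃ λ zs → (u ∷ as) ʳ++ ys ≡ c ∷ zs) × Next (u ∷ as ++ w ∷ bs) c w
  pivot u [] w bs = u , (λ ys → ys , refl) , here
  pivot u (u′ ∷ as) w bs with pivot u′ as w bs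
  ... | c , h , nx = c , (λ ys → h (u ∷ ys)) , there nx

  module _ {R : A → A → Set} where

    linked-++⁻ˡ : ∀ xs {ys} → Linked R (xs ++ ys) → Linked R xs
    linked-++⁻ˡ [] l = []
    linked-++⁻ˡ (x ∷ []) l = [-]
    linked-++⁻ˡ (x ∷ x′ ∷ xs) (r ∷ l) = r ∷ linked-++⁻ˡ (x′ ∷ xs) l

    linked-++⁻ʳ : ∀ xs {ys} → Linked R (xs ++ ys) → Linked R ys
    linked-++⁻ʳ [] l = l
    linked-++⁻ʳ (x ∷ xs) l = linked-++⁻ʳ xs (Linked.tail l)

    linked-++ : ∀ {xs y ys b} → Ends b xs → R b y → Linked R xs → Linked R (y ∷ ys) → Linked R (xs ++ y ∷ ys)
    linked-++ here r [-] m = r ∷ m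
    linked-++ (there e@here) r (s ∷ l) m = s ∷ linked-++ e r l m
    linked-++ (there e@(there _)) r (s ∷ l) m = s ∷ linked-++ e r l m

    linked-ʳ++ : (∀ {a b} → R a b → R b a) → ∀ {x y} xs {ys} → R x y → Linked R (x ∷ xs) → Linked R (y ∷ ys) →
      Linked R ((x ∷ xs) ʳ++ (y ∷ ys))
    linked-ʳ++ s [] r [-] m = r ∷ m
    linked-ʳ++ s (x′ ∷ xs) r (q ∷ l) m = linked-ʳ++ s xs (s q) l (r ∷ m)

    linked-reverse : (∀ {a b} → R a b → R b a) → ∀ xs → Linked R xs → Linked R (xs ʳ++ [])
    linked-reverse s [] l = []
    linked-reverse s (x ∷ []) l = [-]
    linked-reverse s (x ∷ x′ ∷ xs) (q ∷ l) = linked-ʳ++ s xs (s q) l [-]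

    linked-take : ∀ k {xs} → Linked R xs → Linked R (take k xs)
    linked-take zero l = []
    linked-take (suc k) [] = []
    linked-take (suc k) [-] = subst (λ ys → Linked R (_ ∷ ys)) (sym (L.take-[] k)) [-]
    linked-take (suc zero) (r ∷ l) = [-]
    linked-take (suc (suc k)) (r ∷ l) = r ∷ linked-take (suc k) l

  module _ {R : A → Set} (R? : Decidable R) where

    keep : ∀ {P : Set} → Dec P → A → List A → List A
    keep (yes _) x xs = x ∷ xs
    keep (no _) x xs = xs

    prevs : List A → List A
    prevs [] = []
    prevs (x ∷ []) = []
    prevs (x ∷ y ∷ xs) = keep (R? y) x (prevs (y ∷ xs))

    nexts : List A → List A
    nexts [] = []
    nexts (x ∷ []) = []
    nexts (x ∷ y ∷ xs) = keep (R? x) y (nexts (y ∷ xs))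

    ∈-prevs : ∀ {xs a b} → Next xs a b → R b → a ∈ prevs xs
    ∈-prevs {x ∷ y ∷ xs} here r with R? y
    ... | yes _ = here refl
    ... | no ¬r = ⊥-elim (¬r r)
    ∈-prevs {x ∷ y ∷ xs} (there p) r with R? y
    ... | yes _ = there (∈-prevs p r)
    ... | no _ = ∈-prevs p r
    ∈-prevs {x ∷ []} (there ()) r

    ∈-nexts : ∀ {xs a b} → Next xs a b → R a → b ∈ nexts xs
    ∈-nexts {x ∷ y ∷ xs} here r with R? x
    ... | yes _ = here refl
    ... | no ¬r = ⊥-elim (¬r r)
    ∈-nexts {x ∷ y ∷ xs} (there p) r with R? x
    ... | yes _ = there (∈-nexts p r)
    ... | no _ = ∈-nexts p r
    ∈-nexts {x ∷ []} (there ()) r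

    -- The head of a path is nobody's successor, so only the tail counts. This loss of one makes
    -- `#near` strict, which is what contradicts an expansion by a factor of exactly 3.
    length-prevs : ∀ x xs → length (prevs (x ∷ xs)) ≡ # xs R?
    length-prevs x [] = refl
    length-prevs x (y ∷ xs) with R? y
    ... | yes _ = cong suc (length-prevs y xs)
    ... | no _ = length-prevs y xs

    length-nexts : ∀ x xs → length (nexts (x ∷ xs)) ≤ # (x ∷ xs) R?
    length-nexts x [] = z≤n
    length-nexts x (y ∷ xs) with R? x
    ... | yes _ = s≤s (length-nexts y xs)
    ... | no _ = length-nexts y xs

next? : ∀ {n} (xs : List (Fin n)) a b → Dec (Next xs a b)
next? [] a b = no λ ()
next? (x ∷ []) a b = no λ { (there ()) }
next? (x ∷ y ∷ xs) a b = map′ (λ { (inj₁ (refl , refl)) → here ; (inj₂ p) → there p })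
  (λ { here → inj₁ (refl , refl) ; (there p) → inj₂ p }) (((a F.≟ x) ×-dec (b F.≟ y)) ⊎-dec next? (y ∷ xs) a b)

ends? : ∀ {n} (b : Fin n) xs → Dec (Ends b xs)
ends? b [] = no λ ()
ends? b (x ∷ []) = map′ (λ { refl → here }) (λ { here → refl ; (there ()) }) (x F.≟ b)
ends? b (x ∷ y ∷ xs) = map′ there (λ { (there p) → p }) (ends? b (y ∷ xs))

list? : ∀ {n} k {P : List (Fin n) → Set} → Decidable P → Dec (∃ λ q → length q ≡ k × P q)
list? zero P? = map′ (λ p → [] , refl , p) (λ { ([] , _ , p) → p }) (P? [])
list? (suc k) P? = map′ (λ { (x , q , e , p) → x ∷ q , cong suc e , p }) (λ { (x ∷ q , e , p) → x , q , suc-injective e , p })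
  (F.any? λ x → list? k λ q → P? (x ∷ q))

-- Double-negation shift over a finite type. Reachability by rotations is not decided here; but the
-- lower bounds on numbers of boosters are decidable, hence stable, so `Endpoint` may be taken as
-- decidable while they are proved.
dns : ∀ {n} {P : Fin n → Set} → (∀ i → ¬ ¬ P i) → ¬ ¬ (∀ i → P i)
dns {zero} h k = k λ ()
dns {suc n} h k = h zero λ p → dns (h ∘ suc) λ q → k λ { zero → p ; (suc i) → q i }

¬¬-dec : ∀ {P : Set} → ¬ ¬ Dec P
¬¬-dec k = k (no λ p → k (yes p))

module _ {n : ℕ} where

  _∈ᶠ?_ : (x : Fin n) (xs : List (Fin n)) → Dec (x ∈ xs)
  _∈ᶠ?_ = DM._∈?_
    where import Data.List.Membership.DecPropositional (F._≟_ {n}) as DM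

  Path : Rel n → List (Fin n) → Set
  Path F q = Linked (at F) q × Unique q

  path? : ∀ F q → Dec (Path F q)
  path? F q = linked? (at? F) q ×-dec DU.unique? q
    where import Data.List.Relation.Unary.Unique.DecPropositional (F._≟_ {n}) as DU

  HasPath : Rel n → ℕ → Set
  HasPath F k = ∃ λ q → length q ≡ k × Path F q

  hasPath? : ∀ F k → Dec (HasPath F k)
  hasPath? F k = list? k (path? F)

  HamC : Rel n → Set
  HamC F = ∃ λ q → length q ≡ n × Path F q × ∃ λ a → ∃ λ b → (∃ λ q′ → q ≡ a ∷ q′) × Ends b q × at F b a

  hasPath-≤ : ∀ F {j k} → j ≤ k → HasPath F k → HasPath F j
  hasPath-≤ F {j} le (q , e , l , u) = take j q , trans (L.length-take j q) (m≤n⇒m⊓n≡m (subst (j ≤_) (sym e) le))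
    , linked-take j l , U.take⁺ j u

  path-≤n : ∀ F {k} → HasPath F k → k ≤ n
  path-≤n F (q , refl , _ , u) = subst (length q ≤_) (trans (#-all (V n) (λ x → x ∈ᶠ? V n) λ x p → p) (V-length n))
    (length≤# F._≟_ {ys = V n} (λ x → x ∈ᶠ? V n) u λ x _ → ∈-allFin x , ∈-allFin x)

  -- `W` is any decidable superset of `X` and its neighbours, so each application supplies the
  -- superset that it can count. Tripling the closed neighbourhood means at least `2|X|` neighbours
  -- outside `X`, the hypothesis of Pósa's lemma.
  Expander : Rel n → Set₁
  Expander F = ∀ X → Unique X → 4 * length X ≤ n → {W : Fin n → Set} (W? : Decidable W) →
    (∀ x → x ∈ X → W x) → (∀ x → x ∈ X → ∀ y → at F x y → W y) → 3 * length X ≤ # (V n) W?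

  expander-mono : ∀ {F G} → F ⊑ G → Expander F → Expander G
  expander-mono sub ex X u le W? h₁ h₂ = ex X u le W? h₁ λ x x∈ y e → h₂ x x∈ y (sub x y e)

  module Posa {F : Rel n} (F-sym : Sym F) (ex : Expander F) where

    swapF : ∀ {a b} → at F a b → at F b a
    swapF {a} {b} = F-sym a b

    -- The last vertex stays fixed and the head moves: the chord from the head `u` to `w` replaces
    -- the path edge entering `w`, and the segment before `w` is reversed.
    data Reach (P : List (Fin n)) : List (Fin n) → Set where
      start : Reach P P
      rotate : ∀ u as w bs → Reach P (u ∷ as ++ w ∷ bs) → at F u w → Reach P ((u ∷ as) ʳ++ (w ∷ bs))

    reach-path : ∀ {P Q} → Path F P → Reach P Q → Path F Q
    reach-path p start = p
    reach-path p (rotate u as w bs r e) with reach-path p r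
    ... | l , un = linked-ʳ++ swapF as e (linked-++⁻ˡ (u ∷ as) l) (linked-++⁻ʳ (u ∷ as) l)
                 , Unique-resp-↭ (++↭ʳ++ (u ∷ as) (w ∷ bs)) un

    reach-ends : ∀ {P Q b} → Ends b P → Reach P Q → Ends b Q
    reach-ends e start = e
    reach-ends e (rotate u as w bs r _) = ends-ʳ++ (u ∷ as) (ends-++⁻ (u ∷ as) (reach-ends e r))

    reach-length : ∀ {P Q} → Reach P Q → length Q ≡ length P
    reach-length start = refl
    reach-length (rotate u as w bs r _) = trans (sym (↭-length (++↭ʳ++ (u ∷ as) (w ∷ bs)))) (reach-length r)

    reach-∈ : ∀ {P Q x} → Reach P Q → x ∈ Q → x ∈ P
    reach-∈ start p = p
    reach-∈ (rotate u as w bs r _) p = reach-∈ r (∈-resp-↭ (↭-sym (++↭ʳ++ (u ∷ as) (w ∷ bs))) p)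

    Endpoint : List (Fin n) → Fin n → Set
    Endpoint P v = ∃ λ q → Reach P (v ∷ q)

    pivot-endpoint : ∀ {P} u as w bs → Reach P (u ∷ as ++ w ∷ bs) → at F u w →
      ∃ λ c → Endpoint P c × Next (u ∷ as ++ w ∷ bs) c w
    pivot-endpoint {P} u as w bs r e with pivot u as w bs
    ... | c , h , nx with h (w ∷ bs)
    ... | zs , eq = c , (zs , subst (Reach P) eq (rotate u as w bs r e)) , nx

    -- Pósa's lemma: rotations create path edges only at endpoints and at the P-neighbours of endpoints.
    frozen : ∀ {P Q} → Reach P Q → ∀ w → ¬ Endpoint P w → (∀ c → Endpoint P c → ¬ Adj P w c) →
      ∀ a → Adj Q w a → Adj P w a
    frozen start w ¬e ¬c a p = p
    frozen (rotate u as w′ bs r e) w ¬e ¬c a p with adj-ʳ++ (u ∷ as) (w′ ∷ bs) p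
    ... | inj₁ (inj₁ q) = frozen r w ¬e ¬c a (inj₁ (next-++ˡ q))
    ... | inj₁ (inj₂ q) = frozen r w ¬e ¬c a (inj₂ (next-++ˡ q))
    ... | inj₂ (inj₁ (inj₁ q)) = frozen r w ¬e ¬c a (inj₁ (next-++ʳ (u ∷ as) q))
    ... | inj₂ (inj₁ (inj₂ q)) = frozen r w ¬e ¬c a (inj₂ (next-++ʳ (u ∷ as) q))
    ... | inj₂ (inj₂ (inj₁ heads)) = ⊥-elim (¬e (_ , r))
    ... | inj₂ (inj₂ (inj₂ heads)) with pivot-endpoint u as w bs r e
    ...   | c , ec , nx = ⊥-elim (¬c c ec (frozen r w ¬e ¬c c (inj₂ nx)))

    module _ (p : Fin n) (ps : List (Fin n)) (path : Path F (p ∷ ps))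
      (longest : ∀ q → Path F q → length q ≤ length (p ∷ ps)) (R? : Decidable (Endpoint (p ∷ ps))) where

      private
        P = p ∷ ps
        Near : Fin n → Set
        Near w = Endpoint P w ⊎ ((∃ λ c → Next P w c × Endpoint P c) ⊎ (∃ λ c → Next P c w × Endpoint P c))

        near? : Decidable Near
        near? w = R? w ⊎-dec ((F.any? λ c → next? P w c ×-dec R? c) ⊎-dec (F.any? λ c → next? P c w ×-dec R? c))

        r = # (V n) R?

        on-path : ∀ {u q w} → Reach P (u ∷ q) → at F u w → w ∈ u ∷ q
        on-path {u} {q} {w} reach e with w ∈ᶠ? (u ∷ q)
        ... | yes w∈ = w∈
        ... | no w∉ with reach-path path reach
        ...   | l , un = ⊥-elim (<-irrefl (reach-length reach) (longest (w ∷ u ∷ q)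
                  (swapF e ∷ l , All.tabulate (λ { x∈ refl → w∉ x∈ }) ∷ un)))

        -- If `w` were not near, `frozen` would make every path neighbour of `w` a neighbour in `P`.
        -- The pivot of the rotation along `uw` precedes `w` and is an endpoint, so `w` would be
        -- next to an endpoint in `P` after all.
        nbr-near : ∀ u → Endpoint P u → ∀ w → at F u w → Near w
        nbr-near u (q , reach) w e = decidable-stable (near? w) λ ¬near → go ¬near (on-path reach e)
          where
          go : ¬ Near w → w ∈ u ∷ q → ⊥
          go ¬near (here refl) = ¬near (inj₁ (q , reach))
          go ¬near (there w∈) with ∈-∃++ w∈
          ... | as , bs , refl with pivot-endpoint u as w bs reach e
          ...   | c , ec , nx = far c ec (frozen reach w (¬near ∘ inj₁) far c (inj₂ nx))
            where
            far : ∀ c → Endpoint P c → ¬ Adj P w c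
            far c ec (inj₁ a) = ¬near (inj₂ (inj₁ (c , a , ec)))
            far c ec (inj₂ a) = ¬near (inj₂ (inj₂ (c , a , ec)))

        on-P : # P R? ≤ r
        on-P = subst (_≤ r) (sym (#≡length P R?)) (length≤# F._≟_ R? (U.filter⁺ R? (proj₂ path))
          λ x x∈ → ∈-allFin x , proj₂ (∈-filter⁻ R? {xs = P} x∈))

        suc-tail : suc (# ps R?) ≤ r
        suc-tail = ≤-trans (≤-reflexive (cong (_+ # ps R?) (sym (ι-yes (R? p) (ps , start))))) on-P

        #near : suc (# (V n) near?) ≤ 3 * r
        #near = begin
          suc (# (V n) near?)
            ≤⟨ s≤s (#-⊎ (V n) R? (λ w → (F.any? λ c → next? P w c ×-dec R? c) ⊎-dec (F.any? λ c → next? P c w ×-dec R? c)) near? λ _ x → x) ⟩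
          suc (r + # (V n) (λ w → (F.any? λ c → next? P w c ×-dec R? c) ⊎-dec (F.any? λ c → next? P c w ×-dec R? c)))
            ≤⟨ s≤s (+-monoʳ-≤ r (≤-trans (#-⊎ (V n) (λ w → F.any? λ c → next? P w c ×-dec R? c) (λ w → F.any? λ c → next? P c w ×-dec R? c)
                   (λ w → (F.any? λ c → next? P w c ×-dec R? c) ⊎-dec (F.any? λ c → next? P c w ×-dec R? c)) λ _ x → x) (+-mono-≤
                 (#≤cover F._≟_ (λ w → F.any? λ c → next? P w c ×-dec R? c) (prevs R? P) (V-unique n) λ w (c , nx , ec) → ∈-prevs R? nx ec)
                 (#≤cover F._≟_ (λ w → F.any? λ c → next? P c w ×-dec R? c) (nexts R? P) (V-unique n) λ w (c , nx , ec) → ∈-nexts R? nx ec)))) ⟩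
          suc (r + (length (prevs R? P) + length (nexts R? P)))
            ≤⟨ s≤s (+-monoʳ-≤ r (+-mono-≤ (≤-reflexive (length-prevs R? p ps)) (≤-trans (length-nexts R? p ps) on-P))) ⟩
          suc (r + (# ps R? + r))
            ≡⟨ shuffle r (# ps R?) ⟩
          r + (suc (# ps R?) + r)
            ≤⟨ +-monoʳ-≤ r (+-monoˡ-≤ r suc-tail) ⟩
          r + (r + r)
            ≡⟨ cong (r +_) (cong (r +_) (+-identityʳ r)) ⟨
          3 * r ∎
          where
          open ≤-Reasoning
          shuffle : ∀ r s → suc (r + (s + r)) ≡ r + (suc s + r)
          shuffle = solve-∀

      -- Otherwise expansion applies to the set of endpoints. All their neighbours are `Near`, so it
      -- would yield `3 * r` near vertices where `#near` allows fewer.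
      endpoints-many : n < 4 * r
      endpoints-many with n <? 4 * r
      ... | yes lt = lt
      ... | no ¬lt = ⊥-elim (<-irrefl refl (≤-trans #near (subst (λ k → 3 * k ≤ # (V n) near?) len
          (ex X (U.filter⁺ R? (V-unique n)) (subst (λ k → 4 * k ≤ n) (sym len) (≮⇒≥ ¬lt)) near?
            (λ x x∈ → inj₁ (isR x∈)) λ x x∈ y e → nbr-near x (isR x∈) y e))))
        where
        X = filter R? (V n)
        len : length X ≡ r
        len = sym (#≡length (V n) R?)
        isR : ∀ {x} → x ∈ X → Endpoint P x
        isR x∈ = proj₂ (∈-filter⁻ R? {xs = V n} x∈)

  -- The path has `k + 1` vertices, with `w` at its head; counting only its tail lets `k` range over
  -- `Fin n` in `Booster`.
  Longest : Rel n → ℕ → Fin n → Fin n → Set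
  Longest F k u w = (∃ λ q → length q ≡ k × Path F (w ∷ q) × Ends u (w ∷ q)) × ¬ HasPath F (suc (suc k))

  -- Adding the edge uw turns a longest path into a cycle.
  Booster : Rel n → Fin n → Fin n → Set
  Booster F u w = ∃ λ (k : Fin n) → Longest F (toℕ k) u w

  booster? : ∀ F u w → Dec (Booster F u w)
  booster? F u w = F.any? λ k → list? (toℕ k) (λ q → path? F (w ∷ q) ×-dec ends? u (w ∷ q)) ×-dec ¬? (hasPath? F (suc (suc (toℕ k))))

  -- Two rounds of rotations. With one end of a longest path fixed, they produce more than `n / 4`
  -- endpoints `u`; each resulting path is reversed, so that `u` becomes the fixed end, and rotating
  -- again produces the vertices `w`.
  many-boosters : ∀ {F} → Sym F → Expander F → ∀ k → HasPath F (suc k) → ¬ HasPath F (suc (suc k)) →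
    n < 4 * # (V n) (λ u → n <? 4 * # (V n) (booster? F u))
  many-boosters {F} sy ex k hp@(p ∷ ps , e , path) max =
    decidable-stable (n <? 4 * # (V n) (λ u → n <? 4 * # (V n) (booster? F u))) λ ¬goal → dns (λ v → ¬¬-dec) λ R? →
      ¬goal (<-≤-trans (endpoints-many p ps path longest R?) (*-monoʳ-≤ 4 (#-mono (V n) R? (λ u → n <? 4 * # (V n) (booster? F u)) second)))
    where
    open Posa sy ex
    k<n : k < n
    k<n = path-≤n F hp
    longest′ : ∀ q → Path F q → length q ≤ suc k
    longest′ q pa with length q ≤? suc k
    ... | yes le = le
    ... | no ¬le = ⊥-elim (max (hasPath-≤ F (≰⇒> ¬le) (q , refl , pa)))
    longest : ∀ q → Path F q → length q ≤ length (p ∷ ps)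
    longest q pa = subst (length q ≤_) (sym e) (longest′ q pa)
    b = proj₁ (ends-exists p ps)
    bE = proj₂ (ends-exists p ps)
    second : ∀ u → Endpoint (p ∷ ps) u → n < 4 * # (V n) (booster? F u)
    second u (q , reach) with ends-head (reach-ends bE reach) []
    ... | zs , eq = decidable-stable (n <? 4 * # (V n) (booster? F u)) λ ¬goal → dns (λ v → ¬¬-dec) λ R? →
        ¬goal (<-≤-trans (endpoints-many b zs path₂ (λ q pa → subst (length q ≤_) (sym len) (longest′ q pa)) R?)
          (*-monoʳ-≤ 4 (#-mono (V n) R? (booster? F u) third)))
      where
      path₁ = reach-path path reach
      path₂ : Path F (b ∷ zs)
      path₂ = subst (Path F) eq (linked-reverse swapF (u ∷ q) (proj₁ path₁)
        , Unique-resp-↭ (++↭ʳ++ (u ∷ q) []) (subst Unique (sym (L.++-identityʳ (u ∷ q))) (proj₂ path₁)))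
      endU : Ends u (b ∷ zs)
      endU = subst (Ends u) eq (ends-ʳ++ q here)
      len : length (b ∷ zs) ≡ suc k
      len = trans (cong length (sym eq)) (trans (L.length-ʳ++ (u ∷ q)) (trans (+-identityʳ _) (trans (reach-length reach) e)))
      third : ∀ w → Endpoint (b ∷ zs) w → Booster F u w
      third w (q′ , reach′) = fromℕ< k<n , subst (λ j → Longest F j u w) (sym (F.toℕ-fromℕ< k<n))
        ((q′ , suc-injective (trans (reach-length reach′) len) , reach-path path₂ reach′ , reach-ends endU reach′) , max)

-- Connectivity, and lengthening paths by boosters

module _ {n : ℕ} where

  -- Expansion of an `m`-element subset stays inside `W`. If `W` had fewer than `m` elements,
  -- expansion of `W` itself would force a nonempty set to triple within itself.
  closed-large : ∀ {F : Rel n} → Expander F → ∀ m → 4 * m ≤ n → {W : Fin n → Set} (W? : Decidable W) → (∃ λ w → W w) →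
    (∀ x y → W x → at F x y → W y) → 3 * m ≤ # (V n) W?
  closed-large {F} ex m 4m≤n {W} W? (w , Ww) closed = go (m ≤? c)
    where
    c = # (V n) W?
    1≤c : 1 ≤ c
    1≤c = ≤-trans (≤-reflexive (sym (ι-yes (W? w) Ww))) (∑-∈ (λ x → ι (W? x)) (∈-allFin w))
    grow : ∀ k → 4 * k ≤ n → k ≤ c → 3 * k ≤ c
    grow k 4k≤n le with choose W? k le
    ... | X , refl , u , inW = ex X u 4k≤n W? inW λ x x∈ y e → closed x y (inW x x∈) e
    go : Dec (m ≤ c) → 3 * m ≤ c
    go (yes le) = grow m 4m≤n le
    go (no ¬le) = ⊥-elim (<⇒≱ (m<m+n c {c + (c + 0)} (≤-trans 1≤c (m≤m+n c _)))
      (grow c (≤-trans (*-monoʳ-≤ 4 (<⇒≤ (≰⇒> ¬le))) 4m≤n) ≤-refl))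

  -- Connectivity. Without an edge leaving `W`, both `W` and its complement are closed and have at
  -- least `3 * (n / 4)` vertices each; `6 * (n / 4) ≤ n` fails from `n = 8` on.
  crossing : ∀ {F : Rel n} → Sym F → Expander F → 8 ≤ n → {W : Fin n → Set} (W? : Decidable W) →
    (∃ λ w → W w) → (∃ λ y → ¬ W y) → ∃ λ q → ∃ λ y → W q × ¬ W y × at F q y
  crossing {F} sy ex 8≤n {W} W? w y with F.any? (λ q → F.any? λ y → W? q ×-dec ¬? (W? y) ×-dec at? F q y)
  ... | yes p = p
  ... | no none = ⊥-elim (<⇒≱ n<8 8≤n)
    where
    m = n / 4
    eq : n ≡ n % 4 + m * 4
    eq = m≡m%n+[m/n]*n n 4
    4m≤n : 4 * m ≤ n
    4m≤n = ≤-trans (≤-reflexive (*-comm 4 m)) (≤-trans (m≤n+m (m * 4) (n % 4)) (≤-reflexive (sym eq)))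
    closed₁ : ∀ x y → W x → at F x y → W y
    closed₁ x y Wx e = decidable-stable (W? y) λ ¬Wy → none (x , y , Wx , ¬Wy , e)
    closed₂ : ∀ x y → ¬ W x → at F x y → ¬ W y
    closed₂ x y ¬Wx e Wy = none (y , x , Wy , ¬Wx , sy x y e)
    6m≤n : 3 * m + 3 * m ≤ n
    6m≤n = ≤-trans (+-mono-≤ (closed-large ex m 4m≤n W? w closed₁) (closed-large ex m 4m≤n (λ x → ¬? (W? x)) y closed₂))
      (≤-reflexive (trans (#-¬ (V n) W?) (V-length n)))
    n< : n < 4 * suc m
    n< = ≤-trans (≤-reflexive (cong suc eq)) (≤-trans (+-monoˡ-≤ (m * 4) (m%n<n n 4)) (≤-reflexive (r m)))
      where
      r : ∀ m → 4 + m * 4 ≡ 4 * suc m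
      r = solve-∀
    m<2 : m < 2
    m<2 = *-cancelˡ-< 2 m 2 (+-cancelʳ-< (4 * m) _ _ (≤-<-trans (≤-reflexive (r m)) (≤-<-trans 6m≤n (<-≤-trans n< (≤-reflexive (r′ m))))))
      where
      r : ∀ m → 2 * m + 4 * m ≡ 3 * m + 3 * m
      r = solve-∀
      r′ : ∀ m → 4 * suc m ≡ 2 * 2 + 4 * m
      r′ = solve-∀
    n<8 : n < 8
    n<8 = <-≤-trans n< (*-monoʳ-≤ 4 m<2)

  path-mono : ∀ {F G : Rel n} → F ⊑ G → ∀ {q} → Path F q → Path G q
  path-mono sub (l , u) = Linked.map (λ {x} {y} → sub x y) l , u

  hamC-mono : ∀ {F G : Rel n} → F ⊑ G → HamC F → HamC G
  hamC-mono sub (q , e , p , a , b , h , en , ba) = q , e , path-mono sub p , a , b , h , en , sub b a ba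

  -- The edge `uw` closes the path into a cycle. If the cycle misses a vertex, some edge joins an
  -- `x` on it to a `y` outside, and opening the cycle at `x` gives a path that starts at `y` and
  -- has one vertex more.
  close-up : ∀ {F G : Rel n} → Sym F → Expander F → 8 ≤ n → Sym G → F ⊑ G → ∀ {k u w} → Longest F k u w → at G u w →
    HamC G ⊎ HasPath G (suc (suc k))
  close-up {F} {G} sy ex 8≤n syG sub {k} {u} {w} ((q , e , path , end) , _) uw with F.all? (λ v → v ∈ᶠ? (w ∷ q))
  ... | yes all = inj₁ (w ∷ q , len , path-mono sub path , w , u , (q , refl) , end , uw)
    where
    len : length (w ∷ q) ≡ n
    len = ≤-antisym (path-≤n F (w ∷ q , refl , path)) (subst (_≤ length (w ∷ q)) (trans (#-all (V n) (λ x → x ∈ᶠ? (w ∷ q)) λ x _ → all x) (V-length n))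
      (#≤cover F._≟_ (λ x → x ∈ᶠ? (w ∷ q)) (w ∷ q) (V-unique n) λ x p → p))
  ... | no ¬all with crossing sy ex 8≤n (λ v → v ∈ᶠ? (w ∷ q)) (w , here refl) (F.¬∀⟶∃¬ n _ (λ v → v ∈ᶠ? (w ∷ q)) ¬all)
  ...   | x , y , x∈ , y∉ , xy with ∈-∃++ x∈
  ...     | as , bs , eq = inj₂ (y ∷ (x ∷ bs) ++ as , len , linked , unique)
    where
    path′ : Path G (as ++ x ∷ bs)
    path′ = subst (Path G) eq (path-mono sub path)
    end′ : Ends u (as ++ x ∷ bs)
    end′ = subst (Ends u) eq end
    perm : (as ++ x ∷ bs) ↭ ((x ∷ bs) ++ as)
    perm = ++-comm as (x ∷ bs)
    tl : ∀ as → w ∷ q ≡ as ++ x ∷ bs → Linked (at G) as → Linked (at G) ((x ∷ bs) ++ as)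
    -- Here `x` is the head `w`: the cycle is opened at its closing edge, and the old path is kept
    -- as it is.
    tl [] eq l = subst (Linked (at G)) (sym (L.++-identityʳ (x ∷ bs))) (linked-++⁻ʳ as (proj₁ path′))
    tl (a ∷ as′) refl l = linked-++ (ends-++⁻ as end′) uw (linked-++⁻ʳ as (proj₁ path′)) l
    linked : Linked (at G) (y ∷ (x ∷ bs) ++ as)
    linked = syG x y (sub x y xy) ∷ tl as eq (linked-++⁻ˡ as (proj₁ path′))
    unique : Unique (y ∷ (x ∷ bs) ++ as)
    unique = All.tabulate (λ { z∈ refl → y∉ (subst (y ∈_) (sym eq) (∈-resp-↭ (↭-sym perm) z∈)) }) ∷ Unique-resp-↭ perm (proj₂ path′)
      where open import Data.List.Relation.Binary.Permutation.Propositional.Properties using (∈-resp-↭)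
    len : length (y ∷ (x ∷ bs) ++ as) ≡ suc (suc k)
    len = cong suc (trans (sym (↭-length perm)) (trans (cong length (sym eq)) (cong suc e)))
      where open import Data.List.Relation.Binary.Permutation.Propositional.Properties using (↭-length)

  Edges : Set
  Edges = List (Fin n × Fin n)

  InE : Edges → Fin n → Fin n → Set
  InE es i j = (i , j) ∈ es ⊎ (j , i) ∈ es

  inE? : ∀ es i j → Dec (InE es i j)
  inE? es i j = ((i , j) ∈? es) ⊎-dec ((j , i) ∈? es)
    where open import Data.List.Membership.DecPropositional (×-≡-dec F._≟_ (F._≟_ {n}))

  gr : Edges → Rel n
  gr es i j = false orDec inE? es i j

  gr⁻ : ∀ es {i j} → at (gr es) i j → InE es i j
  gr⁻ es {i} {j} e with inE? es i j
  ... | yes p = p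

  gr⁺ : ∀ es {i j} → InE es i j → at (gr es) i j
  gr⁺ es {i} {j} p with inE? es i j
  ... | yes _ = refl
  ... | no ¬p = ⊥-elim (¬p p)

  gr-sym : ∀ es → Sym (gr es)
  gr-sym es i j e with gr⁻ es e
  ... | inj₁ p = gr⁺ es (inj₂ p)
  ... | inj₂ p = gr⁺ es (inj₁ p)

  gr-mono : ∀ {es fs} → (∀ e → e ∈ es → e ∈ fs) → gr es ⊑ gr fs
  gr-mono {es} {fs} h i j e with gr⁻ es e
  ... | inj₁ p = gr⁺ fs (inj₁ (h _ p))
  ... | inj₂ p = gr⁺ fs (inj₂ (h _ p))

  gr-⊑ : ∀ es {G} → Sym G → (∀ i j → (i , j) ∈ es → at G i j) → gr es ⊑ G
  gr-⊑ es sy h i j e with gr⁻ es e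
  ... | inj₁ p = h i j p
  ... | inj₂ p = sy j i (h j i p)

  gr-∷-⊑ : ∀ es {G u w} → Sym G → gr es ⊑ G → at G u w → gr ((u , w) ∷ es) ⊑ G
  gr-∷-⊑ es {G} {u} {w} sy sub uw = gr-⊑ ((u , w) ∷ es) sy go
    where
    go : ∀ i j → (i , j) ∈ (u , w) ∷ es → at G i j
    go i j (here refl) = uw
    go i j (there p) = sub i j (gr⁺ es (inj₁ p))

  tot-gr : ∀ es → tot (gr es) ≤ 2 * length es
  tot-gr [] = ≤-reflexive (trans (∑-cong (V n) λ i → #-none (V n) (at? (gr []) i) λ j _ e → none {i} {j} (gr⁻ [] e)) (∑-0 (V n)))
    where
    none : ∀ {i j} → ¬ InE [] i j
    none (inj₁ ())
    none (inj₂ ())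
  tot-gr ((a , b) ∷ es) = begin
    tot (gr ((a , b) ∷ es)) ≤⟨ ∑-mono (V n) (λ i → #-mono (V n) (at? (gr ((a , b) ∷ es)) i) (at? (ins (gr es) a b) i) (λ j e → split (gr⁻ ((a , b) ∷ es) e))) ⟩
    tot (ins (gr es) a b) ≤⟨ tot-ins (gr es) a b ⟩
    tot (gr es) + 2 ≤⟨ +-monoˡ-≤ 2 (tot-gr es) ⟩
    2 * length es + 2 ≡⟨ r (length es) ⟩
    2 * suc (length es) ∎
    where
    open ≤-Reasoning
    r : ∀ l → 2 * l + 2 ≡ 2 * suc l
    r = solve-∀
    split : ∀ {i j} → InE ((a , b) ∷ es) i j → at (ins (gr es) a b) i j
    split {i} {j} (inj₁ (here refl)) = ins-new (gr es) a b i j (inj₁ (refl , refl))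
    split {i} {j} (inj₁ (there p)) = ins-old (gr es) a b i j (gr⁺ es (inj₁ p))
    split {i} {j} (inj₂ (here refl)) = ins-new (gr es) a b i j (inj₂ (refl , refl))
    split {i} {j} (inj₂ (there p)) = ins-old (gr es) a b i j (gr⁺ es (inj₂ p))

  -- Each booster lengthens a longest path or closes a Hamilton cycle, so at most n of them are ever added.
  boost : (G : Rel n) → Sym G → 8 ≤ n → ∀ m →
    (∀ es → length es ≤ m → gr es ⊑ G → Expander (gr es) → ∃ λ u → ∃ λ w → Booster (gr es) u w × at G u w) →
    ∀ j k es → k + j ≡ n → length es + j ≤ m → gr es ⊑ G → Expander (gr es) → HasPath (gr es) (suc k) → HamC G
  boost G sy 8≤n m oracle zero k es kn le sub ex hp =
    ⊥-elim (<-irrefl (trans (sym (+-identityʳ k)) kn) (path-≤n (gr es) hp))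
  boost G sy 8≤n m oracle (suc j) k es kn le sub ex hp with oracle es (≤-trans (m≤m+n _ _) le) sub ex
  ... | u , w , (k′ , lg) , uw with close-up (gr-sym es) ex 8≤n (gr-sym ((u , w) ∷ es)) (gr-mono λ e → there) lg (gr⁺ ((u , w) ∷ es) (inj₁ (here refl)))
  ...   | inj₁ ham = hamC-mono (gr-∷-⊑ es sy sub uw) ham
  ...   | inj₂ hp′ = boost G sy 8≤n m oracle j (suc k) ((u , w) ∷ es) (trans (sym (+-suc k j)) kn) (≤-trans (≤-reflexive (sym (+-suc _ j))) le)
            (gr-∷-⊑ es sy sub uw) (expander-mono (gr-mono λ e → there) ex)
            (hasPath-≤ (gr ((u , w) ∷ es)) (s≤s (s≤s k≤k′)) hp′)
    where
    k≤k′ : k ≤ toℕ k′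
    k≤k′ with k ≤? toℕ k′
    ... | yes le = le
    ... | no ¬le = ⊥-elim (proj₂ lg (hasPath-≤ (gr es) (s≤s (≰⇒> ¬le)) hp))

-- From cyclic lists to `Hamiltonian`

linked-lookup : ∀ {A : Set} {R : A → A → Set} {q} → Linked R q → ∀ i j → suc (toℕ i) ≡ toℕ j →
  R (Data.List.lookup q i) (Data.List.lookup q j)
linked-lookup (r ∷ l) zero (suc zero) e = r
linked-lookup (r ∷ l) (suc i) (suc j) e = linked-lookup l i j (suc-injective e)
linked-lookup (r ∷ l) zero (suc (suc j)) ()

module _ {A : Set} where

  ends-lookup : ∀ {q} {b : A} → Ends b q → ∀ i → suc (toℕ i) ≡ length q → Data.List.lookup q i ≡ b
  ends-lookup here zero e = refl
  ends-lookup (there (here)) zero ()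
  ends-lookup (there (there _)) zero ()
  ends-lookup (there en) (suc i) e = ends-lookup en i (suc-injective e)

  unique-lookup : ∀ {q : List A} → Unique q → ∀ i j → Data.List.lookup q i ≡ Data.List.lookup q j → i ≡ j
  unique-lookup (x ∷ u) zero zero e = refl
  unique-lookup {y ∷ q} (x ∷ u) zero (suc j) e = ⊥-elim (All.lookup x (∈-lookup j) e)
    where open import Data.List.Membership.Propositional.Properties using (∈-lookup)
  unique-lookup {y ∷ q} (x ∷ u) (suc i) zero e = ⊥-elim (All.lookup x (∈-lookup i) (sym e))
    where open import Data.List.Membership.Propositional.Properties using (∈-lookup)
  unique-lookup (x ∷ u) (suc i) (suc j) e = cong suc (unique-lookup u i j e)

hamiltonian : ∀ {n} (M : Mat n) → 3 ≤ n → HamC (adj M) → Hamiltonian M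
hamiltonian {n} M 3≤n (.(a ∷ q) , e , (l , u) , a , b , (q , refl) , en , ba) = 3≤n , σ
  , (λ {i} {j} eq → F.toℕ-injective (trans (sym (F.toℕ-cast (sym e) i)) (trans (cong toℕ (unique-lookup u (c i) (c j) eq)) (F.toℕ-cast (sym e) j))))
  , (λ i j eq → linked-lookup l (c i) (c j) (trans (cong suc (F.toℕ-cast (sym e) i)) (trans eq (sym (F.toℕ-cast (sym e) j)))))
  , closing
  where
  c : Fin n → Fin (length (a ∷ q))
  c = cast (sym e)
  σ : Fin n → Fin n
  σ i = Data.List.lookup (a ∷ q) (c i)
  first : ∀ (i : Fin (length (a ∷ q))) → toℕ i ≡ 0 → Data.List.lookup (a ∷ q) i ≡ a
  first zero _ = refl
  closing : ∀ k l → suc (toℕ k) ≡ n → toℕ l ≡ 0 → adj M (σ k) (σ l) ≡ true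
  closing k l kn l0 = subst₂ (λ x y → adj M x y ≡ true)
    (sym (ends-lookup en (c k) (trans (cong suc (F.toℕ-cast (sym e) k)) (trans kn (sym e)))))
    (sym (first (c l) (trans (F.toℕ-cast (sym e) l) l0))) ba

-- Sparse expanding subgraphs

-- Greedy choice: each new element hits a proportion 1/(c+1) of the sets not hit so far.
hitting-set : ∀ {P E : Set} {Hit : P → E → Set} (hit? : ∀ p → Decidable (Hit p)) (es : List E) (N c : ℕ) → 1 ≤ N → length es ≤ N →
  ∀ k (ps : List P) → (∀ p → p ∈ ps → N ≤ suc c * # es (hit? p)) → c ^ k * length ps < suc c ^ k →
  ∃ λ hs → length hs ≤ k × (∀ e → e ∈ hs → e ∈ es) × (∀ p → p ∈ ps → ∃ λ e → e ∈ hs × Hit p e)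
hitting-set hit? es N c 1≤N le zero [] rich lt = [] , z≤n , (λ _ ()) , λ _ ()
hitting-set hit? es N c 1≤N le zero (p ∷ ps) rich (s≤s ())
hitting-set hit? es N c 1≤N le (suc k) [] rich lt = [] , z≤n , (λ _ ()) , λ _ ()
hitting-set hit? [] N c 1≤N le (suc k) (p ∷ ps) rich lt =
  ⊥-elim (<⇒≱ 1≤N (≤-trans (rich p (here refl)) (≤-reflexive (*-zeroʳ (suc c)))))
hitting-set {P} {E} hit? es@(e₀ ∷ es′) N c 1≤N le (suc k) ps@(_ ∷ _) rich lt with average e₀ es′ (λ e → # ps (λ p → hit? p e))
... | e , e∈ , avg with hitting-set hit? es N c 1≤N le k (filter (λ p → ¬? (hit? p e)) ps)
                        (λ p p∈ → rich p (proj₁ (∈-filter⁻ (λ p → ¬? (hit? p e)) p∈))) small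
  where
  open ≤-Reasoning
  h = # ps (λ p → hit? p e)
  r = length (filter (λ p → ¬? (hit? p e)) ps)
  r+h : h + r ≡ length ps
  r+h = trans (cong (h +_) (sym (#≡length ps (λ p → ¬? (hit? p e))))) (#-¬ ps (λ p → hit? p e))
  gain : length ps ≤ suc c * h
  gain = *-cancelˡ-≤ N {{>-nonZero 1≤N}} (begin
    N * length ps ≡⟨ *-comm N (length ps) ⟩
    length ps * N ≡⟨ ∑-const ps N ⟨
    ∑ ps (λ _ → N) ≤⟨ ∑-mono∈ ps rich ⟩
    ∑ ps (λ p → suc c * # es (hit? p)) ≡⟨ ∑-*ˡ ps (suc c) (λ p → # es (hit? p)) ⟩
    suc c * ∑ ps (λ p → # es (hit? p)) ≡⟨ cong (suc c *_) (∑-swap ps es (λ p e → ι (hit? p e))) ⟩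
    suc c * ∑ es (λ e → # ps (λ p → hit? p e)) ≤⟨ *-monoʳ-≤ (suc c) (≤-trans avg (*-monoˡ-≤ h le)) ⟩
    suc c * (N * h) ≡⟨ r₁ (suc c) N h ⟩
    N * (suc c * h) ∎)
    where
    r₁ : ∀ a b c → a * (b * c) ≡ b * (a * c)
    r₁ = solve-∀
  shrink : suc c * r ≤ c * length ps
  shrink = +-cancelˡ-≤ (length ps) _ _ (begin
    length ps + suc c * r ≤⟨ +-monoˡ-≤ (suc c * r) gain ⟩
    suc c * h + suc c * r ≡⟨ *-distribˡ-+ (suc c) h r ⟨
    suc c * (h + r) ≡⟨ cong (suc c *_) r+h ⟩
    length ps + c * length ps ∎)
  small : c ^ k * r < suc c ^ k
  small = *-cancelˡ-< (suc c) _ _ (begin-strict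
    suc c * (c ^ k * r) ≡⟨ r₂ (suc c) (c ^ k) r ⟩
    c ^ k * (suc c * r) ≤⟨ *-monoʳ-≤ (c ^ k) shrink ⟩
    c ^ k * (c * length ps) ≡⟨ r₃ (c ^ k) c (length ps) ⟩
    c ^ suc k * length ps <⟨ lt ⟩
    suc c ^ suc k ∎)
    where
    r₂ : ∀ a b c → a * (b * c) ≡ b * (a * c)
    r₂ = solve-∀
    r₃ : ∀ a b c → a * (b * c) ≡ b * a * c
    r₃ = solve-∀
... | hs , len , sub , hits = e ∷ hs , s≤s len , (λ { _ (here refl) → e∈ ; x (there x∈) → sub x x∈ }) , all-hit
  where
  all-hit : ∀ p → p ∈ ps → ∃ λ e′ → e′ ∈ e ∷ hs × _
  all-hit p p∈ with hit? p e
  ... | yes q = e , here refl , q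
  ... | no ¬q with hits p (∈-filter⁺ (λ p → ¬? (hit? p e)) p∈ ¬q)
  ...   | e′ , e′∈ , q = e′ , there e′∈ , q

-- Vertex sets and the exceptional configurations

module _ {n : ℕ} where

  Mem : Vec Bool n → Fin n → Set
  Mem X i = lookup X i ≡ true

  mem? : ∀ X → Decidable (Mem X)
  mem? X i = lookup X i B.≟ true

  size : Vec Bool n → ℕ
  size X = # (V n) (mem? X)

  toVec : {P : Fin n → Set} → Decidable P → Vec Bool n
  toVec P? = Vec.tabulate λ i → false orDec P? i

  mem-toVec⁺ : {P : Fin n → Set} (P? : Decidable P) {i : Fin n} → P i → Mem (toVec P?) i
  mem-toVec⁺ P? {i} p rewrite VecP.lookup∘tabulate (λ i → false orDec P? i) i with P? i
  ... | yes _ = refl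
  ... | no ¬p = ⊥-elim (¬p p)

  mem-toVec⁻ : {P : Fin n → Set} (P? : Decidable P) {i : Fin n} → Mem (toVec P?) i → P i
  mem-toVec⁻ P? {i} e rewrite VecP.lookup∘tabulate (λ i → false orDec P? i) i with P? i
  ... | yes p = p

  size-toVec : {P : Fin n → Set} (P? : Decidable P) → size (toVec P?) ≡ # (V n) P?
  size-toVec P? = #-cong (V n) (mem? (toVec P?)) P? (λ i → mem-toVec⁻ P?) (λ i → mem-toVec⁺ P?)

  size-list : ∀ {X} → Unique X → size (toVec (λ x → x ∈ᶠ? X)) ≡ length X
  size-list {X} u = trans (size-toVec (λ x → x ∈ᶠ? X)) (≤-antisym (#≤cover F._≟_ (λ x → x ∈ᶠ? X) X (V-unique n) λ x p → p)
    (length≤# F._≟_ (λ x → x ∈ᶠ? X) u λ x p → ∈-allFin x , p))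

  into : Mat n → Vec Bool n → Fin n → ℕ
  into G W v = # (V n) (λ y → at? (adj G) v y ×-dec mem? W y)

  -- What a small set `X` that fails to triple would force in `G` once `s` edges are kept at each
  -- vertex, with `W` in the role of its closed neighbourhood.
  record Dense (s B : ℕ) (X W : Vec Bool n) (G : Mat n) : Set where
    constructor mk
    field
      sizes : 1 ≤ size X × 2 * B * size X ≤ n × size W ≤ 3 * size X
      inward : ∀ v → Mem X v → s ≤ into G W v

  dense? : ∀ s B X W G → Dec (Dense s B X W G)
  dense? s B X W G = map′ (λ (p , q) → mk p q) (λ (mk p q) → p , q)
    (((1 ≤? size X) ×-dec (2 * B * size X ≤? n) ×-dec (size W ≤? 3 * size X)) ×-dec
    F.all? (λ v → mem? X v →-dec (s ≤? into G W v)))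

  -- The bound 4d/5 is chosen so that a vertex falling below it keeps edges out of `W` whatever is
  -- deleted.
  record Trapped (d B : ℕ) (X W : Vec Bool n) (G : Mat n) : Set where
    constructor mk
    field
      sizes : n ≤ 4 * B * size X × 4 * size W ≤ 3 * n
      inward : ∀ v → Mem X v → 4 * d ≤ 5 * into G W v

  trapped? : ∀ d B X W G → Dec (Trapped d B X W G)
  trapped? d B X W G = map′ (λ (p , q) → mk p q) (λ (mk p q) → p , q)
    (((n ≤? 4 * B * size X) ×-dec (4 * size W ≤? 3 * n)) ×-dec
    F.all? (λ v → mem? X v →-dec (4 * d ≤? 5 * into G W v)))

  record Rich (Γ : Mat n) (v : Fin n) : Set where
    constructor mk
    field many : n < 4 * # (V n) (booster? (adj Γ) v)

  rich? : ∀ Γ → Decidable (Rich Γ)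
  rich? Γ v = map′ mk Rich.many (n <? 4 * # (V n) (booster? (adj Γ) v))

  outside : Mat n → Mat n → Fin n → ℕ
  outside Γ G v = # (V n) (λ y → at? (adj G) v y ×-dec ¬? (booster? (adj Γ) v y))

  -- `Expander` quantifies over predicates and cannot be tested matrix by matrix. Its consequence
  -- `rich` can be decided, so the union bound runs over matrices with that property.
  record Sparse (M : ℕ) (Γ : Mat n) : Set where
    constructor mk
    field
      symmetric : ∀ i j → at (adj Γ) i j → at (adj Γ) j i
      few-edges : tot (adj Γ) ≤ M
      rich : n < 4 * # (V n) (rich? Γ)

  sparse? : ∀ M Γ → Dec (Sparse M Γ)
  sparse? M Γ = map′ (λ (p , q , r) → mk p q r) (λ (mk p q r) → p , q , r)
    ((F.all? λ i → F.all? λ j → at? (adj Γ) i j →-dec at? (adj Γ) j i) ×-dec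
    (tot (adj Γ) ≤? M) ×-dec (n <? 4 * # (V n) (rich? Γ)))

  record Unboosted (d : ℕ) (Γ G : Mat n) : Set where
    constructor mk
    field stuck : ∀ v → Rich Γ v → 4 * d ≤ 5 * outside Γ G v

  unboosted? : ∀ d Γ G → Dec (Unboosted d Γ G)
  unboosted? d Γ G = map′ mk Unboosted.stuck (F.all? λ v → rich? Γ v →-dec (4 * d ≤? 5 * outside Γ G v))

max-path : ∀ {n} (F : Rel n) j k → k + j ≡ n → HasPath F (suc k) → ∃ λ k → HasPath F (suc k) × ¬ HasPath F (suc (suc k))
max-path F zero k e hp = ⊥-elim (<-irrefl (trans (sym (+-identityʳ k)) e) (path-≤n F hp))
max-path F (suc j) k e hp with hasPath? F (suc (suc k))
... | yes hp′ = max-path F j (suc k) (trans (sym (+-suc k j)) e) hp′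
... | no ¬hp = k , hp , ¬hp

booster-resp : ∀ {n} {F G : Rel n} → F ⊑ G → G ⊑ F → ∀ {u w} → Booster F u w → Booster G u w
booster-resp fg gf (k , (q , e , p , en) , ¬hp) = k , (q , e , path-mono fg p , en) , λ { (q , e , p) → ¬hp (q , e , path-mono gf p) }

length-concatMap : ∀ {A B : Set} (f : A → List B) (xs : List A) → length (concatMap f xs) ≡ ∑ xs (length ∘ f)
length-concatMap f [] = refl
length-concatMap f (x ∷ xs) = trans (L.length-++ (f x)) (cong (length (f x) +_) (length-concatMap f xs))

length-product : ∀ {A B : Set} (xs : List A) (ys : List B) → length (cartesianProduct xs ys) ≡ length xs * length ys
length-product [] ys = refl
length-product (x ∷ xs) ys = trans (L.length-++ (map (x ,_) ys)) (cong₂ _+_ (L.length-map (x ,_) ys) (length-product xs ys))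

length-allVecs : ∀ k → length (allVecs bools k) ≡ 2 ^ k
length-allVecs zero = refl
length-allVecs (suc k) = trans (length-concatMap (λ x → map (x ∷_) (allVecs bools k)) bools)
  (cong₂ _+_ (one true) (cong (_+ 0) (one false)))
  where
  one : ∀ b → length (map {B = Vec Bool (suc k)} (b ∷_) (allVecs bools k)) ≡ 2 ^ k
  one b = trans (L.length-map (b ∷_) (allVecs bools k)) (length-allVecs k)

rowMinus-lookup : ∀ {m} (u v : Vec Bool m) i → lookup (rowMinus u v) i ≡ (lookup u i Data.Bool.∧ Data.Bool.not (lookup v i))
rowMinus-lookup (a ∷ u) (b ∷ v) zero = refl
rowMinus-lookup (a ∷ u) (b ∷ v) (suc i) = rowMinus-lookup u v i

minusRows-lookup : ∀ {m k} (G H : Vec (Vec Bool m) k) i → lookup (minusRows G H) i ≡ rowMinus (lookup G i) (lookup H i)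
minusRows-lookup (g ∷ G) (h ∷ H) zero = refl
minusRows-lookup (g ∷ G) (h ∷ H) (suc i) = minusRows-lookup G H i

adj-minus : ∀ {n} (G H : Mat n) i j → adj (minus G H) i j ≡ (adj G i j Data.Bool.∧ Data.Bool.not (adj H i j))
adj-minus G H i j = trans (cong (λ r → lookup r j) (minusRows-lookup G H i)) (rowMinus-lookup (lookup G i) (lookup H i) j)

minus⁺ : ∀ {n} (G H : Mat n) {i j} → at (adj G) i j → ¬ at (adj H) i j → at (adj (minus G H)) i j
minus⁺ G H {i} {j} g ¬h = trans (adj-minus G H i j) (cong₂ (λ a b → a Data.Bool.∧ Data.Bool.not b) g (≢true ¬h))

minus⁻ : ∀ {n} (G H : Mat n) {i j} → at (adj (minus G H)) i j → at (adj G) i j × ¬ at (adj H) i j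
minus⁻ G H {i} {j} e with adj G i j | adj H i j | trans (sym (adj-minus G H i j)) e
... | true | false | _ = refl , λ ()

-- Resilience of a graph free of exceptional configurations

module Deterministic {d n : ℕ} (s B c K M : ℕ) (G : Mat n) (H D : Rel n) (reg : Regular d G) (D-sym : Sym D)
  (D⊑G : D ⊑ adj G) (survive : ∀ i j → at (adj G) i j → ¬ at H i j → at D i j) (few : ∀ v → 6 * dg H v < d) (8≤n : 8 ≤ n) (2s≤d : 2 * s ≤ d) (c-def : suc c ≡ 120 * B)
  (M-large : 2 * ((n * s + K) + n) ≤ M) (hits-enough : c ^ K * 4 ^ n < suc c ^ K)
  (¬dense : ∀ X W → ¬ Dense s B X W G) (¬trapped : ∀ X W → ¬ Trapped d B X W G)
  (¬unboosted : ∀ Γ → Sparse M Γ → adj Γ ⊑ adj G → ¬ Unboosted d Γ G) where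

  private
    1≤d : 1 ≤ d
    1≤d = ≤-trans (s≤s z≤n) (few (fromℕ< {0} (≤-trans (s≤s z≤n) 8≤n)))

    split-H : ∀ {P : Fin n → Set} (P? : Decidable P) v → # (V n) (λ y → at? (adj G) v y ×-dec P? y) ≤
      # (V n) (λ y → at? D v y ×-dec P? y) + dg H v
    split-H {P} P? v = #-⊎ (V n) (λ y → at? D v y ×-dec P? y) (at? H v) (λ y → at? (adj G) v y ×-dec P? y) go
      where
      go : ∀ y → at (adj G) v y × P y → (at D v y × P y) ⊎ at H v y
      go y (g , p) with at? H v y
      ... | yes h = inj₂ h
      ... | no ¬h = inj₁ (survive v y g ¬h , p)

    split-P : ∀ {P : Fin n → Set} (P? : Decidable P) v →
      # (V n) (λ y → at? (adj G) v y ×-dec P? y) + # (V n) (λ y → at? (adj G) v y ×-dec ¬? (P? y)) ≡ d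
    split-P P? v = trans (sym (∑-+ (V n) (λ y → ι (at? (adj G) v y ×-dec P? y)) (λ y → ι (at? (adj G) v y ×-dec ¬? (P? y)))))
      (trans (∑-cong (V n) eq) (reg-dg G reg v))
      where
      eq : ∀ y → ι (at? (adj G) v y ×-dec P? y) + ι (at? (adj G) v y ×-dec ¬? (P? y)) ≡ ι (at? (adj G) v y)
      eq y with at? (adj G) v y | P? y
      ... | yes _ | yes _ = refl
      ... | yes _ | no _ = refl
      ... | no _ | _ = refl

    -- More than d/5 neighbours of v lie outside P, and H removes less than d/6 of them.
    many-out : ∀ {P : Fin n → Set} (P? : Decidable P) v → 5 * # (V n) (λ y → at? (adj G) v y ×-dec P? y) < 4 * d →
      d ≤ 30 * # (V n) (λ y → at? D v y ×-dec ¬? (P? y))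
    many-out P? v lt = +-cancelʳ-≤ (5 * (6 * h)) _ _ (+-cancelʳ-≤ (6 * (4 * d)) _ _ (begin
      d + 5 * (6 * h) + 6 * (4 * d) ≤⟨ +-monoˡ-≤ (6 * (4 * d)) (+-monoʳ-≤ d (*-monoʳ-≤ 5 (<⇒≤ (few v)))) ⟩
      d + 5 * d + 6 * (4 * d) ≡⟨ r₁ d ⟩
      30 * d ≡⟨ cong (30 *_) (split-P P? v) ⟨
      30 * (a + b) ≡⟨ r₂ a b ⟩
      6 * (5 * a) + 30 * b ≤⟨ +-mono-≤ (*-monoʳ-≤ 6 (<⇒≤ lt)) (*-monoʳ-≤ 30 (split-H (λ y → ¬? (P? y)) v)) ⟩
      6 * (4 * d) + 30 * (o + h) ≡⟨ r₃ d o h ⟩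
      30 * o + 5 * (6 * h) + 6 * (4 * d) ∎))
      where
      open ≤-Reasoning
      h = dg H v
      a = # (V n) (λ y → at? (adj G) v y ×-dec P? y)
      b = # (V n) (λ y → at? (adj G) v y ×-dec ¬? (P? y))
      o = # (V n) (λ y → at? D v y ×-dec ¬? (P? y))
      r₁ : ∀ d → d + 5 * d + 6 * (4 * d) ≡ 30 * d
      r₁ = solve-∀
      r₂ : ∀ a b → 30 * (a + b) ≡ 6 * (5 * a) + 30 * b
      r₂ = solve-∀
      r₃ : ∀ d o h → 6 * (4 * d) + 30 * (o + h) ≡ 30 * o + 5 * (6 * h) + 6 * (4 * d)
      r₃ = solve-∀

    -- `D` retains more than 5d/6 edges at each vertex, whereas `s` is at most d/2.
    enough : ∀ v → s ≤ dg D v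
    enough v = *-cancelˡ-≤ 6 (+-cancelʳ-≤ (6 * dg H v) _ _ (begin
      6 * s + 6 * dg H v ≤⟨ +-monoʳ-≤ (6 * s) (<⇒≤ (few v)) ⟩
      6 * s + d ≡⟨ cong (_+ d) (*-assoc 3 2 s) ⟩
      3 * (2 * s) + d ≤⟨ +-monoˡ-≤ d (*-monoʳ-≤ 3 2s≤d) ⟩
      3 * d + d ≤⟨ m≤n+m (3 * d + d) (d + d) ⟩
      (d + d) + (3 * d + d) ≡⟨ r₁ d ⟩
      6 * d ≤⟨ *-monoʳ-≤ 6 all ⟩
      6 * (dg D v + dg H v) ≡⟨ *-distribˡ-+ 6 (dg D v) _ ⟩
      6 * dg D v + 6 * dg H v ∎))
      where
      open ≤-Reasoning
      r₁ : ∀ d → (d + d) + (3 * d + d) ≡ 6 * d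
      r₁ = solve-∀
      all : d ≤ dg D v + dg H v
      all = subst (_≤ dg D v + dg H v) (reg-dg G reg v) (#-⊎ (V n) (at? D v) (at? H v) (at? (adj G) v) go)
        where
        go : ∀ y → at (adj G) v y → at D v y ⊎ at H v y
        go y g with at? H v y
        ... | yes h = inj₂ h
        ... | no ¬h = inj₁ (survive v y g ¬h)

    nb : Fin n → List (Fin n)
    nb v = proj₁ (choose (at? D v) s (enough v))

    nb-length : ∀ v → length (nb v) ≡ s
    nb-length v = proj₁ (proj₂ (choose (at? D v) s (enough v)))

    nb-unique : ∀ v → Unique (nb v)
    nb-unique v = proj₁ (proj₂ (proj₂ (choose (at? D v) s (enough v))))

    nb-adj : ∀ v y → y ∈ nb v → at D v y
    nb-adj v = proj₂ (proj₂ (proj₂ (choose (at? D v) s (enough v))))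

    local : Edges {n}
    local = concatMap (λ v → map (v ,_) (nb v)) (V n)

    local-length : length local ≡ n * s
    local-length = trans (length-concatMap (λ v → map (v ,_) (nb v)) (V n))
      (trans (∑-cong (V n) λ v → trans (L.length-map (v ,_) (nb v)) (nb-length v)) (trans (∑-const (V n) s) (cong (_* s) (V-length n))))

    ∈-local⁺ : ∀ {v y} → y ∈ nb v → (v , y) ∈ local
    ∈-local⁺ {v} {y} y∈ = ∈-concat⁺′ (∈-map⁺ (v ,_) y∈) (∈-map⁺ (λ v → map (v ,_) (nb v)) (∈-allFin v))

    ∈-local⁻ : ∀ {i j} → (i , j) ∈ local → at D i j
    ∈-local⁻ {i} {j} p with ∈-concat⁻′ (map (λ v → map (v ,_) (nb v)) (V n)) p
    ... | ys , p∈ , ys∈ with ∈-map⁻ (λ v → map (v ,_) (nb v)) ys∈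
    ...   | v , _ , refl with ∈-map⁻ (v ,_) p∈
    ...     | y , y∈ , refl = nb-adj v y y∈

    arcs : Edges {n}
    arcs = filter (λ e → at? D (proj₁ e) (proj₂ e)) (cartesianProduct (V n) (V n))

    ∑-product : ∀ {A B : Set} (xs : List A) (ys : List B) (f : A × B → ℕ) → ∑ (cartesianProduct xs ys) f ≡ ∑ xs (λ x → ∑ ys (λ y → f (x , y)))
    ∑-product [] ys f = refl
    ∑-product (x ∷ xs) ys f = trans (∑-++ (map (x ,_) ys) _ f) (cong₂ _+_ (∑-map (x ,_) ys f) (∑-product xs ys f))

    arcs-length : length arcs ≤ d * n
    arcs-length = begin
      length arcs ≡⟨ #≡length (cartesianProduct (V n) (V n)) (λ e → at? D (proj₁ e) (proj₂ e)) ⟨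
      # (cartesianProduct (V n) (V n)) (λ e → at? D (proj₁ e) (proj₂ e))
        ≡⟨ ∑-product (V n) (V n) (λ e → ι (at? D (proj₁ e) (proj₂ e))) ⟩
      ∑ (V n) (dg D) ≤⟨ ∑-mono (V n) (λ v → ≤-trans (#-mono (V n) (at? D v) (at? (adj G) v) λ y e → D⊑G v y e) (≤-reflexive (reg-dg G reg v))) ⟩
      ∑ (V n) (λ _ → d) ≡⟨ ∑-const (V n) d ⟩
      length (V n) * d ≡⟨ cong (_* d) (V-length n) ⟩
      n * d ≡⟨ *-comm n d ⟩
      d * n ∎
      where open ≤-Reasoning

    -- An arc from `X` that leaves `W`; its presence prevents `W` from containing all neighbours of
    -- `X`.
    Cut : Vec Bool n × Vec Bool n → Fin n × Fin n → Set
    Cut (X , W) (u , v) = Mem X u × ¬ Mem W v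

    cut? : ∀ p → Decidable (Cut p)
    cut? (X , W) (u , v) = mem? X u ×-dec ¬? (mem? W v)

    Big : Vec Bool n × Vec Bool n → Set
    Big (X , W) = n ≤ 2 * B * size X × 4 * size W ≤ 3 * n

    big? : Decidable Big
    big? (X , W) = (n ≤? 2 * B * size X) ×-dec (4 * size W ≤? 3 * n)

    family : List (Vec Bool n × Vec Bool n)
    family = filter big? (cartesianProduct (allVecs bools n) (allVecs bools n))

    -- By `¬trapped`, fewer than n/4B vertices of `X` send 4d/5 of their edges into `W`. At least
    -- n/4B others remain, each with d/30 surviving arcs out of `W` by `many-out`. Together these
    -- are dn/120B arcs, whence `suc c ≡ 120 * B`.
    cut-many : ∀ p → p ∈ family → d * n ≤ suc c * # arcs (cut? p)
    cut-many (X , W) p∈ = begin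
      d * n ≤⟨ *-monoʳ-≤ d n≤Y ⟩
      d * (4 * B * # (V n) Y?) ≡⟨ r₁ d B (# (V n) Y?) ⟩
      4 * B * (# (V n) Y? * d) ≡⟨ cong (4 * B *_) (∑-*ʳ (V n) d (λ v → ι (Y? v))) ⟨
      4 * B * ∑ (V n) (λ v → ι (Y? v) * d) ≤⟨ *-monoʳ-≤ (4 * B) (∑-mono (V n) per) ⟩
      4 * B * ∑ (V n) (λ v → 30 * (ι (mem? X v) * out v)) ≡⟨ cong (4 * B *_) (∑-*ˡ (V n) 30 (λ v → ι (mem? X v) * out v)) ⟩
      4 * B * (30 * ∑ (V n) (λ v → ι (mem? X v) * out v)) ≡⟨ r₂ B (∑ (V n) (λ v → ι (mem? X v) * out v)) ⟩
      120 * B * ∑ (V n) (λ v → ι (mem? X v) * out v) ≡⟨ cong₂ _*_ (sym c-def) (sym count) ⟩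
      suc c * # arcs (cut? (X , W)) ∎
      where
      open ≤-Reasoning
      big = proj₂ (∈-filter⁻ big? {xs = cartesianProduct (allVecs bools n) (allVecs bools n)} p∈)
      out : Fin n → ℕ
      out v = # (V n) (λ y → at? D v y ×-dec ¬? (mem? W y))
      X′? : ∀ v → Dec (Mem X v × 4 * d ≤ 5 * into G W v)
      X′? v = mem? X v ×-dec (4 * d ≤? 5 * into G W v)
      Y? : ∀ v → Dec (Mem X v × ¬ (4 * d ≤ 5 * into G W v))
      Y? v = mem? X v ×-dec ¬? (4 * d ≤? 5 * into G W v)
      X′<n : 4 * B * # (V n) X′? < n
      X′<n = ≰⇒> λ le → ¬trapped (toVec X′?) W (mk (subst (λ k → n ≤ 4 * B * k) (sym (size-toVec X′?)) le , proj₂ big)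
        λ v m → proj₂ (mem-toVec⁻ X′? m))
      X≤ : size X ≤ # (V n) X′? + # (V n) Y?
      X≤ = #-⊎ (V n) X′? Y? (mem? X) go
        where
        go : ∀ v → Mem X v → (Mem X v × 4 * d ≤ 5 * into G W v) ⊎ (Mem X v × ¬ (4 * d ≤ 5 * into G W v))
        go v m with 4 * d ≤? 5 * into G W v
        ... | yes p = inj₁ (m , p)
        ... | no p = inj₂ (m , p)
      n≤Y : n ≤ 4 * B * # (V n) Y?
      n≤Y = +-cancelˡ-≤ n _ _ (begin
        n + n ≤⟨ +-mono-≤ (proj₁ big) (proj₁ big) ⟩
        2 * B * size X + 2 * B * size X ≡⟨ r B (size X) ⟩
        4 * B * size X ≤⟨ *-monoʳ-≤ (4 * B) X≤ ⟩
        4 * B * (# (V n) X′? + # (V n) Y?) ≡⟨ *-distribˡ-+ (4 * B) (# (V n) X′?) (# (V n) Y?) ⟩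
        4 * B * # (V n) X′? + 4 * B * # (V n) Y? ≤⟨ +-monoˡ-≤ (4 * B * # (V n) Y?) (<⇒≤ X′<n) ⟩
        n + 4 * B * # (V n) Y? ∎)
        where
        r : ∀ b x → 2 * b * x + 2 * b * x ≡ 4 * b * x
        r = solve-∀
      per : ∀ v → ι (Y? v) * d ≤ 30 * (ι (mem? X v) * out v)
      per v with Y? v
      ... | no _ = z≤n
      ... | yes (m , ¬le) = begin
        1 * d ≡⟨ *-identityˡ d ⟩
        d ≤⟨ many-out (mem? W) v (≰⇒> ¬le) ⟩
        30 * out v ≡⟨ cong (30 *_) (trans (cong (_* out v) (ι-yes (mem? X v) m)) (*-identityˡ (out v))) ⟨
        30 * (ι (mem? X v) * out v) ∎
      count : # arcs (cut? (X , W)) ≡ ∑ (V n) (λ v → ι (mem? X v) * out v)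
      count = trans (∑-filter (cartesianProduct (V n) (V n)) (λ e → at? D (proj₁ e) (proj₂ e)) (λ e → ι (cut? (X , W) e)))
        (trans (∑-product (V n) (V n) (λ e → ι (at? D (proj₁ e) (proj₂ e)) * ι (cut? (X , W) e)))
        (∑-cong (V n) λ u → trans (∑-cong (V n) λ v → eq u v) (∑-*ˡ (V n) (ι (mem? X u)) (λ y → ι (at? D u y ×-dec ¬? (mem? W y))))))
        where
        eq : ∀ u v → ι (at? D u v) * ι (mem? X u ×-dec ¬? (mem? W v)) ≡ ι (mem? X u) * ι (at? D u v ×-dec ¬? (mem? W v))
        eq u v with at? D u v | mem? X u | mem? W v
        ... | yes _ | yes _ | yes _ = refl
        ... | yes _ | yes _ | no _ = refl
        ... | yes _ | no _ | _ = refl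
        ... | no _ | yes _ | yes _ = refl
        ... | no _ | yes _ | no _ = refl
        ... | no _ | no _ | _ = refl
      r₁ : ∀ d b y → d * (4 * b * y) ≡ 4 * b * (y * d)
      r₁ = solve-∀
      r₂ : ∀ b t → 4 * b * (30 * t) ≡ 120 * b * t
      r₂ = solve-∀

    family-length : length family ≤ 4 ^ n
    family-length = begin
      length family ≤⟨ L.length-filter big? (cartesianProduct (allVecs bools n) (allVecs bools n)) ⟩
      length (cartesianProduct (allVecs bools n) (allVecs bools n)) ≡⟨ length-product (allVecs bools n) (allVecs bools n) ⟩
      length (allVecs bools n) * length (allVecs bools n) ≡⟨ cong₂ _*_ (length-allVecs n) (length-allVecs n) ⟩
      2 ^ n * 2 ^ n ≡⟨ ^-distribʳ-* n 2 2 ⟨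
      4 ^ n ∎
      where open ≤-Reasoning

    -- Suppose `|W| < 3|X|`. If `|X| ≤ n/2B`, the `s` kept edges at each vertex of `X` all end in
    -- `W`, against `¬dense`. If `X` is larger, then `|W| < 3|X| ≤ 3n/4`, and a chosen arc leads
    -- from `X` out of `W`.
    expander-of : ∀ es → (∀ v → ∃ λ ys → length ys ≡ s × Unique ys × (∀ y → y ∈ ys → at D v y × (v , y) ∈ es)) →
      (∀ X W → n ≤ 2 * B * size X → 4 * size W ≤ 3 * n → ∃ λ e → e ∈ es × Cut (X , W) e) → Expander (gr es)
    expander-of es near cuts X u 4x≤n W? X⊆W N⊆W with 3 * length X ≤? # (V n) W?
    ... | yes le = le
    ... | no ¬le with 2 * B * length X ≤? n
    ...   | yes 2Bx = ⊥-elim (¬dense Xv (toVec W?) (mk (subst (1 ≤_) (sym sX) 1≤x , subst (λ k → 2 * B * k ≤ n) (sym sX) 2Bx ,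
              subst₂ (λ a b → a ≤ 3 * b) (sym (size-toVec W?)) (sym sX) (<⇒≤ (≰⇒> ¬le))) dense))
      where
      Xv = toVec (λ x → x ∈ᶠ? X)
      sX = size-list u
      1≤x : 1 ≤ length X
      1≤x with length X | ≰⇒> ¬le
      ... | suc _ | _ = s≤s z≤n
      dense : ∀ v → Mem Xv v → s ≤ into G (toVec W?) v
      dense v m = subst (_≤ into G (toVec W?) v) (proj₁ (proj₂ (near v))) (length≤# F._≟_ (λ y → at? (adj G) v y ×-dec mem? (toVec W?) y) (proj₁ (proj₂ (proj₂ (near v))))
        λ y y∈ → ∈-allFin y , D⊑G v y (proj₁ (proj₂ (proj₂ (proj₂ (near v))) y y∈)) ,
          mem-toVec⁺ W? (N⊆W v (mem-toVec⁻ (λ x → x ∈ᶠ? X) m) y (gr⁺ es (inj₁ (proj₂ (proj₂ (proj₂ (proj₂ (near v))) y y∈))))))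
    ...   | no ¬2Bx = ⊥-elim (go (cuts Xv (toVec W?)
              (subst (λ k → n ≤ 2 * B * k) (sym sX) (<⇒≤ (≰⇒> ¬2Bx))) (subst (λ k → 4 * k ≤ 3 * n) (sym (size-toVec W?)) 4W)))
      where
      Xv = toVec (λ x → x ∈ᶠ? X)
      sX = size-list u
      4W : 4 * # (V n) W? ≤ 3 * n
      4W = ≤-trans (*-monoʳ-≤ 4 (<⇒≤ (≰⇒> ¬le))) (≤-trans (≤-reflexive (r (length X))) (*-monoʳ-≤ 3 4x≤n))
        where
        r : ∀ x → 4 * (3 * x) ≡ 3 * (4 * x)
        r = solve-∀
      go : ¬ (∃ λ e → e ∈ es × Cut (Xv , toVec W?) e)
      go ((a , b) , e∈ , mx , ¬mw) = ¬mw (mem-toVec⁺ W? (N⊆W a (mem-toVec⁻ (λ x → x ∈ᶠ? X) mx) b (gr⁺ es (inj₁ e∈))))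

    hitting = hitting-set cut? arcs (d * n) c (*-mono-≤ 1≤d (≤-trans (s≤s z≤n) 8≤n)) arcs-length K family cut-many
      (≤-<-trans (*-monoʳ-≤ (c ^ K) family-length) hits-enough)

    global : Edges {n}
    global = proj₁ hitting

    skeleton : Edges {n}
    skeleton = local ++ global

    skeleton-⊑ : gr skeleton ⊑ D
    skeleton-⊑ = gr-⊑ skeleton D-sym λ i j p → go i j (∈-++⁻ local p)
      where
      go : ∀ i j → (i , j) ∈ local ⊎ (i , j) ∈ global → at D i j
      go i j (inj₁ p) = ∈-local⁻ p
      go i j (inj₂ p) = proj₂ (∈-filter⁻ (λ e → at? D (proj₁ e) (proj₂ e)) {xs = cartesianProduct (V n) (V n)}
        (proj₁ (proj₂ (proj₂ hitting)) (i , j) p))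

    skeleton-length : length skeleton ≤ n * s + K
    skeleton-length = ≤-trans (≤-reflexive (L.length-++ local)) (+-mono-≤ (≤-reflexive local-length) (proj₁ (proj₂ hitting)))

    skeleton-expander : Expander (gr skeleton)
    skeleton-expander = expander-of skeleton
      (λ v → nb v , nb-length v , nb-unique v , λ y y∈ → nb-adj v y y∈ , ∈-++⁺ˡ (∈-local⁺ y∈))
      λ X W nX Wn → reach (X , W) (proj₂ (proj₂ (proj₂ hitting)) (X , W) (∈-filter⁺ big?
        (∈-cartesianProduct⁺ (∈-allVecs X λ i → ∈-bools _) (∈-allVecs W λ i → ∈-bools _)) (nX , Wn)))
      where
      reach : ∀ p → (∃ λ e → e ∈ global × Cut p e) → ∃ λ e → e ∈ skeleton × Cut p e
      reach _ (e , e∈ , h) = e , ∈-++⁺ʳ local e∈ , h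

    start : ∀ es → HasPath (gr es) 1
    start es = fromℕ< {0} (≤-trans (s≤s z≤n) 8≤n) ∷ [] , refl , [-] , [] ∷ []

    -- If no booster were an edge of `D`, then by `many-out` at least 4d/5 of the `G`-neighbours of
    -- every vertex would be non-boosters, making the sparse graph `Γ` unboosted in `G`.
    oracle : ∀ es → length es ≤ (n * s + K) + n → gr es ⊑ D → Expander (gr es) →
      ∃ λ u → ∃ λ w → Booster (gr es) u w × at D u w
    oracle es le esD ex = go (F.any? (λ u → F.any? λ w → booster? (adj Γ) u w ×-dec at? D u w))
      where
      Γ = toMat (gr es)
      to : gr es ⊑ adj Γ
      to i j h = trans (adj-toMat (gr es) i j) h
      from : adj Γ ⊑ gr es
      from i j h = trans (sym (adj-toMat (gr es) i j)) h
      carry : HasPath (gr es) 1 → HasPath (adj Γ) 1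
      carry (q , e , p) = q , e , path-mono to p
      longest = max-path (adj Γ) n 0 refl (carry (start es))
      Γ-sym : Sym (adj Γ)
      Γ-sym i j h = to j i (gr-sym es i j (from i j h))
      Γ-tot : tot (adj Γ) ≤ M
      Γ-tot = ≤-trans (∑-mono (V n) λ i → #-mono (V n) (at? (adj Γ) i) (at? (gr es) i) (from i)) (≤-trans (tot-gr es) (≤-trans (*-monoʳ-≤ 2 le) M-large))
      Γ⊑G : adj Γ ⊑ adj G
      Γ⊑G i j h = D⊑G i j (esD i j (from i j h))
      Γ-rich : n < 4 * # (V n) (rich? Γ)
      Γ-rich = <-≤-trans (many-boosters Γ-sym (expander-mono to ex) (proj₁ longest) (proj₁ (proj₂ longest)) (proj₂ (proj₂ longest)))
        (*-monoʳ-≤ 4 (#-mono (V n) (λ u → n <? 4 * # (V n) (booster? (adj Γ) u)) (rich? Γ) λ u → mk))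
      go : Dec (∃ λ u → ∃ λ w → Booster (adj Γ) u w × at D u w) → ∃ λ u → ∃ λ w → Booster (gr es) u w × at D u w
      go (yes (u , w , b , e)) = u , w , booster-resp from to b , e
      go (no none) = ⊥-elim (¬unboosted Γ (mk Γ-sym Γ-tot Γ-rich) Γ⊑G (mk λ v _ → ≮⇒≥ (stuck v)))
        where
        stuck : ∀ v → ¬ (5 * outside Γ G v < 4 * d)
        stuck v lt = <⇒≱ 1≤d (≤-trans (many-out (λ y → ¬? (booster? (adj Γ) v y)) v lt)
          (≤-reflexive (trans (cong (30 *_) (#-none (V n) (λ y → at? D v y ×-dec ¬? (¬? (booster? (adj Γ) v y))) λ y _ (e , ¬¬b) →
            none (v , y , decidable-stable (booster? (adj Γ) v y) ¬¬b , e))) (*-zeroʳ 30))))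

  hamilton-cycle : HamC D
  hamilton-cycle = boost D D-sym 8≤n ((n * s + K) + n) oracle n 0 skeleton refl (+-monoˡ-≤ n skeleton-length)
    skeleton-⊑ skeleton-expander (start skeleton)

-- Numerical estimates

bernoulli : ∀ n x → (n + x) * n ^ x ≤ suc n ^ x * n
bernoulli n zero = ≤-reflexive (r n)
  where
  r : ∀ n → (n + 0) * 1 ≡ 1 * n
  r = solve-∀
bernoulli n (suc x) = begin
  (n + suc x) * (n * n ^ x) ≤⟨ m≤m+n _ (x * n ^ x) ⟩
  (n + suc x) * (n * n ^ x) + x * n ^ x ≡⟨ r₁ n x (n ^ x) ⟩
  suc n * ((n + x) * n ^ x) ≤⟨ *-monoʳ-≤ (suc n) (bernoulli n x) ⟩
  suc n * (suc n ^ x * n) ≡⟨ *-assoc (suc n) (suc n ^ x) n ⟨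
  suc n * suc n ^ x * n ∎
  where
  open ≤-Reasoning
  r₁ : ∀ n x p → (n + suc x) * (n * p) + x * p ≡ suc n * ((n + x) * p)
  r₁ = solve-∀

double-power : ∀ n → 1 ≤ n → 2 * n ^ n ≤ suc n ^ n
double-power n@(suc _) _ = *-cancelʳ-≤ _ _ n (≤-trans (≤-reflexive (r n (n ^ n))) (bernoulli n n))
  where
  r : ∀ n p → 2 * p * n ≡ (n + n) * p
  r = solve-∀

-- `(1 - 1/(n+1))^k ≥ 1 - k/(n+1)`, where `j = n + 1 - k`.
bernoulli′ : ∀ n k j → j + k ≡ suc n → suc n ^ k * j ≤ n ^ k * suc n
bernoulli′ n zero j e = ≤-reflexive (trans (*-identityˡ j) (trans (sym (+-identityʳ j)) (trans e (sym (*-identityˡ (suc n))))))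
bernoulli′ n (suc k) j e = begin
  suc n * suc n ^ k * j ≡⟨ r₁ (suc n) (suc n ^ k) j ⟩
  suc n ^ k * (suc n * j) ≤⟨ *-monoʳ-≤ (suc n ^ k) (≤-trans (+-monoˡ-≤ (n * j) j≤n) (≤-reflexive (sym (*-suc n j)))) ⟩
  suc n ^ k * (n * suc j) ≡⟨ r₂ (suc n ^ k) n (suc j) ⟩
  n * (suc n ^ k * suc j) ≤⟨ *-monoʳ-≤ n (bernoulli′ n k (suc j) (trans (sym (+-suc j k)) e)) ⟩
  n * (n ^ k * suc n) ≡⟨ *-assoc n (n ^ k) (suc n) ⟨
  n * n ^ k * suc n ∎
  where
  open ≤-Reasoning
  r₁ : ∀ a b c → a * b * c ≡ b * (a * c)
  r₁ = solve-∀
  r₂ : ∀ a b c → a * (b * c) ≡ b * (a * c)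
  r₂ = solve-∀
  j≤n : j ≤ n
  j≤n = s≤s⁻¹ (≤-trans (s≤s (m≤m+n j k)) (≤-reflexive (trans (sym (+-suc j k)) e)))

half-power : ∀ n k → 2 * k ≤ suc n → suc n ^ k ≤ 2 * n ^ k
half-power n k 2k≤ = *-cancelʳ-≤ _ _ (suc n) (begin
  suc n ^ k * suc n ≤⟨ *-monoʳ-≤ (suc n ^ k) n<2j ⟩
  suc n ^ k * (2 * j) ≡⟨ r₁ (suc n ^ k) j ⟩
  2 * (suc n ^ k * j) ≤⟨ *-monoʳ-≤ 2 (bernoulli′ n k j j+k) ⟩
  2 * (n ^ k * suc n) ≡⟨ *-assoc 2 (n ^ k) (suc n) ⟨
  2 * n ^ k * suc n ∎)
  where
  open ≤-Reasoning
  j = suc n ∸ k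
  r₁ : ∀ a b → a * (2 * b) ≡ 2 * (a * b)
  r₁ = solve-∀
  j+k : j + k ≡ suc n
  j+k = m∸n+n≡m (≤-trans (m≤m+n k (k + 0)) 2k≤)
  n<2j : suc n ≤ 2 * j
  n<2j = +-cancelʳ-≤ (2 * k) _ _ (begin
    suc n + 2 * k ≤⟨ +-monoʳ-≤ (suc n) 2k≤ ⟩
    suc n + suc n ≡⟨ cong₂ _+_ j+k j+k ⟨
    (j + k) + (j + k) ≡⟨ r₂ j k ⟩
    2 * j + 2 * k ∎)
    where
    r₂ : ∀ j k → (j + k) + (j + k) ≡ 2 * j + 2 * k
    r₂ = solve-∀

-- Each half of the exponent is at most `(n+1)/2`, the range in which `half-power` bounds the power
-- of `1 + 1/n` by 2.
e≤4 : ∀ n → suc n ^ n ≤ 4 * n ^ n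
e≤4 n = begin
  suc n ^ n ≡⟨ cong (suc n ^_) split ⟨
  suc n ^ (a + b) ≡⟨ ^-distribˡ-+-* (suc n) a b ⟩
  suc n ^ a * suc n ^ b ≤⟨ *-mono-≤ (half-power n a (≤-trans (2*⌊/2⌋ n) (n≤1+n n))) (half-power n b (2*⌊/2⌋ (suc n))) ⟩
  2 * n ^ a * (2 * n ^ b) ≡⟨ r (n ^ a) (n ^ b) ⟩
  4 * (n ^ a * n ^ b) ≡⟨ cong (4 *_) (^-distribˡ-+-* n a b) ⟨
  4 * n ^ (a + b) ≡⟨ cong (λ k → 4 * n ^ k) split ⟩
  4 * n ^ n ∎
  where
  open ≤-Reasoning
  a = ⌊ n /2⌋
  b = ⌈ n /2⌉
  split : a + b ≡ n
  split = ⌊n/2⌋+⌈n/2⌉≡n n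
  2*⌊/2⌋ : ∀ m → 2 * ⌊ m /2⌋ ≤ m
  2*⌊/2⌋ m = ≤-trans (+-monoʳ-≤ ⌊ m /2⌋ (≤-trans (≤-reflexive (+-identityʳ _)) (⌊n/2⌋≤⌈n/2⌉ m))) (≤-reflexive (⌊n/2⌋+⌈n/2⌉≡n m))
  r : ∀ a b → 2 * a * (2 * b) ≡ 4 * (a * b)
  r = solve-∀

^-swap : ∀ a b c → (a ^ b) ^ c ≡ (a ^ c) ^ b
^-swap a b c = trans (^-*-assoc a b c) (trans (cong (a ^_) (*-comm b c)) (sym (^-*-assoc a c b)))

-- Raise `1 + x/n ≤ (1 + 1/n)^x` to the power `n` and use `(1 + 1/n)^n ≤ 4`.
binomial-bound : ∀ n x → 1 ≤ n → (x + n) ^ n ≤ 4 ^ x * n ^ n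
binomial-bound n@(suc _) x _ = *-cancelʳ-≤ _ _ ((n ^ x) ^ n) {{m^n≢0 (n ^ x) n {{m^n≢0 n x}}}} (begin
  (x + n) ^ n * (n ^ x) ^ n ≡⟨ ^-distribʳ-* n (x + n) (n ^ x) ⟨
  ((x + n) * n ^ x) ^ n ≤⟨ ^-monoˡ-≤ n (≤-trans (≤-reflexive (cong (_* n ^ x) (+-comm x n))) (bernoulli n x)) ⟩
  (suc n ^ x * n) ^ n ≡⟨ ^-distribʳ-* n (suc n ^ x) n ⟩
  (suc n ^ x) ^ n * n ^ n ≡⟨ cong (_* n ^ n) (^-swap (suc n) x n) ⟩
  (suc n ^ n) ^ x * n ^ n ≤⟨ *-monoˡ-≤ (n ^ n) (^-monoˡ-≤ x (e≤4 n)) ⟩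
  (4 * n ^ n) ^ x * n ^ n ≡⟨ cong (_* n ^ n) (^-distribʳ-* x 4 (n ^ n)) ⟩
  4 ^ x * (n ^ n) ^ x * n ^ n ≡⟨ cong (λ k → 4 ^ x * k * n ^ n) (^-swap n n x) ⟩
  4 ^ x * (n ^ x) ^ n * n ^ n ≡⟨ r (4 ^ x) ((n ^ x) ^ n) (n ^ n) ⟩
  4 ^ x * n ^ n * (n ^ x) ^ n ∎)
  where
  open ≤-Reasoning
  r : ∀ a b c → a * b * c ≡ a * c * b
  r = solve-∀

-- Pad the exponent `a` to `z * b`, then apply `(1 + 1/z)^z ≤ 4` to `b` blocks.
entropy-bound : ∀ z a b → 1 ≤ z → a ≤ z * b → suc z ^ a ≤ 4 ^ b * z ^ a
entropy-bound z@(suc _) a b _ le = *-cancelʳ-≤ _ _ (z ^ c) {{m^n≢0 z c}} (begin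
  suc z ^ a * z ^ c ≤⟨ *-monoʳ-≤ (suc z ^ a) (^-monoˡ-≤ c (n≤1+n z)) ⟩
  suc z ^ a * suc z ^ c ≡⟨ ^-distribˡ-+-* (suc z) a c ⟨
  suc z ^ (a + c) ≡⟨ cong (suc z ^_) a+c ⟩
  suc z ^ (z * b) ≡⟨ ^-*-assoc (suc z) z b ⟨
  (suc z ^ z) ^ b ≤⟨ ^-monoˡ-≤ b (e≤4 z) ⟩
  (4 * z ^ z) ^ b ≡⟨ ^-distribʳ-* b 4 (z ^ z) ⟩
  4 ^ b * (z ^ z) ^ b ≡⟨ cong (4 ^ b *_) (trans (^-*-assoc z z b) (trans (cong (z ^_) (sym a+c)) (^-distribˡ-+-* z a c))) ⟩
  4 ^ b * (z ^ a * z ^ c) ≡⟨ *-assoc (4 ^ b) (z ^ a) (z ^ c) ⟨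
  4 ^ b * z ^ a * z ^ c ∎)
  where
  open ≤-Reasoning
  c = z * b ∸ a
  a+c : a + c ≡ z * b
  a+c = m+[n∸m]≡n le

-- Converts a gain of `1 + 1/c` per step into a doubling every `c` steps, both for exposures, with
-- `c = 32`, and for the greedy hitting set.
power-gap : ∀ c k → 1 ≤ c → 2 ^ k * c ^ (c * k) ≤ suc c ^ (c * k)
power-gap c k 1≤c = begin
  2 ^ k * c ^ (c * k) ≡⟨ cong (2 ^ k *_) (^-*-assoc c c k) ⟨
  2 ^ k * (c ^ c) ^ k ≡⟨ ^-distribʳ-* k 2 (c ^ c) ⟨
  (2 * c ^ c) ^ k ≤⟨ ^-monoˡ-≤ k (double-power c 1≤c) ⟩
  (suc c ^ c) ^ k ≡⟨ ^-*-assoc (suc c) c k ⟩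
  suc c ^ (c * k) ∎
  where open ≤-Reasoning

n<2^n : ∀ n → n < 2 ^ n
n<2^n zero = s≤s z≤n
n<2^n (suc n) = ≤-trans (+-mono-≤ {1} (≤-trans (s≤s z≤n) (n<2^n n)) (n<2^n n)) (≤-reflexive (r (2 ^ n)))
  where
  r : ∀ a → a + a ≡ 2 * a
  r = solve-∀

-- Counting sets and subgraphs by product weights

∏ᵛ : ∀ {A : Set} {k} → Vec (A → ℕ) k → Vec A k → ℕ
∏ᵛ [] [] = 1
∏ᵛ (f ∷ fs) (x ∷ v) = f x * ∏ᵛ fs v

∏ : ∀ {k} → Vec ℕ k → ℕ
∏ [] = 1
∏ (m ∷ ms) = m * ∏ ms

∑-concatMap : ∀ {A B : Set} (g : A → List B) (xs : List A) (f : B → ℕ) → ∑ (concatMap g xs) f ≡ ∑ xs (λ x → ∑ (g x) f)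
∑-concatMap g [] f = refl
∑-concatMap g (x ∷ xs) f = trans (∑-++ (g x) _ f) (cong (∑ (g x) f +_) (∑-concatMap g xs f))

-- Distributivity, the source of the total weights `(x + n)^n` for sets and `(1 + z)^|G|` for
-- subgraphs.
∑-allVecs : ∀ {A : Set} (xs : List A) {k} (fs : Vec (A → ℕ) k) → ∑ (allVecs xs k) (∏ᵛ fs) ≡ ∏ (Vec.map (∑ xs) fs)
∑-allVecs xs [] = refl
∑-allVecs xs {suc k} (f ∷ fs) = begin
  ∑ (concatMap (λ x → map (x ∷_) (allVecs xs k)) xs) (∏ᵛ (f ∷ fs))
    ≡⟨ ∑-concatMap (λ x → map (x ∷_) (allVecs xs k)) xs (∏ᵛ (f ∷ fs)) ⟩
  ∑ xs (λ x → ∑ (map (x ∷_) (allVecs xs k)) (∏ᵛ (f ∷ fs)))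
    ≡⟨ ∑-cong xs (λ x → trans (∑-map (x ∷_) (allVecs xs k) (∏ᵛ (f ∷ fs))) (∑-*ˡ (allVecs xs k) (f x) (∏ᵛ fs))) ⟩
  ∑ xs (λ x → f x * ∑ (allVecs xs k) (∏ᵛ fs))
    ≡⟨ ∑-*ʳ xs (∑ (allVecs xs k) (∏ᵛ fs)) f ⟩
  ∑ xs f * ∑ (allVecs xs k) (∏ᵛ fs)
    ≡⟨ cong (∑ xs f *_) (∑-allVecs xs fs) ⟩
  ∑ xs f * ∏ (Vec.map (∑ xs) fs) ∎
  where open ≡-Reasoning

side : ℕ → ℕ → Bool → ℕ
side x z true = x
side x z false = z

sideWeight : ∀ x z {k} (v : Vec Bool k) → ∏ᵛ (Vec.replicate k (side x z)) v * z ^ countTrue v ≡ x ^ countTrue v * z ^ k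
sideWeight x z [] = refl
sideWeight x z {suc k} (true ∷ v) = trans (r₁ x (∏ᵛ (Vec.replicate k (side x z)) v) z (z ^ countTrue v))
  (trans (cong (x * z *_) (sideWeight x z v)) (r₂ x z (x ^ countTrue v) (z ^ k)))
  where
  r₁ : ∀ a b c e → a * b * (c * e) ≡ a * c * (b * e)
  r₁ = solve-∀
  r₂ : ∀ a b c e → a * b * (c * e) ≡ a * c * (b * e)
  r₂ = solve-∀
sideWeight x z {suc k} (false ∷ v) = trans (r₁ z (∏ᵛ (Vec.replicate k (side x z)) v) (z ^ countTrue v))
  (trans (cong (z *_) (sideWeight x z v)) (r₂ z (x ^ countTrue v) (z ^ k)))
  where
  r₁ : ∀ a b c → a * b * c ≡ a * (b * c)
  r₁ = solve-∀
  r₂ : ∀ a b c → a * (b * c) ≡ b * (a * c)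
  r₂ = solve-∀

∏-replicate : ∀ k (xs : List Bool) (f : Bool → ℕ) → ∏ (Vec.map (∑ xs) (Vec.replicate k f)) ≡ ∑ xs f ^ k
∏-replicate zero xs f = refl
∏-replicate (suc k) xs f = cong (∑ xs f *_) (∏-replicate k xs f)

-- Weighting a set X by (x/n)^|X|, with total weight (1 + x/n)^n ≤ 4^x, bounds the number of small sets.
few-small-sets : ∀ n x m → 1 ≤ n → x ≤ n → # (allVecs bools n) (λ X → countTrue X ≤? m) * x ^ m ≤ 4 ^ x * n ^ m
few-small-sets n@(suc _) x m 1≤n x≤n = *-cancelʳ-≤ _ _ (n ^ n) {{m^n≢0 n n}} (begin
  # (allVecs bools n) (λ X → countTrue X ≤? m) * x ^ m * n ^ n
    ≡⟨ *-assoc (# (allVecs bools n) (λ X → countTrue X ≤? m)) (x ^ m) (n ^ n) ⟩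
  # (allVecs bools n) (λ X → countTrue X ≤? m) * (x ^ m * n ^ n)
    ≡⟨ ∑-*ʳ (allVecs bools n) (x ^ m * n ^ n) (λ X → ι (countTrue X ≤? m)) ⟨
  ∑ (allVecs bools n) (λ X → ι (countTrue X ≤? m) * (x ^ m * n ^ n))
    ≤⟨ ∑-mono (allVecs bools n) per ⟩
  ∑ (allVecs bools n) (λ X → ∏ᵛ w X * n ^ m)
    ≡⟨ ∑-*ʳ (allVecs bools n) (n ^ m) (∏ᵛ w) ⟩
  ∑ (allVecs bools n) (∏ᵛ w) * n ^ m
    ≡⟨ cong (_* n ^ m) (trans (∑-allVecs bools w) (trans (∏-replicate n bools (side x n)) (cong (λ k → (x + k) ^ n) (+-identityʳ n)))) ⟩
  (x + n) ^ n * n ^ m ≤⟨ *-monoˡ-≤ (n ^ m) (binomial-bound n x 1≤n) ⟩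
  4 ^ x * n ^ n * n ^ m ≡⟨ r₀ (4 ^ x) (n ^ n) (n ^ m) ⟩
  4 ^ x * n ^ m * n ^ n ∎)
  where
  open ≤-Reasoning
  w = Vec.replicate n (side x n)
  r₀ : ∀ a b c → a * b * c ≡ a * c * b
  r₀ = solve-∀
  per : ∀ X → ι (countTrue X ≤? m) * (x ^ m * n ^ n) ≤ ∏ᵛ w X * n ^ m
  per X with countTrue X ≤? m
  ... | no _ = z≤n
  ... | yes le = begin
    1 * (x ^ m * n ^ n) ≡⟨ *-identityˡ _ ⟩
    x ^ m * n ^ n ≡⟨ cong (λ k → x ^ k * n ^ n) j+r ⟨
    x ^ (j + r) * n ^ n ≡⟨ cong (_* n ^ n) (^-distribˡ-+-* x j r) ⟩
    x ^ j * x ^ r * n ^ n ≡⟨ r₁ (x ^ j) (x ^ r) (n ^ n) ⟩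
    x ^ j * n ^ n * x ^ r ≡⟨ cong (_* x ^ r) (sideWeight x n X) ⟨
    ∏ᵛ w X * n ^ j * x ^ r ≤⟨ *-monoʳ-≤ (∏ᵛ w X * n ^ j) (^-monoˡ-≤ r x≤n) ⟩
    ∏ᵛ w X * n ^ j * n ^ r ≡⟨ *-assoc (∏ᵛ w X) (n ^ j) (n ^ r) ⟩
    ∏ᵛ w X * (n ^ j * n ^ r) ≡⟨ cong (∏ᵛ w X *_) (^-distribˡ-+-* n j r) ⟨
    ∏ᵛ w X * n ^ (j + r) ≡⟨ cong (λ k → ∏ᵛ w X * n ^ k) j+r ⟩
    ∏ᵛ w X * n ^ m ∎
    where
    j = countTrue X
    r = m ∸ j
    j+r : j + r ≡ m
    j+r = m+[n∸m]≡n le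
    r₁ : ∀ a b c → a * b * c ≡ a * c * b
    r₁ = solve-∀

ct : ∀ {m k} → Vec (Vec Bool m) k → ℕ
ct [] = 0
ct (r ∷ rs) = countTrue r + ct rs

tot≡ct : ∀ {n k} (M : Vec (Vec Bool n) k) → ∑ (V k) (λ i → # (V n) (λ j → lookup (lookup M i) j B.≟ true)) ≡ ct M
tot≡ct [] = refl
tot≡ct {n} (r ∷ M) = trans (∑V-suc (λ i → # (V n) (λ j → lookup (lookup (r ∷ M) i) j B.≟ true))) (cong₂ _+_ (sym (countTrue≡# r)) (tot≡ct M))

ct-regular : ∀ {m k d} (M : Vec (Vec Bool m) k) → (∀ i → countTrue (lookup M i) ≡ d) → ct M ≡ k * d
ct-regular [] h = refl
ct-regular (r ∷ M) h = cong₂ _+_ (h zero) (ct-regular M (h ∘ suc))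

-- The products of these entry weights give a submatrix R of G the weight z^(|G| − |R|), and any other matrix 0,
-- so that the total weight is (1 + z)^|G|.
entry : ℕ → Bool → Bool → ℕ
entry z true true = 1
entry z true false = z
entry z false true = 0
entry z false false = 1

rowWeight : ∀ z {k} → Vec Bool k → Vec Bool k → ℕ
rowWeight z g = ∏ᵛ (Vec.map (entry z) g)

matWeight : ∀ z {m k} → Vec (Vec Bool m) k → Vec (Vec Bool m) k → ℕ
matWeight z G = ∏ᵛ (Vec.map (rowWeight z) G)

∑-rowWeight : ∀ z {k} (g : Vec Bool k) → ∑ (allVecs bools k) (rowWeight z g) ≡ suc z ^ countTrue g
∑-rowWeight z g = trans (∑-allVecs bools (Vec.map (entry z) g)) (go g)
  where
  go : ∀ {k} (g : Vec Bool k) → ∏ (Vec.map (∑ bools) (Vec.map (entry z) g)) ≡ suc z ^ countTrue g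
  go [] = refl
  go (true ∷ g) = cong₂ _*_ (cong suc (+-identityʳ z)) (go g)
  go (false ∷ g) = trans (+-identityʳ _) (go g)

∑-matWeight : ∀ z {m k} (G : Vec (Vec Bool m) k) → ∑ (allVecs (allVecs bools m) k) (matWeight z G) ≡ suc z ^ ct G
∑-matWeight z {m} G = trans (∑-allVecs (allVecs bools m) (Vec.map (rowWeight z) G)) (go G)
  where
  go : ∀ {k} (G : Vec (Vec Bool m) k) → ∏ (Vec.map (∑ (allVecs bools m)) (Vec.map (rowWeight z) G)) ≡ suc z ^ ct G
  go [] = refl
  go (g ∷ G) = trans (cong₂ _*_ (∑-rowWeight z g) (go G)) (sym (^-distribˡ-+-* (suc z) (countTrue g) (ct G)))

rowWeight-sub : ∀ z {k} (g r : Vec Bool k) → (∀ i → lookup r i ≡ true → lookup g i ≡ true) → rowWeight z g r * z ^ countTrue r ≡ z ^ countTrue g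
rowWeight-sub z [] [] h = refl
rowWeight-sub z (true ∷ g) (true ∷ r) h = trans (r₁ (rowWeight z g r) z (z ^ countTrue r)) (cong (z *_) (rowWeight-sub z g r (h ∘ suc)))
  where
  r₁ : ∀ a b c → 1 * a * (b * c) ≡ b * (a * c)
  r₁ = solve-∀
rowWeight-sub z (true ∷ g) (false ∷ r) h = trans (*-assoc z _ _) (cong (z *_) (rowWeight-sub z g r (h ∘ suc)))
rowWeight-sub z (false ∷ g) (true ∷ r) h with h zero refl
... | ()
rowWeight-sub z (false ∷ g) (false ∷ r) h = trans (cong (_* z ^ countTrue r) (*-identityˡ (rowWeight z g r))) (rowWeight-sub z g r (h ∘ suc))

matWeight-sub : ∀ z {m k} (G R : Vec (Vec Bool m) k) → (∀ i j → lookup (lookup R i) j ≡ true → lookup (lookup G i) j ≡ true) →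
  matWeight z G R * z ^ ct R ≡ z ^ ct G
matWeight-sub z [] [] h = refl
matWeight-sub z (g ∷ G) (r ∷ R) h = begin
  rowWeight z g r * matWeight z G R * z ^ (countTrue r + ct R)
    ≡⟨ cong (rowWeight z g r * matWeight z G R *_) (^-distribˡ-+-* z (countTrue r) (ct R)) ⟩
  rowWeight z g r * matWeight z G R * (z ^ countTrue r * z ^ ct R)
    ≡⟨ r₁ (rowWeight z g r) (matWeight z G R) (z ^ countTrue r) (z ^ ct R) ⟩
  rowWeight z g r * z ^ countTrue r * (matWeight z G R * z ^ ct R)
    ≡⟨ cong₂ _*_ (rowWeight-sub z g r (h zero)) (matWeight-sub z G R (h ∘ suc)) ⟩
  z ^ countTrue g * z ^ ct G ≡⟨ ^-distribˡ-+-* z (countTrue g) (ct G) ⟨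
  z ^ (countTrue g + ct G) ∎
  where
  open ≡-Reasoning
  r₁ : ∀ a b c e → a * b * (c * e) ≡ a * c * (b * e)
  r₁ = solve-∀

-- Each such `Γ` has weight at least `z^(|G| - M)` out of a total `(1 + z)^|G| ≤ 4^b * z^|G|`. A
-- larger `z` allows a smaller `b` at the price of `z^M`.
few-sparse-subgraphs : ∀ z {d n} M b (G : Mat n) → 1 ≤ z → Regular d G → n * d ≤ z * b →
  # (allMats n) (λ Γ → (tot (adj Γ) ≤? M) ×-dec (adj Γ ⊑? adj G)) ≤ 4 ^ b * z ^ M
few-sparse-subgraphs z@(suc _) {d} {n} M b G 1≤z reg le = *-cancelʳ-≤ _ _ (z ^ (n * d)) {{m^n≢0 z (n * d)}} (begin
  # (allMats n) P? * z ^ (n * d)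
    ≡⟨ ∑-*ʳ (allMats n) (z ^ (n * d)) (λ Γ → ι (P? Γ)) ⟨
  ∑ (allMats n) (λ Γ → ι (P? Γ) * z ^ (n * d)) ≤⟨ ∑-mono (allMats n) per ⟩
  ∑ (allMats n) (λ Γ → matWeight z G Γ * z ^ M) ≡⟨ ∑-*ʳ (allMats n) (z ^ M) (matWeight z G) ⟩
  ∑ (allMats n) (matWeight z G) * z ^ M ≡⟨ cong (_* z ^ M) (∑-matWeight z G) ⟩
  suc z ^ ct G * z ^ M ≡⟨ cong (λ k → suc z ^ k * z ^ M) ctG ⟩
  suc z ^ (n * d) * z ^ M ≤⟨ *-monoˡ-≤ (z ^ M) (entropy-bound z (n * d) b 1≤z le) ⟩
  4 ^ b * z ^ (n * d) * z ^ M ≡⟨ r₁ (4 ^ b) (z ^ (n * d)) (z ^ M) ⟩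
  4 ^ b * z ^ M * z ^ (n * d) ∎)
  where
  open ≤-Reasoning
  P? : Decidable (λ Γ → tot (adj Γ) ≤ M × adj Γ ⊑ adj G)
  P? Γ = (tot (adj Γ) ≤? M) ×-dec (adj Γ ⊑? adj G)
  ctG : ct G ≡ n * d
  ctG = ct-regular G (proj₂ reg)
  r₁ : ∀ a b c → a * b * c ≡ a * c * b
  r₁ = solve-∀
  per : ∀ Γ → ι (P? Γ) * z ^ (n * d) ≤ matWeight z G Γ * z ^ M
  per Γ with P? Γ
  ... | no _ = z≤n
  ... | yes (t≤M , sub) = begin
    1 * z ^ (n * d) ≡⟨ *-identityˡ _ ⟩
    z ^ (n * d) ≡⟨ cong (z ^_) ctG ⟨
    z ^ ct G ≡⟨ matWeight-sub z G Γ sub ⟨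
    matWeight z G Γ * z ^ ct Γ ≤⟨ *-monoʳ-≤ (matWeight z G Γ) (^-monoʳ-≤ z (subst (_≤ M) (tot≡ct Γ) t≤M)) ⟩
    matWeight z G Γ * z ^ M ∎

-- The exceptional events

ceil : ∀ d → ∃ λ K → 4 * d ≤ 5 * K × (∀ x → 4 * d ≤ 5 * x → K ≤ x)
ceil d = K , lower , upper
  where
  K = (4 * d + 4) / 5
  lower : 4 * d ≤ 5 * K
  lower = +-cancelʳ-≤ 4 _ _ (≤-trans (≤-reflexive (m≡m%n+[m/n]*n (4 * d + 4) 5))
    (≤-trans (+-monoˡ-≤ (K * 5) (s≤s⁻¹ (m%n<n (4 * d + 4) 5))) (≤-reflexive (r K))))
    where
    r : ∀ k → 4 + k * 5 ≡ 5 * k + 4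
    r = solve-∀
  upper : ∀ x → 4 * d ≤ 5 * x → K ≤ x
  upper x le = s≤s⁻¹ (m<n*o⇒m/o<n {4 * d + 4} {suc x} {5} (≤-trans (s≤s (+-monoˡ-≤ 4 le)) (≤-reflexive (r x))))
    where
    r : ∀ x → suc (5 * x + 4) ≡ suc x * 5
    r = solve-∀

module _ {n : ℕ} where

  ∅ : Rel n
  ∅ _ _ = false

  ∅-sym : Sym ∅
  ∅-sym i j ()

  tot-∅ : tot ∅ ≡ 0
  tot-∅ = trans (∑-cong (V n) λ i → #-none (V n) (at? ∅ i) λ _ _ ()) (∑-0 (V n))

  ∅⊑ : ∀ F → ∅ ⊑ F
  ∅⊑ F i j ()

module _ {d n : ℕ} (1≤d : 1 ≤ d) (n-large : 200 * suc d ≤ n) where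

  -- Each exposure gains a factor 33/32, and (33/32)^32 ≥ 2.
  concentrate : ∀ {Bad : Mat n → Set} (bad? : Decidable Bad) {R : Fin n → Set} (R? : Decidable R)
    {A : Fin n → Fin n → Set} (A? : ∀ v → Decidable (A v)) (ℓ S k : ℕ) →
    (∀ G → Regular d G → Bad G → ∀ v → R v → 4 * d ≤ 5 * # (V n) (λ y → at? (adj G) v y ×-dec A? v y)) →
    n ≤ ℓ * # (V n) R? → (∀ v → R v → 4 * # (V n) (A? v) ≤ 3 * n) → 100 * (ℓ * S) ≤ d * n →
    ∀ F → Sym F → tot F + 2 * (32 * k) ≤ S →
    2 ^ k * # (Reg d n) (λ G → bad? G ×-dec (F ⊑? adj G)) ≤ cnt d n F
  concentrate bad? R? A? ℓ S k rich R-large A-small S-small F sF tF =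
    *-cancelˡ-≤ (32 ^ t) {{m^n≢0 32 t}} (begin
      32 ^ t * (2 ^ k * cntBad F) ≡⟨ r (32 ^ t) (2 ^ k) (cntBad F) ⟩
      2 ^ k * 32 ^ t * cntBad F ≤⟨ *-monoˡ-≤ (cntBad F) (power-gap 32 k (s≤s z≤n)) ⟩
      33 ^ t * cntBad F ≤⟨ exposure t F sF tF ⟩
      32 ^ t * cnt d n F ∎)
    where
    open ≤-Reasoning
    t = 32 * k
    K = proj₁ (ceil d)
    open Concentration {d} {n} bad? R? A? K ℓ S (λ G reg b v Rv → proj₂ (proj₂ (ceil d)) _ (rich G reg b v Rv))
      1≤d n-large R-large A-small (proj₁ (proj₂ (ceil d))) S-small
    r : ∀ a b c → a * (b * c) ≡ b * a * c
    r = solve-∀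

  cnt-∅ : cnt d n ∅ ≡ length (Reg d n)
  cnt-∅ = #-all (Reg d n) (λ G → ∅ ⊑? adj G) λ G _ → ∅⊑ (adj G)

  subsets : List (Vec Bool n)
  subsets = allVecs bools n

  -- A gain of `2^(3n)` pays for the `4^n` pairs `(X, W)` and leaves `2^n`, more than `n`. It takes
  -- `96n` exposures with `ℓ = 4B`, and their budget gives 76800 = 100 * 4 * 2 * 32 * 3.
  trapped-few : ∀ B X W → 76800 * B ≤ d → 2 ^ (3 * n) * # (Reg d n) (trapped? d B X W) ≤ length (Reg d n)
  trapped-few B X W Bd = go ((n ≤? 4 * B * size X) ×-dec (4 * size W ≤? 3 * n))
    where
    open ≤-Reasoning
    r₁ : ∀ a b c e f g n → a * (b * c * (e * (f * (g * n)))) ≡ a * (b * (e * (f * g))) * c * n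
    r₁ = solve-∀
    go : Dec (n ≤ 4 * B * size X × 4 * size W ≤ 3 * n) → 2 ^ (3 * n) * # (Reg d n) (trapped? d B X W) ≤ length (Reg d n)
    go (no ¬sizes) = ≤-trans (≤-reflexive (trans (cong (2 ^ (3 * n) *_) (#-none (Reg d n) (trapped? d B X W) λ G _ t → ¬sizes (Trapped.sizes t)))
      (*-zeroʳ (2 ^ (3 * n))))) z≤n
    go (yes (nX , Wn)) = begin
      2 ^ (3 * n) * # (Reg d n) (trapped? d B X W)
        ≤⟨ *-monoʳ-≤ (2 ^ (3 * n)) (#-mono (Reg d n) (trapped? d B X W) (λ G → trapped? d B X W G ×-dec (∅ ⊑? adj G)) λ G t → t , ∅⊑ (adj G)) ⟩
      2 ^ (3 * n) * # (Reg d n) (λ G → trapped? d B X W G ×-dec (∅ ⊑? adj G))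
        ≤⟨ concentrate (trapped? d B X W) (mem? X) (λ _ → mem? W) (4 * B) (2 * (32 * (3 * n))) (3 * n)
             (λ G _ t v m → Trapped.inward t v m) nX (λ _ _ → Wn)
             (≤-trans (≤-reflexive (r₁ 100 4 B 2 32 3 n)) (*-monoˡ-≤ n Bd)) ∅ ∅-sym
             (≤-reflexive (cong (_+ 2 * (32 * (3 * n))) (tot-∅ {n}))) ⟩
      cnt d n ∅ ≡⟨ cnt-∅ ⟩
      length (Reg d n) ∎

  trapped-total : ℕ → ℕ
  trapped-total B = ∑ subsets (λ X → ∑ subsets (λ W → # (Reg d n) (trapped? d B X W)))

  trapped-bound : ∀ B → 76800 * B ≤ d → trapped-total B * n ≤ length (Reg d n)
  trapped-bound B Bd = *-cancelˡ-≤ (2 ^ n * 2 ^ n) {{m*n≢0 (2 ^ n) (2 ^ n) {{m^n≢0 2 n}} {{m^n≢0 2 n}}}} (begin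
    2 ^ n * 2 ^ n * (T * n) ≤⟨ *-monoʳ-≤ (2 ^ n * 2 ^ n) (*-monoʳ-≤ T (<⇒≤ (n<2^n n))) ⟩
    2 ^ n * 2 ^ n * (T * 2 ^ n) ≡⟨ r₁ (2 ^ n) T ⟩
    2 ^ n * (2 ^ n * 2 ^ n) * T ≡⟨ cong (_* T) e ⟨
    2 ^ (3 * n) * T ≡⟨ ∑-*ˡ subsets (2 ^ (3 * n)) _ ⟨
    ∑ subsets (λ X → 2 ^ (3 * n) * ∑ subsets (λ W → # (Reg d n) (trapped? d B X W)))
      ≤⟨ ∑-mono subsets (λ X → ≤-trans (≤-reflexive (sym (∑-*ˡ subsets (2 ^ (3 * n)) (λ W → # (Reg d n) (trapped? d B X W)))))
           (∑-≤const subsets (length (Reg d n)) λ W _ → trapped-few B X W Bd)) ⟩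
    ∑ subsets (λ X → length subsets * length (Reg d n)) ≡⟨ ∑-const subsets (length subsets * length (Reg d n)) ⟩
    length subsets * (length subsets * length (Reg d n)) ≡⟨ cong (λ k → k * (k * length (Reg d n))) (length-allVecs n) ⟩
    2 ^ n * (2 ^ n * length (Reg d n)) ≡⟨ *-assoc (2 ^ n) (2 ^ n) _ ⟨
    2 ^ n * 2 ^ n * length (Reg d n) ∎)
    where
    open ≤-Reasoning
    T = trapped-total B
    r₁ : ∀ p t → p * p * (t * p) ≡ p * (p * p) * t
    r₁ = solve-∀
    e : 2 ^ (3 * n) ≡ 2 ^ n * (2 ^ n * 2 ^ n)
    e = trans (^-distribˡ-+-* 2 n (n + (n + 0))) (cong (2 ^ n *_) (trans (^-distribˡ-+-* 2 n (n + 0)) (cong (λ k → 2 ^ n * 2 ^ k) (+-identityʳ n))))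

  unboosted-total : ℕ → ℕ
  unboosted-total M = ∑ (allMats n) (λ Γ → ι (sparse? M Γ) * # (Reg d n) (λ G → unboosted? d Γ G ×-dec (adj Γ ⊑? adj G)))

  -- Exposure starts from `Γ`, not from the empty graph, because which pairs are boosters is known
  -- only relative to `Γ`.
  unboosted-few : ∀ M k Γ → 100 * (4 * (M + 2 * (32 * k))) ≤ d * n →
    2 ^ k * (ι (sparse? M Γ) * # (Reg d n) (λ G → unboosted? d Γ G ×-dec (adj Γ ⊑? adj G))) ≤ ι (tot (adj Γ) ≤? M) * cnt d n (adj Γ)
  unboosted-few M k Γ le = go (sparse? M Γ)
    where
    open ≤-Reasoning
    c = # (Reg d n) (λ G → unboosted? d Γ G ×-dec (adj Γ ⊑? adj G))
    go : (p : Dec (Sparse M Γ)) → 2 ^ k * (ι p * c) ≤ ι (tot (adj Γ) ≤? M) * cnt d n (adj Γ)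
    go (no _) = ≤-trans (≤-reflexive (*-zeroʳ (2 ^ k))) z≤n
    go (yes (mk symm few rich)) = begin
      2 ^ k * (1 * c) ≡⟨ cong (2 ^ k *_) (*-identityˡ c) ⟩
      2 ^ k * c ≤⟨ concentrate (unboosted? d Γ) (rich? Γ) (λ v y → ¬? (booster? (adj Γ) v y)) 4 (M + 2 * (32 * k)) k
           (λ G _ u v r → Unboosted.stuck u v r) (<⇒≤ rich) small le (adj Γ) symm (+-monoˡ-≤ (2 * (32 * k)) few) ⟩
      cnt d n (adj Γ) ≡⟨ trans (cong (_* cnt d n (adj Γ)) (ι-yes (tot (adj Γ) ≤? M) few)) (*-identityˡ _) ⟨
      ι (tot (adj Γ) ≤? M) * cnt d n (adj Γ) ∎
      where
      small : ∀ v → Rich Γ v → 4 * # (V n) (λ y → ¬? (booster? (adj Γ) v y)) ≤ 3 * n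
      small v (mk many) = +-cancelˡ-≤ n _ _ (begin
        n + 4 * # (V n) (λ y → ¬? (booster? (adj Γ) v y)) ≤⟨ +-monoˡ-≤ _ (<⇒≤ many) ⟩
        4 * # (V n) (booster? (adj Γ) v) + 4 * # (V n) (λ y → ¬? (booster? (adj Γ) v y))
          ≡⟨ *-distribˡ-+ 4 (# (V n) (booster? (adj Γ) v)) _ ⟨
        4 * (# (V n) (booster? (adj Γ) v) + # (V n) (λ y → ¬? (booster? (adj Γ) v y)))
          ≡⟨ cong (4 *_) (trans (#-¬ (V n) (booster? (adj Γ) v)) (V-length n)) ⟩
        4 * n ∎)

  -- After exchanging the sums, the total of `cnt Γ` over sparse `Γ` counts pairs `Γ ⊑ G`, at most
  -- `2^p` for each regular `G`. Hence a gain of `2^(p + n)` suffices, the last `2^n` supplying the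
  -- factor `n`.
  unboosted-bound : ∀ M k b e → 100 * (4 * (M + 2 * (32 * k))) ≤ d * n → n * d ≤ 2 ^ e * b → 2 * b + e * M + n ≤ k →
    unboosted-total M * n ≤ length (Reg d n)
  unboosted-bound M k b e le bd kk = *-cancelˡ-≤ (2 ^ p) {{m^n≢0 2 p}} (begin
    2 ^ p * (T * n) ≤⟨ *-monoʳ-≤ (2 ^ p) (*-monoʳ-≤ T (<⇒≤ (n<2^n n))) ⟩
    2 ^ p * (T * 2 ^ n) ≡⟨ r₁ (2 ^ p) T (2 ^ n) ⟩
    2 ^ p * 2 ^ n * T ≡⟨ cong (_* T) (^-distribˡ-+-* 2 p n) ⟨
    2 ^ (p + n) * T ≤⟨ *-monoˡ-≤ T (^-monoʳ-≤ 2 kk) ⟩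
    2 ^ k * T ≡⟨ ∑-*ˡ (allMats n) (2 ^ k) _ ⟨
    ∑ (allMats n) (λ Γ → 2 ^ k * (ι (sparse? M Γ) * # (Reg d n) (λ G → unboosted? d Γ G ×-dec (adj Γ ⊑? adj G))))
      ≤⟨ ∑-mono (allMats n) (λ Γ → unboosted-few M k Γ le) ⟩
    ∑ (allMats n) (λ Γ → ι (tot (adj Γ) ≤? M) * cnt d n (adj Γ))
      ≡⟨ ∑-cong (allMats n) (λ Γ → sym (∑-*ˡ (Reg d n) (ι (tot (adj Γ) ≤? M)) (λ G → ι (adj Γ ⊑? adj G)))) ⟩
    ∑ (allMats n) (λ Γ → ∑ (Reg d n) (λ G → ι (tot (adj Γ) ≤? M) * ι (adj Γ ⊑? adj G)))
      ≡⟨ ∑-swap (allMats n) (Reg d n) _ ⟩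
    ∑ (Reg d n) (λ G → ∑ (allMats n) (λ Γ → ι (tot (adj Γ) ≤? M) * ι (adj Γ ⊑? adj G)))
      ≤⟨ ∑-≤const (Reg d n) (2 ^ p) perG ⟩
    length (Reg d n) * 2 ^ p ≡⟨ *-comm (length (Reg d n)) (2 ^ p) ⟩
    2 ^ p * length (Reg d n) ∎)
    where
    open ≤-Reasoning
    T = unboosted-total M
    p = 2 * b + e * M
    r₁ : ∀ a b c → a * (b * c) ≡ a * c * b
    r₁ = solve-∀
    perG : ∀ G → G ∈ Reg d n → ∑ (allMats n) (λ Γ → ι (tot (adj Γ) ≤? M) * ι (adj Γ ⊑? adj G)) ≤ 2 ^ p
    perG G G∈ = begin
      ∑ (allMats n) (λ Γ → ι (tot (adj Γ) ≤? M) * ι (adj Γ ⊑? adj G))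
        ≡⟨ ∑-cong (allMats n) (λ Γ → sym (ι-× (tot (adj Γ) ≤? M) (adj Γ ⊑? adj G))) ⟩
      # (allMats n) (λ Γ → (tot (adj Γ) ≤? M) ×-dec (adj Γ ⊑? adj G))
        ≤⟨ few-sparse-subgraphs (2 ^ e) M b G (m^n>0 2 e) (Reg⇒ G∈) bd ⟩
      4 ^ b * (2 ^ e) ^ M ≡⟨ cong₂ _*_ (^-*-assoc 2 2 b) (^-*-assoc 2 e M) ⟩
      2 ^ (2 * b) * 2 ^ (e * M) ≡⟨ ^-distribˡ-+-* 2 (2 * b) (e * M) ⟨
      2 ^ p ∎

-- With x = i + 1 ≤ 2^i, the two spare factors x are absorbed: (Bx)^(2x) ≤ B² (2Bx)^(2i) ≤ B²
-- n^(2i). Of the factor n² so gained, one n pays for the sum over all sizes x, and the other makes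
-- the failure probability O(1/n).
square-gap : ∀ B i n → 2 * B * suc i ≤ n → (B * suc i) ^ (2 * suc i) * (n * n) ≤ B * B * n ^ (2 * suc i)
square-gap B i n le = begin
  u ^ (2 * suc i) * (n * n) ≡⟨ cong (λ k → u ^ k * (n * n)) (r₀ i) ⟩
  u ^ (2 + 2 * i) * (n * n) ≡⟨ r₁ B (suc i) (u ^ (2 * i)) (n * n) ⟩
  B * B * (n * n) * (suc i * suc i * u ^ (2 * i)) ≤⟨ *-monoʳ-≤ (B * B * (n * n)) (*-monoˡ-≤ (u ^ (2 * i)) (*-mono-≤ (n<2^n i) (n<2^n i))) ⟩
  B * B * (n * n) * (2 ^ i * 2 ^ i * u ^ (2 * i)) ≡⟨ cong (λ k → B * B * (n * n) * (k * u ^ (2 * i))) 2^2i ⟩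
  B * B * (n * n) * (2 ^ (2 * i) * u ^ (2 * i)) ≡⟨ cong (B * B * (n * n) *_) (^-distribʳ-* (2 * i) 2 u) ⟨
  B * B * (n * n) * (2 * u) ^ (2 * i) ≤⟨ *-monoʳ-≤ (B * B * (n * n)) (^-monoˡ-≤ (2 * i) (≤-trans (≤-reflexive (sym (*-assoc 2 B (suc i)))) le)) ⟩
  B * B * (n * n) * n ^ (2 * i) ≡⟨ r₂ B n (n ^ (2 * i)) ⟩
  B * B * n ^ (2 + 2 * i) ≡⟨ cong (λ k → B * B * n ^ k) (r₀ i) ⟨
  B * B * n ^ (2 * suc i) ∎
  where
  open ≤-Reasoning
  u = B * suc i
  r₀ : ∀ i → 2 * suc i ≡ 2 + 2 * i
  r₀ = solve-∀
  r₁ : ∀ b x p m → b * x * (b * x * p) * m ≡ b * b * m * (x * x * p)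
  r₁ = solve-∀
  r₂ : ∀ b n p → b * b * (n * n) * p ≡ b * b * (n * (n * p))
  r₂ = solve-∀
  2^2i : 2 ^ i * 2 ^ i ≡ 2 ^ (2 * i)
  2^2i = trans (sym (^-distribˡ-+-* 2 i i)) (cong (λ k → 2 ^ (i + k)) (sym (+-identityʳ i)))

^-6* : ∀ a x → a ^ (6 * x) ≡ a ^ x * a ^ (3 * x) * a ^ (2 * x)
^-6* a x = trans (cong (a ^_) (r x)) (trans (^-distribˡ-+-* a (x + 3 * x) (2 * x)) (cong (_* a ^ (2 * x)) (^-distribˡ-+-* a x (3 * x))))
  where
  r : ∀ x → 6 * x ≡ x + 3 * x + 2 * x
  r = solve-∀

-- With x = suc i: D counts bad graphs with multiplicity over the N sets of size x and the N′ sets of size 3x.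
union-bound : ∀ q B i n D N N′ f → B ≡ 4 * (q * q * q) → 1 ≤ n → 2 * B * suc i ≤ n →
  N * suc i ^ suc i ≤ 4 ^ suc i * n ^ suc i → N′ * suc i ^ (3 * suc i) ≤ 4 ^ suc i * n ^ (3 * suc i) →
  n ^ (6 * suc i) * D ≤ N * N′ * (q * suc i) ^ (6 * suc i) * f → D * (n * n) ≤ B * B * f
union-bound q B i n@(suc _) D N N′ f B-def _ small hN hN′ h = *-cancelˡ-≤ n2 {{m^n≢0 n (2 * x)}} (begin
  n2 * (D * (n * n)) ≡⟨ r₁ n2 D (n * n) ⟩
  n2 * D * (n * n) ≤⟨ *-monoˡ-≤ (n * n) step ⟩
  (B * x) ^ (2 * x) * f * (n * n) ≡⟨ r₂ ((B * x) ^ (2 * x)) f (n * n) ⟩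
  (B * x) ^ (2 * x) * (n * n) * f ≤⟨ *-monoˡ-≤ f (square-gap B i n small) ⟩
  B * B * n2 * f ≡⟨ r₃ (B * B) n2 f ⟩
  n2 * (B * B * f) ∎)
  where
  open ≤-Reasoning
  x = suc i
  n1 = n ^ x
  n3 = n ^ (3 * x)
  n2 = n ^ (2 * x)
  x1 = x ^ x
  x3 = x ^ (3 * x)
  x2 = x ^ (2 * x)
  r₁ : ∀ a b c → a * (b * c) ≡ a * b * c
  r₁ = solve-∀
  r₂ : ∀ a b c → a * b * c ≡ a * c * b
  r₂ = solve-∀
  r₃ : ∀ a b c → a * b * c ≡ b * (a * c)
  r₃ = solve-∀
  B-pow : 4 ^ x * 4 ^ x * q ^ (6 * x) ≡ B ^ (2 * x)
  B-pow = sym (trans (sym (^-*-assoc B 2 x)) (trans (cong (_^ x) (trans (cong (_^ 2) B-def) (r q))) (trans (^-distribʳ-* x (4 * 4) (q ^ 6))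
    (cong₂ _*_ (^-distribʳ-* x 4 4) (^-*-assoc q 6 x)))))
    where
    r : ∀ q → 4 * (q * q * q) * (4 * (q * q * q) * 1) ≡ 4 * 4 * (q * (q * (q * (q * (q * (q * 1))))))
    r = solve-∀
  step : n2 * D ≤ (B * x) ^ (2 * x) * f
  step = *-cancelˡ-≤ (n1 * n3) {{m*n≢0 n1 n3 {{m^n≢0 n x}} {{m^n≢0 n (3 * x)}}}} (*-cancelˡ-≤ (x1 * x3) {{m*n≢0 x1 x3 {{m^n≢0 x x}} {{m^n≢0 x (3 * x)}}}} (begin
    x1 * x3 * (n1 * n3 * (n2 * D)) ≡⟨ cong (x1 * x3 *_) (trans (r₁ (n1 * n3) n2 D) (cong (_* D) (sym (^-6* n x)))) ⟩
    x1 * x3 * (n ^ (6 * x) * D) ≤⟨ *-monoʳ-≤ (x1 * x3) h ⟩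
    x1 * x3 * (N * N′ * (q * x) ^ (6 * x) * f) ≡⟨ r₄ x1 x3 N N′ ((q * x) ^ (6 * x)) f ⟩
    N * x1 * (N′ * x3) * ((q * x) ^ (6 * x) * f) ≤⟨ *-monoˡ-≤ ((q * x) ^ (6 * x) * f) (*-mono-≤ hN hN′) ⟩
    4 ^ x * n1 * (4 ^ x * n3) * ((q * x) ^ (6 * x) * f)
      ≡⟨ cong (λ k → 4 ^ x * n1 * (4 ^ x * n3) * (k * f)) (trans (^-distribʳ-* (6 * x) q x) (cong (q ^ (6 * x) *_) (^-6* x x))) ⟩
    4 ^ x * n1 * (4 ^ x * n3) * (q ^ (6 * x) * (x1 * x3 * x2) * f) ≡⟨ r₅ (4 ^ x) n1 n3 (q ^ (6 * x)) x1 x3 x2 f ⟩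
    x1 * x3 * (n1 * n3 * (4 ^ x * 4 ^ x * q ^ (6 * x) * x2 * f)) ≡⟨ cong (λ k → x1 * x3 * (n1 * n3 * (k * x2 * f))) B-pow ⟩
    x1 * x3 * (n1 * n3 * (B ^ (2 * x) * x2 * f)) ≡⟨ cong (λ k → x1 * x3 * (n1 * n3 * (k * f))) (^-distribʳ-* (2 * x) B x) ⟨
    x1 * x3 * (n1 * n3 * ((B * x) ^ (2 * x) * f)) ∎))
    where
    r₄ : ∀ x1 x3 a b c f → x1 * x3 * (a * b * c * f) ≡ a * x1 * (b * x3) * (c * f)
    r₄ = solve-∀
    r₅ : ∀ p n1 n3 q x1 x3 x2 f → p * n1 * (p * n3) * (q * (x1 * x3 * x2) * f) ≡ x1 * x3 * (n1 * n3 * (p * p * q * x2 * f))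
    r₅ = solve-∀

-- Small dense sets

module _ {d n : ℕ} (Q s : ℕ) (24≤s : 24 ≤ s) (48≤d : 48 ≤ d) (d≤ : d ≤ 2 * Q * s) (n-large : 200 * suc d ≤ n) where

  -- Expose 6x edges from `X` into `W`. Their 12x arcs are too few to use up half of `s` at every
  -- vertex of `X`, so each step still costs a factor of at most 24Qx/n. The exponent 6x is chosen
  -- to exceed by 2x the roughly (n/x)^(4x) choices of `X` and `W`.
  dense-few : ∀ B X W → 1 ≤ size X → size X ≤ n → size W ≤ 3 * size X →
    n ^ (6 * size X) * # (Reg d n) (dense? s B X W) ≤ (24 * Q * size X) ^ (6 * size X) * length (Reg d n)
  dense-few B X W 1≤x x≤n Wx = begin
    n ^ t * # (Reg d n) (dense? s B X W)
      ≤⟨ *-monoʳ-≤ (n ^ t) (#-mono (Reg d n) (dense? s B X W) (λ G → dense? s B X W G ×-dec (∅ ⊑? adj G)) λ G t → t , ∅⊑ (adj G)) ⟩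
    n ^ t * # (Reg d n) (λ G → dense? s B X W G ×-dec (∅ ⊑? adj G))
      ≤⟨ exposure t ∅ ∅-sym (≤-reflexive (trans (cong (_+ 2 * t) (tot-∅ {n})) (r₁ x))) ⟩
    (24 * Q * x) ^ t * cnt d n ∅ ≡⟨ cong ((24 * Q * x) ^ t *_) (#-all (Reg d n) (λ G → ∅ ⊑? adj G) λ G _ → ∅⊑ (adj G)) ⟩
    (24 * Q * x) ^ t * length (Reg d n) ∎
    where
    open ≤-Reasoning
    x = size X
    t = 6 * x
    0<dn : 0 < d * n
    0<dn = *-mono-≤ {1} (≤-trans (s≤s z≤n) 48≤d) (≤-trans (s≤s z≤n) n-large)
    r₁ : ∀ x → 2 * (6 * x) ≡ 12 * x
    r₁ = solve-∀
    step : ∀ F → Sym F → tot F ≤ 12 * x → ∃ λ v → Mem X v × ∃ λ k → ∃ λ e → 0 < k × 0 < e × k + dg F v ≤ s ×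
      e + slack d n ≤ totres d n F × n * (res d n F v * ∑ (V n) (λ y → ι (mem? W y) * res d n F y)) ≤ 24 * Q * x * (k * e)
    step F sF le = v , proj₁ (proj₂ low) , k , e , 0<k , 0<e ,
      ≤-reflexive (m∸n+n≡m {s} {f} (<⇒≤ (m∸n≢0⇒n<m {s} {f} (>⇒≢ 0<k)))) ,
      ≤-reflexive (m∸n+n≡m {E} {slack d n} (<⇒≤ (m∸n≢0⇒n<m {E} {slack d n} (>⇒≢ 0<e)))) , key
      where
      low : ∃ λ v → Mem X v × 2 * dg F v ≤ s
      low = low-degree F (mem? X) 2 s (begin-strict
        2 * tot F ≤⟨ *-monoʳ-≤ 2 le ⟩
        2 * (12 * x) ≡⟨ r x ⟩
        x * 24 ≤⟨ *-monoʳ-≤ x 24≤s ⟩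
        x * s <⟨ m<n+m (x * s) 1≤x ⟩
        x + x * s ≡⟨ *-suc x s ⟨
        x * suc s ∎)
        where
        r : ∀ x → 2 * (12 * x) ≡ x * 24
        r = solve-∀
      v = proj₁ low
      f = dg F v
      k = s ∸ f
      E = totres d n F
      e = E ∸ slack d n
      T = ∑ (V n) (λ y → ι (mem? W y) * res d n F y)
      2k : s ≤ 2 * k
      2k = begin
        s ≤⟨ m+n≤o⇒m≤o∸n s (≤-trans (+-monoʳ-≤ s (proj₂ (proj₂ low))) (≤-reflexive (cong (s +_) (sym (+-identityʳ s))))) ⟩
        2 * s ∸ 2 * f ≡⟨ *-distribˡ-∸ 2 s f ⟨
        2 * k ∎
      4slack : 4 * slack d n ≤ d * n
      4slack = begin
        4 * (2 * d * (d + 1)) ≡⟨ r d ⟩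
        d * (8 * suc d) ≤⟨ *-monoʳ-≤ d (≤-trans (*-monoˡ-≤ (suc d) {8} {200} (m≤m+n 8 192)) n-large) ⟩
        d * n ∎
        where
        r : ∀ d → 4 * (2 * d * (d + 1)) ≡ d * (8 * suc d)
        r = solve-∀
      4tot : 4 * tot F ≤ d * n
      4tot = begin
        4 * tot F ≤⟨ *-monoʳ-≤ 4 le ⟩
        4 * (12 * x) ≡⟨ r x ⟩
        48 * x ≤⟨ *-mono-≤ 48≤d x≤n ⟩
        d * n ∎
        where
        r : ∀ x → 4 * (12 * x) ≡ 48 * x
        r = solve-∀
      4e : 2 * (d * n) ≤ 4 * e
      4e = begin
        2 * (d * n) ≤⟨ m+n≤o⇒m≤o∸n (2 * (d * n)) (+-cancelʳ-≤ (4 * tot F) _ _ (begin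
          2 * (d * n) + 4 * slack d n + 4 * tot F ≤⟨ +-mono-≤ (+-monoʳ-≤ (2 * (d * n)) 4slack) 4tot ⟩
          2 * (d * n) + d * n + d * n ≡⟨ r (d * n) ⟩
          4 * (d * n) ≤⟨ *-monoʳ-≤ 4 (totres-bound d n F) ⟩
          4 * (E + tot F) ≡⟨ *-distribˡ-+ 4 E (tot F) ⟩
          4 * E + 4 * tot F ∎)) ⟩
        4 * E ∸ 4 * slack d n ≡⟨ *-distribˡ-∸ 4 E (slack d n) ⟨
        4 * e ∎
        where
        r : ∀ x → 2 * x + x + x ≡ 4 * x
        r = solve-∀
      0<k = pos-cancel 2 k {s} (≤-trans (s≤s z≤n) 24≤s) 2k
      0<e = pos-cancel 4 e {2 * (d * n)} (≤-trans 0<dn (m≤m+n (d * n) _)) 4e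
      -- 24 = 3 * 4 * 2, from `|W| ≤ 3x`, `d ≤ 2Qs ≤ 4Qk` and `dn ≤ 2e`.
      key : n * (res d n F v * T) ≤ 24 * Q * x * (k * e)
      key = begin
        n * (res d n F v * T) ≤⟨ *-monoʳ-≤ n (*-mono-≤ (m∸n≤m d f) (≤-trans (∑res≤ d n F (mem? W)) (*-monoˡ-≤ d Wx))) ⟩
        n * (d * (3 * x * d)) ≡⟨ r₂ n d x ⟩
        3 * x * (d * n) * d ≤⟨ *-monoʳ-≤ (3 * x * (d * n)) d≤ ⟩
        3 * x * (d * n) * (2 * Q * s) ≡⟨ r₃ x (d * n) Q s ⟩
        3 * x * Q * (s * (2 * (d * n))) ≤⟨ *-monoʳ-≤ (3 * x * Q) (*-mono-≤ 2k 4e) ⟩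
        3 * x * Q * (2 * k * (4 * e)) ≡⟨ r₄ x Q k e ⟩
        24 * Q * x * (k * e) ∎
        where
        r₂ : ∀ n d x → n * (d * (3 * x * d)) ≡ 3 * x * (d * n) * d
        r₂ = solve-∀
        r₃ : ∀ x y q s → 3 * x * y * (2 * q * s) ≡ 3 * x * q * (s * (2 * y))
        r₃ = solve-∀
        r₄ : ∀ x q k e → 3 * x * q * (2 * k * (4 * e)) ≡ 24 * q * x * (k * e)
        r₄ = solve-∀
    open Exposure {d} {n} (dense? s B X W) {Mem X} (λ _ → mem? W) s n (24 * Q * x) (12 * x) (λ G _ b v m → Dense.inward b v m) step

  private
    Vs : List (Vec Bool n)
    Vs = allVecs bools n

  dense-total : ℕ → ℕ
  dense-total B = ∑ Vs (λ X → ∑ Vs (λ W → # (Reg d n) (dense? s B X W)))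

  module _ (B : ℕ) (B-def : B ≡ 4 * (24 * Q * (24 * Q) * (24 * Q))) where

    private
      c : Vec Bool n → Vec Bool n → ℕ
      c X W = # (Reg d n) (dense? s B X W)

      f = length (Reg d n)

      c-none : ∀ X W → ¬ (1 ≤ size X × 2 * B * size X ≤ n × size W ≤ 3 * size X) → c X W ≡ 0
      c-none X W ¬h = #-none (Reg d n) (dense? s B X W) λ G _ b → ¬h (Dense.sizes b)

      -- Index `i` stands for size `i + 1`, since the empty set is never dense.
      layer : Fin n → ℕ
      layer i = ∑ Vs (λ X → ∑ Vs (λ W → ι (size X ≟ suc (toℕ i)) * c X W))

      size≤n : ∀ X → size X ≤ n
      size≤n X = ≤-trans (#≤length (V n) (mem? X)) (≤-reflexive (V-length n))

      spread : ∀ X W → c X W ≤ ∑ (V n) (λ i → ι (size X ≟ suc (toℕ i)) * c X W)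
      spread X W = go (size X) refl
        where
        go : ∀ m → size X ≡ m → c X W ≤ ∑ (V n) (λ i → ι (size X ≟ suc (toℕ i)) * c X W)
        go zero e = ≤-trans (≤-reflexive (c-none X W λ h → <⇒≱ (proj₁ h) (≤-reflexive e))) z≤n
        go (suc m) e = ≤-trans (≤-reflexive (trans (sym (*-identityˡ (c X W))) (cong (_* c X W)
            (sym (ι-yes (size X ≟ suc (toℕ i)) (trans e (cong suc (sym (F.toℕ-fromℕ< m<n)))))))))
          (∑-∈ (λ i → ι (size X ≟ suc (toℕ i)) * c X W) (∈-allFin i))
          where
          m<n : m < n
          m<n = ≤-trans (≤-reflexive (sym e)) (size≤n X)
          i = fromℕ< m<n

      dense-total≤ : dense-total B ≤ ∑ (V n) layer
      dense-total≤ = ≤-trans (∑-mono Vs λ X → ∑-mono Vs (spread X))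
        (≤-reflexive (trans (∑-cong Vs λ X → ∑-swap Vs (V n) (λ W i → ι (size X ≟ suc (toℕ i)) * c X W))
          (∑-swap Vs (V n) (λ X i → ∑ Vs (λ W → ι (size X ≟ suc (toℕ i)) * c X W)))))

      layer-bound : ∀ i → layer i * (n * n) ≤ B * B * f
      layer-bound i = go (2 * B * x ≤? n)
        where
        open ≤-Reasoning
        x = suc (toℕ i)
        1≤n : 1 ≤ n
        1≤n = ≤-trans (s≤s z≤n) (F.toℕ<n i)
        go : Dec (2 * B * x ≤ n) → layer i * (n * n) ≤ B * B * f
        go (no ¬le) = ≤-trans (≤-reflexive (cong (_* (n * n)) (trans (∑-cong Vs λ X → trans (∑-cong Vs (zero′ X)) (∑-0 Vs)) (∑-0 Vs)))) z≤n
          where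
          zero′ : ∀ X W → ι (size X ≟ x) * c X W ≡ 0
          zero′ X W with size X ≟ x
          ... | no _ = refl
          ... | yes e = trans (*-identityˡ (c X W)) (c-none X W λ h → ¬le (subst (λ k → 2 * B * k ≤ n) e (proj₁ (proj₂ h))))
        go (yes le) = union-bound (24 * Q) B (toℕ i) n (layer i) (# Vs (λ X → countTrue X ≤? x)) (# Vs (λ W → countTrue W ≤? 3 * x)) f
          B-def 1≤n le (few-small-sets n x x 1≤n x≤n) (few-small-sets n x (3 * x) 1≤n x≤n) (begin
          n ^ (6 * x) * layer i ≡⟨ ∑-*ˡ Vs (n ^ (6 * x)) _ ⟨
          ∑ Vs (λ X → n ^ (6 * x) * ∑ Vs (λ W → ι (size X ≟ x) * c X W))
            ≡⟨ ∑-cong Vs (λ X → sym (∑-*ˡ Vs (n ^ (6 * x)) (λ W → ι (size X ≟ x) * c X W))) ⟩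
          ∑ Vs (λ X → ∑ Vs (λ W → n ^ (6 * x) * (ι (size X ≟ x) * c X W)))
            ≤⟨ ∑-mono Vs (λ X → ∑-mono Vs (per X)) ⟩
          ∑ Vs (λ X → ∑ Vs (λ W → ι (countTrue X ≤? x) * (ι (countTrue W ≤? 3 * x) * Z)))
            ≡⟨ ∑-cong Vs (λ X → trans (∑-*ˡ Vs (ι (countTrue X ≤? x)) (λ W → ι (countTrue W ≤? 3 * x) * Z)) (cong (ι (countTrue X ≤? x) *_) (∑-*ʳ Vs Z (λ W → ι (countTrue W ≤? 3 * x))))) ⟩
          ∑ Vs (λ X → ι (countTrue X ≤? x) * (# Vs (λ W → countTrue W ≤? 3 * x) * Z))
            ≡⟨ ∑-*ʳ Vs (# Vs (λ W → countTrue W ≤? 3 * x) * Z) (λ X → ι (countTrue X ≤? x)) ⟩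
          # Vs (λ X → countTrue X ≤? x) * (# Vs (λ W → countTrue W ≤? 3 * x) * Z)
            ≡⟨ r (# Vs (λ X → countTrue X ≤? x)) (# Vs (λ W → countTrue W ≤? 3 * x)) ((24 * Q * x) ^ (6 * x)) f ⟩
          # Vs (λ X → countTrue X ≤? x) * # Vs (λ W → countTrue W ≤? 3 * x) * (24 * Q * x) ^ (6 * x) * f ∎)
          where
          Z = (24 * Q * x) ^ (6 * x) * f
          x≤n : x ≤ n
          x≤n = F.toℕ<n i
          r : ∀ a b c e → a * (b * (c * e)) ≡ a * b * c * e
          r = solve-∀
          per : ∀ X W → n ^ (6 * x) * (ι (size X ≟ x) * c X W) ≤ ι (countTrue X ≤? x) * (ι (countTrue W ≤? 3 * x) * Z)
          per X W = both (size X ≟ x) (size W ≤? 3 * x)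
            where
            both : (p : Dec (size X ≡ x)) → Dec (size W ≤ 3 * x) → n ^ (6 * x) * (ι p * c X W) ≤ ι (countTrue X ≤? x) * (ι (countTrue W ≤? 3 * x) * Z)
            both (no _) _ = ≤-trans (≤-reflexive (*-zeroʳ (n ^ (6 * x)))) z≤n
            both (yes e) (no ¬le) = ≤-trans (≤-reflexive (trans (cong (n ^ (6 * x) *_) (trans (*-identityˡ (c X W))
              (c-none X W λ h → ¬le (subst (λ k → size W ≤ 3 * k) e (proj₂ (proj₂ h)))))) (*-zeroʳ (n ^ (6 * x))))) z≤n
            both (yes e) (yes le) = begin
              n ^ (6 * x) * (1 * c X W) ≡⟨ cong (n ^ (6 * x) *_) (*-identityˡ (c X W)) ⟩
              n ^ (6 * x) * c X W ≤⟨ subst (λ k → n ^ (6 * k) * c X W ≤ (24 * Q * k) ^ (6 * k) * f) e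
                (dense-few B X W (≤-trans (s≤s z≤n) (≤-reflexive (sym e))) (size≤n X) (subst (λ k → size W ≤ 3 * k) (sym e) le)) ⟩
              Z ≡⟨ trans (cong₂ (λ a b → a * (b * Z)) (ι-yes (countTrue X ≤? x) (≤-reflexive (trans (countTrue≡# X) e)))
                     (ι-yes (countTrue W ≤? 3 * x) (subst (_≤ 3 * x) (sym (countTrue≡# W)) le)))
                     (trans (*-identityˡ (1 * Z)) (*-identityˡ Z)) ⟨
              ι (countTrue X ≤? x) * (ι (countTrue W ≤? 3 * x) * Z) ∎

    -- There are `n` layers, each contributing at most the fraction `B² / n²` of all regular graphs.
    dense-bound : dense-total B * n ≤ B * B * f
    dense-bound = *-cancelʳ-≤ _ _ n {{>-nonZero 0<n}} (begin
      dense-total B * n * n ≡⟨ *-assoc (dense-total B) n n ⟩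
      dense-total B * (n * n) ≤⟨ *-monoˡ-≤ (n * n) dense-total≤ ⟩
      ∑ (V n) layer * (n * n) ≡⟨ ∑-*ʳ (V n) (n * n) layer ⟨
      ∑ (V n) (λ i → layer i * (n * n)) ≤⟨ ∑-≤const (V n) (B * B * f) (λ i _ → layer-bound i) ⟩
      length (V n) * (B * B * f) ≡⟨ trans (cong (_* (B * B * f)) (V-length n)) (*-comm n _) ⟩
      B * B * f * n ∎)
      where
      open ≤-Reasoning
      0<n : 0 < n
      0<n = ≤-trans (s≤s z≤n) n-large

-- Budget, with s = ⌊d/Q⌋: the sparse graph Γ has at most 3sn arcs, hence at most 4^(16sn) (2^20)^(3sn) ≤ 2^(92sn) choices
-- inside G, while 32·160sn exposures gain 2^(160sn).  Q-large keeps the arcs of Γ and of the exposures below dn/400.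
module Core (Q : ℕ) (Q-large : 100 * (4 * (3 + 2 * (32 * 160))) ≤ Q) (Q-small : 2 * Q ≤ 2 ^ 20 * 16) where

  -- With `q = 24Q`, `B = 4q³` satisfies `B² = 16q⁶`, the base left by the union bound over dense
  -- sets. The share of arcs crossing a big cut is `1 / suc c`. Since `s₀ ≥ 6c + 2`, the `s` edges
  -- at each vertex take two thirds of the budget `M`, and the hitting set together with `n`
  -- boosters fits into the last third.
  B c s₀ : ℕ
  B = 4 * (24 * Q * (24 * Q) * (24 * Q))
  c = pred (120 * B)
  s₀ = 6 * suc c + 4

  private
    640≤Q : 640 ≤ Q
    640≤Q = ≤-trans (≤ᵇ⇒≤ 640 _ _) Q-large

    1≤Q : 1 ≤ Q
    1≤Q = ≤-trans (s≤s z≤n) 640≤Q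

    1≤B : 1 ≤ B
    1≤B = *-mono-≤ {1} {4} (s≤s z≤n) (*-mono-≤ {1} (*-mono-≤ {1} 1≤24Q 1≤24Q) 1≤24Q)
      where
      1≤24Q : 1 ≤ 24 * Q
      1≤24Q = *-mono-≤ {1} {24} (s≤s z≤n) 1≤Q

    120≤ : 120 ≤ 120 * B
    120≤ = ≤-trans (≤-reflexive (sym (*-identityʳ 120))) (*-monoʳ-≤ 120 1≤B)

    c-def : suc c ≡ 120 * B
    c-def = suc-pred (120 * B) {{>-nonZero (≤-trans (s≤s z≤n) 120≤)}}

    119≤c : 119 ≤ c
    119≤c = s≤s⁻¹ (≤-trans 120≤ (≤-reflexive (sym c-def)))

    c≤s₀ : suc c ≤ s₀
    c≤s₀ = ≤-trans (m≤m+n (suc c) _) (m≤m+n (6 * suc c) 4)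

    24≤s₀ : 24 ≤ s₀
    24≤s₀ = ≤-trans (≤-trans (≤-trans (m≤m+n 24 95) 119≤c) (n≤1+n c)) c≤s₀

  module _ (d : ℕ) (d-large : Q * s₀ ≤ d) where

    private instance
      Q≢0 : NonZero Q
      Q≢0 = >-nonZero 1≤Q

    s : ℕ
    s = d / Q

    private
      s₀≤s : s₀ ≤ s
      s₀≤s = ≤-trans (≤-reflexive (sym (m*n/n≡m s₀ Q))) (/-monoˡ-≤ Q (≤-trans (≤-reflexive (*-comm s₀ Q)) d-large))

      24≤s : 24 ≤ s
      24≤s = ≤-trans 24≤s₀ s₀≤s

      1≤s : 1 ≤ s
      1≤s = ≤-trans (s≤s z≤n) 24≤s

      Qs≤d : Q * s ≤ d
      Qs≤d = ≤-trans (≤-reflexive (*-comm Q s)) (m/n*n≤m d Q)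

      d≤2Qs : d ≤ 2 * Q * s
      d≤2Qs = begin
        d ≡⟨ m≡m%n+[m/n]*n d Q ⟩
        d % Q + s * Q ≤⟨ +-monoˡ-≤ (s * Q) (≤-trans (<⇒≤ (m%n<n d Q)) (≤-trans (≤-reflexive (sym (*-identityˡ Q))) (*-monoˡ-≤ Q 1≤s))) ⟩
        s * Q + s * Q ≡⟨ r s Q ⟩
        2 * Q * s ∎
        where
        open ≤-Reasoning
        r : ∀ s q → s * q + s * q ≡ 2 * q * s
        r = solve-∀

      2s≤d : 2 * s ≤ d
      2s≤d = ≤-trans (*-monoˡ-≤ s (≤-trans (m≤m+n 2 638) 640≤Q)) Qs≤d

      48≤d : 48 ≤ d
      48≤d = ≤-trans (*-monoʳ-≤ 2 24≤s) 2s≤d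

      1≤d : 1 ≤ d
      1≤d = ≤-trans (s≤s z≤n) 48≤d

      Bd : 76800 * B ≤ d
      Bd = begin
        76800 * B ≡⟨ *-assoc 640 120 B ⟩
        640 * (120 * B) ≤⟨ *-mono-≤ 640≤Q (≤-trans (≤-reflexive (sym c-def)) (≤-trans c≤s₀ s₀≤s)) ⟩
        Q * s ≤⟨ Qs≤d ⟩
        d ∎
        where open ≤-Reasoning

    module _ (n : ℕ) (n-large : 200 * suc d ≤ n) where

      M K : ℕ
      M = 3 * s * n
      K = c * (3 * n)

      private
        8≤n : 8 ≤ n
        8≤n = ≤-trans (≤-trans (m≤m+n 8 192) (m≤m*n 200 (suc d))) n-large

        M-large : 2 * ((n * s + K) + n) ≤ M
        M-large = begin
          2 * ((n * s + c * (3 * n)) + n) ≡⟨ r₁ n s c ⟩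
          n * (2 * s + (6 * c + 2)) ≤⟨ *-monoʳ-≤ n (+-monoʳ-≤ (2 * s) 6c) ⟩
          n * (2 * s + s) ≡⟨ r₂ n s ⟩
          3 * s * n ∎
          where
          open ≤-Reasoning
          r₁ : ∀ n s c → 2 * ((n * s + c * (3 * n)) + n) ≡ n * (2 * s + (6 * c + 2))
          r₁ = solve-∀
          r₂ : ∀ n s → n * (2 * s + s) ≡ 3 * s * n
          r₂ = solve-∀
          6c : 6 * c + 2 ≤ s
          6c = ≤-trans (+-mono-≤ (*-monoʳ-≤ 6 (n≤1+n c)) (m≤m+n 2 2)) s₀≤s

        -- The `3cn` greedy choices shrink the family by a factor of at least `2^(3n)`, against at
        -- most `4^n` pairs.
        hits-enough : c ^ K * 4 ^ n < suc c ^ K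
        hits-enough = begin-strict
          c ^ K * 4 ^ n ≡⟨ cong (c ^ K *_) (^-*-assoc 2 2 n) ⟩
          c ^ K * 2 ^ (2 * n) <⟨ *-monoʳ-< (c ^ K) {{m^n≢0 c K {{>-nonZero (≤-trans (s≤s z≤n) 119≤c)}}}} (^-monoʳ-< 2 (s≤s (s≤s z≤n)) (*-monoˡ-< n {{>-nonZero (≤-trans (s≤s z≤n) 8≤n)}} {2} {3} ≤-refl)) ⟩
          c ^ K * 2 ^ (3 * n) ≡⟨ *-comm (c ^ K) (2 ^ (3 * n)) ⟩
          2 ^ (3 * n) * c ^ K ≤⟨ power-gap c (3 * n) (≤-trans (s≤s z≤n) 119≤c) ⟩
          suc c ^ K ∎
          where open ≤-Reasoning

        exposures : 100 * (4 * (M + 2 * (32 * (160 * s * n)))) ≤ d * n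
        exposures = begin
          100 * (4 * (3 * s * n + 2 * (32 * (160 * s * n)))) ≡⟨ r 100 4 3 2 32 160 s n ⟩
          100 * (4 * (3 + 2 * (32 * 160))) * s * n ≤⟨ *-monoˡ-≤ n (≤-trans (*-monoˡ-≤ s Q-large) Qs≤d) ⟩
          d * n ∎
          where
          open ≤-Reasoning
          r : ∀ a b e f g h s n → a * (b * (e * s * n + f * (g * (h * s * n)))) ≡ a * (b * (e + f * (g * h))) * s * n
          r = solve-∀

        arcs : n * d ≤ 2 ^ 20 * (16 * s * n)
        arcs = begin
          n * d ≤⟨ *-monoʳ-≤ n (≤-trans d≤2Qs (*-monoˡ-≤ s Q-small)) ⟩
          n * (2 ^ 20 * 16 * s) ≡⟨ r n (2 ^ 20) 16 s ⟩
          2 ^ 20 * (16 * s * n) ∎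
          where
          open ≤-Reasoning
          r : ∀ n a b s → n * (a * b * s) ≡ a * (b * s * n)
          r = solve-∀

        -- In units of `sn`: 32 from `4^b`, 60 from `(2^20)^M`, and 1 covering the extra factor
        -- `2^n`; 93 against 160.
        exponents : 2 * (16 * s * n) + 20 * M + n ≤ 160 * s * n
        exponents = begin
          2 * (16 * s * n) + 20 * (3 * s * n) + n ≤⟨ +-monoʳ-≤ (2 * (16 * s * n) + 20 * (3 * s * n)) (≤-trans (≤-reflexive (sym (*-identityˡ n))) (*-monoˡ-≤ n 1≤s)) ⟩
          2 * (16 * s * n) + 20 * (3 * s * n) + s * n ≡⟨ r 2 16 20 3 s n ⟩
          (2 * 16 + 20 * 3 + 1) * s * n ≤⟨ *-monoˡ-≤ n (*-monoˡ-≤ s {93} {160} (m≤m+n 93 67)) ⟩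
          160 * s * n ∎
          where
          open ≤-Reasoning
          r : ∀ a b e f s n → a * (b * s * n) + e * (f * s * n) + s * n ≡ (a * b + e * f + 1) * s * n
          r = solve-∀

        Vs : List (Vec Bool n)
        Vs = allVecs bools n

        f : ℕ
        f = length (Reg d n)

        -- The number of exceptional configurations in `G`. Its average over regular graphs is
        -- O(1/n), so by Markov's inequality most graphs have cost 0.
        cost₁ cost₂ cost₃ cost : Mat n → ℕ
        cost₁ G = ∑ Vs (λ X → ∑ Vs (λ W → ι (dense? s B X W G)))
        cost₂ G = ∑ Vs (λ X → ∑ Vs (λ W → ι (trapped? d B X W G)))
        cost₃ G = ∑ (allMats n) (λ Γ → ι (sparse? M Γ) * ι (unboosted? d Γ G ×-dec (adj Γ ⊑? adj G)))
        cost G = cost₁ G + cost₂ G + cost₃ G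

        total : ∑ (Reg d n) cost ≡ dense-total {d} {n} Q s 24≤s 48≤d d≤2Qs n-large B
          + trapped-total 1≤d n-large B + unboosted-total 1≤d n-large M
        total = trans (∑-+ (Reg d n) (λ G → cost₁ G + cost₂ G) cost₃) (cong₂ _+_ (trans (∑-+ (Reg d n) cost₁ cost₂) (cong₂ _+_
          (trans (∑-swap (Reg d n) Vs _) (∑-cong Vs λ X → ∑-swap (Reg d n) Vs _))
          (trans (∑-swap (Reg d n) Vs _) (∑-cong Vs λ X → ∑-swap (Reg d n) Vs _))))
          (trans (∑-swap (Reg d n) (allMats n) _) (∑-cong (allMats n) λ Γ →
            ∑-*ˡ (Reg d n) (ι (sparse? M Γ)) (λ G → ι (unboosted? d Γ G ×-dec (adj Γ ⊑? adj G))))))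

        total-bound : ∑ (Reg d n) cost * n ≤ (B * B + 2) * f
        total-bound = begin
          ∑ (Reg d n) cost * n ≡⟨ cong (_* n) total ⟩
          (D₁ + D₂ + D₃) * n ≡⟨ r₁ D₁ D₂ D₃ n ⟩
          D₁ * n + D₂ * n + D₃ * n ≤⟨ +-mono-≤ (+-mono-≤ (dense-bound Q s 24≤s 48≤d d≤2Qs n-large B refl)
            (trapped-bound 1≤d n-large B Bd)) (unboosted-bound 1≤d n-large M (160 * s * n) (16 * s * n) 20 exposures arcs exponents) ⟩
          B * B * f + f + f ≡⟨ r₂ (B * B) f ⟩
          (B * B + 2) * f ∎
          where
          open ≤-Reasoning
          D₁ = dense-total {d} {n} Q s 24≤s 48≤d d≤2Qs n-large B
          D₂ = trapped-total 1≤d n-large B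
          D₃ = unboosted-total 1≤d n-large M
          r₁ : ∀ a b c n → (a + b + c) * n ≡ a * n + b * n + c * n
          r₁ = solve-∀
          r₂ : ∀ b f → b * f + f + f ≡ (b + 2) * f
          r₂ = solve-∀

        cheap? : (G : Mat n) → Dec (cost G ≡ 0)
        cheap? G = cost G ≟ 0

      good : List (Mat n)
      good = filter cheap? (Reg d n)

      private
        bad : ℕ
        bad = # (Reg d n) (λ G → ¬? (cheap? G))

        good+bad : length good + bad ≡ f
        good+bad = trans (cong (_+ bad) (sym (#≡length (Reg d n) cheap?))) (#-¬ (Reg d n) cheap?)

        bad≤cost : bad ≤ ∑ (Reg d n) cost
        bad≤cost = ∑-mono (Reg d n) per
          where
          per : ∀ G → ι (¬? (cheap? G)) ≤ cost G
          per G = go (cost G) refl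
            where
            go : ∀ m → cost G ≡ m → ι (¬? (cheap? G)) ≤ cost G
            go zero e = ≤-trans (≤-reflexive (ι-no (¬? (cheap? G)) λ ¬e → ¬e e)) z≤n
            go (suc m) e = ≤-trans (ι≤1 (¬? (cheap? G))) (≤-trans (s≤s z≤n) (≤-reflexive (sym e)))

      good-unique : Unique good
      good-unique = U.filter⁺ cheap? (Reg-unique d n)

      -- `a / b` is the tolerated failure probability. As `a ≥ 1`, a share of at most `1 / b` bad
      -- graphs suffices, which the lower bound on `n` guarantees.
      good-many : ∀ a b → 1 ≤ a → 1 ≤ b → b * (B * B + 2) ≤ n → (b ∸ a) * f ≤ length good * b
      good-many a b 1≤a 1≤b bn = +-cancelʳ-≤ f _ _ (begin
        (b ∸ a) * f + f ≡⟨ +-comm _ f ⟩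
        suc (b ∸ a) * f ≤⟨ *-monoˡ-≤ f (≤-trans (s≤s (∸-monoʳ-≤ b 1≤a)) (≤-reflexive (m+[n∸m]≡n 1≤b))) ⟩
        b * f ≡⟨ trans (cong (b *_) (sym good+bad)) (r₁ b (length good) bad) ⟩
        length good * b + bad * b ≤⟨ +-monoʳ-≤ (length good * b) bad-few ⟩
        length good * b + f ∎)
        where
        open ≤-Reasoning
        r₁ : ∀ b g h → b * (g + h) ≡ g * b + h * b
        r₁ = solve-∀
        bad-few : bad * b ≤ f
        bad-few = *-cancelˡ-≤ (B * B + 2) {{>-nonZero (≤-trans (s≤s z≤n) (m≤n+m 2 (B * B)))}} (begin
          (B * B + 2) * (bad * b) ≡⟨ r₂ (B * B + 2) bad b ⟩
          bad * (b * (B * B + 2)) ≤⟨ *-mono-≤ bad≤cost bn ⟩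
          ∑ (Reg d n) cost * n ≤⟨ total-bound ⟩
          (B * B + 2) * f ∎)
          where
          r₂ : ∀ m h b → m * (h * b) ≡ h * (b * m)
          r₂ = solve-∀

      module _ (G : Mat n) (free : cost G ≡ 0) where
        private
          free₁₂ : cost₁ G + cost₂ G ≡ 0
          free₁₂ = m+n≡0⇒m≡0 (cost₁ G + cost₂ G) free

          vec∈ : ∀ (X : Vec Bool n) → X ∈ Vs
          vec∈ X = ∈-allVecs X λ i → ∈-bools (lookup X i)

        not-dense : ∀ X W → ¬ Dense s B X W G
        not-dense X W = ι≡0⇒¬ (dense? s B X W G) (∑≡0 (λ W → ι (dense? s B X W G))
          (∑≡0 (λ X → ∑ Vs (λ W → ι (dense? s B X W G))) (m+n≡0⇒m≡0 (cost₁ G) free₁₂) (vec∈ X)) (vec∈ W))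

        not-trapped : ∀ X W → ¬ Trapped d B X W G
        not-trapped X W = ι≡0⇒¬ (trapped? d B X W G) (∑≡0 (λ W → ι (trapped? d B X W G))
          (∑≡0 (λ X → ∑ Vs (λ W → ι (trapped? d B X W G))) (m+n≡0⇒n≡0 (cost₁ G) free₁₂) (vec∈ X)) (vec∈ W))

        not-unboosted : ∀ Γ → Sparse M Γ → adj Γ ⊑ adj G → ¬ Unboosted d Γ G
        not-unboosted Γ sp sub u = ι≡0⇒¬ (unboosted? d Γ G ×-dec (adj Γ ⊑? adj G))
          (trans (sym (*-identityˡ _)) (trans (cong (_* ι (unboosted? d Γ G ×-dec (adj Γ ⊑? adj G))) (sym (ι-yes (sparse? M Γ) sp)))
            (∑≡0 (λ Γ → ι (sparse? M Γ) * ι (unboosted? d Γ G ×-dec (adj Γ ⊑? adj G))) (m+n≡0⇒n≡0 (cost₁ G + cost₂ G) free) (∈-allMats Γ))))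
          (u , sub)

      resilient : ∀ {G} → G ∈ good → ∀ H → SubgraphOf H G → (∀ v → 6 * dg (adj H) v < d) → Hamiltonian (minus G H)
      resilient {G} G∈ H sub few = hamiltonian (minus G H) (≤-trans (m≤m+n 3 5) 8≤n)
        (Deterministic.hamilton-cycle s B c K M G (adj H) (adj (minus G H)) reg D-sym (λ i j e → proj₁ (minus⁻ G H e))
          (λ i j → minus⁺ G H) few 8≤n 2s≤d c-def M-large hits-enough (not-dense G free) (not-trapped G free) (not-unboosted G free))
        where
        reg = Reg⇒ (proj₁ (∈-filter⁻ cheap? {xs = Reg d n} G∈))
        free = proj₂ (∈-filter⁻ cheap? {xs = Reg d n} G∈)
        D-sym : Sym (adj (minus G H))
        D-sym i j e = minus⁺ G H (reg-sym G reg i j (proj₁ (minus⁻ G H e)))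
          λ h → proj₂ (minus⁻ G H e) (trans (proj₁ (proj₁ sub) i j) h)

      good-regular : ∀ {G} → G ∈ good → Regular d G
      good-regular G∈ = Reg⇒ (proj₁ (∈-filter⁻ cheap? {xs = Reg d n} G∈))

theorem4 : (p q : ℕ) → 1 ≤ p → 1 ≤ q →
    ∃ λ d₀ → 1 ≤ d₀ × ((d : ℕ) → d₀ ≤ d →
    (a b : ℕ) → 1 ≤ a → 1 ≤ b →
    ∃ λ N → (n : ℕ) → N ≤ n → 2 ∣ d * n →
    Σ (List (Mat n)) λ S →
    Unique S ×
    All (λ G → Regular d G × ResilienceAtLeast p q d G) S ×
    (b ∸ a) * regCount d n ≤ length S * b)
-- Any Q from 4097200 to 8388608 meets both inequalities: the lower limit makes room for the
-- exposures, the upper one bounds the number of graphs Γ. Handing it over as a variable keeps the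
-- numeral from unfolding in types.
theorem4 p q 1≤p 1≤q = from-constants 8192000 (≤ᵇ⇒≤ _ _ _) (≤ᵇ⇒≤ _ _ _)
  where
  from-constants : ∀ Q → 100 * (4 * (3 + 2 * (32 * 160))) ≤ Q → 2 * Q ≤ 2 ^ 20 * 16 →
    ∃ λ d₀ → 1 ≤ d₀ × ((d : ℕ) → d₀ ≤ d →
    (a b : ℕ) → 1 ≤ a → 1 ≤ b →
    ∃ λ N → (n : ℕ) → N ≤ n → 2 ∣ d * n →
    Σ (List (Mat n)) λ S →
    Unique S ×
    All (λ G → Regular d G × ResilienceAtLeast p q d G) S ×
    (b ∸ a) * regCount d n ≤ length S * b)
  from-constants Q Q-large Q-small = Q * s₀ , *-mono-≤ {1} (≤-trans (s≤s z≤n) Q-large) (≤-trans (s≤s z≤n) (m≤n+m 4 (6 * suc c))) ,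
    -- The first summand makes `slack` negligible against `d * n`; the second pushes the share of
    -- bad graphs down to `1 / b`.
    λ d d-large a b 1≤a 1≤b → 200 * suc d + b * (B * B + 2) , λ n n-large _ →
      let n₁ = ≤-trans (m≤m+n (200 * suc d) _) n-large
          n₂ = ≤-trans (m≤n+m (b * (B * B + 2)) (200 * suc d)) n-large
      in good d d-large n n₁ , good-unique d d-large n n₁ ,
         All.tabulate (λ {G} G∈ → good-regular d d-large n n₁ G∈ , λ H sub few → resilient d d-large n n₁ G∈ H sub (sparse d H few)) ,
         good-many d d-large n n₁ a b 1≤a 1≤b n₂
    where
    open Core Q Q-large Q-small
    -- Since `q ∸ p ≤ q`, the hypothesis relaxes to `6 * deg * q < q * d`, and `q` cancels.
    sparse : ∀ d {n} (H : Mat n) → (∀ i → 6 * deg H i * q < (q ∸ p) * d) → ∀ v → 6 * dg (adj H) v < d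
    sparse d H few v = *-cancelʳ-< q (6 * dg (adj H) v) d (<-≤-trans (subst (λ k → 6 * k * q < (q ∸ p) * d) (deg≡dg H v) (few v))
      (≤-trans (*-monoˡ-≤ d (m∸n≤m q p)) (≤-reflexive (*-comm q d))))
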